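{- There is an absolute constant $C>0$ such that for every odd prime power $q$ we have $$N(q) \le \exp\left(C q^{1/2}\right),$$ where $N(q)$ is the number of pairs $(\mathcal{A},\mathcal{B})$ of subsets $\mathcal{A},\mathcal{B}\subseteq \mathbb{F}_q$ with $\min\{\#\mathcal{A},\#\mathcal{B}\}\ge 2$ and $\mathcal{A}+\mathcal{B}=\mathcal{Q}$, with $\mathcal{Q}=\{x^2 : x\in\mathbb{F}_q^*\}$ the set of nonzero squares (quadratic residues) of $\mathbb{F}_q$.
   Context: $\mathbb{F}_q$ is the finite field with $q$ elements. For $\mathcal{A},\mathcal{B}\subseteq\mathbb{F}_q$, $\mathcal{A}+\mathcal{B}=\{a+b : a\in\mathcal{A},\ b\in\mathcal{B}\}$. A set $\mathcal{S}$ is additively decomposed into $\mathcal{A}$ and $\mathcal{B}$ if $\mathcal{S}=\mathcal{A}+\mathcal{B}$ with $\min\{\#\mathcal{A},\#\mathcal{B}\}\ge 2$. -}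

module Defs where

open import Data.Nat using (ℕ; _≤_)
open import Data.Fin using (Fin)
open import Data.Fin.Subset using (Subset; _∈_; ∣_∣)
open import Data.Product using (Σ; ∃; _×_)
open import Algebra.Core using (Op₁; Op₂)
open import Algebra.Structures using (IsCommutativeRing)
open import Relation.Binary.PropositionalEquality using (_≡_; _≢_)
open import Function.Bundles using (_⇔_)

-- A finite field with q elements, whose carrier is represented as Fin q.
-- (Every finite field of order q is isomorphic to one of these, and
-- q is then automatically a prime power.)
record FiniteFieldOn (q : ℕ) : Set where
  field
    _+_ _*_ : Op₂ (Fin q)
    -_      : Op₁ (Fin q)
    0# 1#   : Fin q
    isCommutativeRing : IsCommutativeRing _≡_ _+_ _*_ -_ 0# 1#
    0≢1     : 0# ≢ 1#
    inverse : ∀ x → x ≢ 0# → ∃ λ y → x * y ≡ 1#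

module _ {q : ℕ} (F : FiniteFieldOn q) where
  open FiniteFieldOn F

  IsNonzeroSquare : Fin q → Set
  IsNonzeroSquare z = ∃ λ x → x ≢ 0# × x * x ≡ z

  InSumset : Subset q → Subset q → Fin q → Set
  InSumset A B z = ∃ λ a → ∃ λ b → a ∈ A × b ∈ B × a + b ≡ z

  DecomposesSquares : Subset q × Subset q → Set
  DecomposesSquares (A Data.Product., B) =
    2 ≤ ∣ A ∣ × 2 ≤ ∣ B ∣ × (∀ z → InSumset A B z ⇔ IsNonzeroSquare z)

{-# OPTIONS --safe #-}
module Submission where

-- Let q = 2d + 1, let χ be the quadratic character z ↦ z^d, and let h be of the order of √q.
--
-- Stepanov's method bounds Σ_x χ(f(x)) by O(h) for a product f of at most four linear factors, one of
-- which occurs only once: the auxiliary polynomial Σ_j X^(qj) (P_j + f^d Q_j) can be chosen to vanish to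
-- order 2h wherever f^d = ε, and it is nonzero because P² f = f(0) Q² mod X^q is impossible by comparing
-- the orders at the simple root. Vanishing orders are read off from power series expansions at
-- every point rather than from derivatives, so small characteristic causes no trouble.
--
-- If A + B is the set of nonzero squares, evaluating Σ_x (1 + χ(x + a)) (1 + χ(x + b)) (Σ_{y ∈ A} χ(x + y))²
-- with a, b ∈ A bounds |A| |B| by (q/4)(1 + 2/|A|) + O(h |A|), whereas |A| |B| ≥ (q - 1)/2; hence |A| ≫ h,
-- and likewise |B| ≫ h. (For |A| = 2 this is not enough, and three-term correlations are used instead.)
--
-- The pairs are then counted by graph containers. By the second moment of Σ_{y ∈ Y} χ(x + y), only O(h)
-- points x have more than 3/4 of Y as neighbours (x + y a square). So, starting from B ⊆ Y = F_q, either A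
-- lies in this set of O(h) bad points, or some x ∈ A shrinks Y by the factor 3/4. There are O(log q)
-- steps with at most q choices each, which costs only exp(O(log² q)), and a set of O(h) points has
-- exp(O(h)) subsets; finally A confines B to its O(h) common neighbours.

open import Defs
open import Level using (0ℓ)
open import Algebra.Bundles using (CommutativeRing)
open import Data.Nat using (ℕ; suc)
import Data.Nat as ℕ
open import Data.Integer using (ℤ)
open import Data.Fin using (Fin)
open import Relation.Binary.PropositionalEquality as ≡ using (_≡_; _≢_)

-- The two weights 1 + χ(x + a) and 1 + χ(x + b) are forced by a factor of two. A point of B has
-- weight 4 while the mean weight is about 1. Without weights the second moment only gives |A| |B|
-- of size at most about q; one weight gives q/2, which is the size of the trivial lower bound and
-- hence no contradiction. Two weights give q/4, at the price of a second main term from the two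
-- ordered pairs (y, z) with {y, z} = {a, b}. For |A| = 2 that term brings the bound back to q/2.
--
-- The auxiliary polynomial comes from a pigeonhole argument on coefficient vectors: two vectors
-- impose the same expansions, and injectivity of the construction makes the difference nonzero. Two
-- constraints fix h. Unknowns must outnumber conditions, which needs q ≫ h²; and degree divided by
-- order must be q/2 + O(h), which needs q = O(h²).
--
-- The lower bounds |A|, |B| ≫ h keep the containers small: the second moment bounds the bad set for
-- Y by O(q/|Y| + h), and |Y| ≥ |B| at every step.

-- Arithmetic of the field: cancellation and Fermat's little theorem.

module Field {q : ℕ} (F : FiniteFieldOn q) where

  open import Data.Nat using (zero; suc)
  open import Data.Fin using (Fin; zero; suc)
  open import Data.Fin.Properties using (_≟_; punchInᵢ≢i; ¬Fin0)
  open import Data.Fin.Permutation using (Permutation; permutation)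
  open import Data.Vec.Functional using (removeAt)
  open import Data.Product using (_,_; proj₁; proj₂)
  open import Data.Sum using (_⊎_; inj₁; inj₂)
  open import Data.Empty using (⊥-elim)
  open import Relation.Nullary using (yes; no)
  open import Relation.Binary.PropositionalEquality

  open FiniteFieldOn F public using (isCommutativeRing; 0≢1; inverse)

  ring : CommutativeRing 0ℓ 0ℓ
  ring = record { isCommutativeRing = isCommutativeRing }

  open CommutativeRing ring public
    using (_+_; _*_; -_; 0#; 1#; commutativeSemiring; semiring; *-commutativeMonoid; +-assoc; +-comm; *-assoc; *-comm;
           distribˡ; distribʳ; +-identityˡ; +-identityʳ; *-identityˡ; *-identityʳ;
           -‿inverseˡ; -‿inverseʳ; zeroˡ; zeroʳ)
  open import Algebra.Properties.Semiring.Exp semiring public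
    using (_^_; ^-homo-*)
  open import Algebra.Properties.CommutativeSemiring.Exp commutativeSemiring public
    using (^-distrib-*)
  open import Algebra.Properties.Ring (CommutativeRing.ring ring) public
    using (-‿distribˡ-*; -‿distribʳ-*; -‿involutive)
  open import Algebra.Properties.CommutativeMonoid.Sum *-commutativeMonoid
    using () renaming (sum to prod; sum-remove to prod-remove; sum-permute to prod-permute;
      ∑-distrib-+ to ∏-distrib-*; sum-cong-≗ to prod-cong-≗; sum-replicate to prod-replicate)

  *-cancelˡ-nonZero : ∀ x {y z} → x ≢ 0# → x * y ≡ x * z → y ≡ z
  *-cancelˡ-nonZero x {y} {z} x≢0 xy≡xz with x⁻¹ , xx⁻¹≡1 ← inverse x x≢0 = begin
    y                ≡⟨ *-identityˡ y ⟨
    1# * y           ≡⟨ cong (_* y) (trans (*-comm x⁻¹ x) xx⁻¹≡1) ⟨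
    x⁻¹ * x * y      ≡⟨ *-assoc x⁻¹ x y ⟩
    x⁻¹ * (x * y)    ≡⟨ cong (x⁻¹ *_) xy≡xz ⟩
    x⁻¹ * (x * z)    ≡⟨ *-assoc x⁻¹ x z ⟨
    x⁻¹ * x * z      ≡⟨ cong (_* z) (trans (*-comm x⁻¹ x) xx⁻¹≡1) ⟩
    1# * z           ≡⟨ *-identityˡ z ⟩
    z                ∎
    where open ≡-Reasoning

  integral : ∀ {x y} → x * y ≡ 0# → x ≡ 0# ⊎ y ≡ 0#
  integral {x} {y} xy≡0 with x ≟ 0#
  ... | yes x≡0 = inj₁ x≡0
  ... | no x≢0 = inj₂ (*-cancelˡ-nonZero x x≢0 (trans xy≡0 (sym (zeroʳ x))))

  *-nonZero : ∀ {x y} → x ≢ 0# → y ≢ 0# → x * y ≢ 0#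
  *-nonZero x≢0 y≢0 xy≡0 with integral xy≡0
  ... | inj₁ x≡0 = x≢0 x≡0
  ... | inj₂ y≡0 = y≢0 y≡0

  ^-nonZero : ∀ {x} → x ≢ 0# → ∀ n → x ^ n ≢ 0#
  ^-nonZero x≢0 zero = λ 1≡0 → 0≢1 (sym 1≡0)
  ^-nonZero x≢0 (suc n) = *-nonZero x≢0 (^-nonZero x≢0 n)

  1^n≡1 : ∀ n → 1# ^ n ≡ 1#
  1^n≡1 zero = refl
  1^n≡1 (suc n) = trans (*-identityˡ _) (1^n≡1 n)

  +-cancelˡ : ∀ x {y z} → x + y ≡ x + z → y ≡ z
  +-cancelˡ x {y} {z} e = begin
    y               ≡⟨ +-identityˡ y ⟨
    0# + y          ≡⟨ cong (_+ y) (-‿inverseˡ x) ⟨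
    - x + x + y     ≡⟨ +-assoc (- x) x y ⟩
    - x + (x + y)   ≡⟨ cong (- x +_) e ⟩
    - x + (x + z)   ≡⟨ +-assoc (- x) x z ⟨
    - x + x + z     ≡⟨ cong (_+ z) (-‿inverseˡ x) ⟩
    0# + z          ≡⟨ +-identityˡ z ⟩
    z               ∎
    where open ≡-Reasoning

  x-y≡0⇒x≡y : ∀ {x y} → x + - y ≡ 0# → x ≡ y
  x-y≡0⇒x≡y {x} {y} e = +-cancelˡ (- y) (trans (+-comm (- y) x) (trans e (sym (-‿inverseˡ y))))

  -- Multiplication by x permutes the field; compare the product of all nonzero elements with its image.
  fermat : ∀ x → x ≢ 0# → ∀ n → q ≡ suc n → x ^ n ≡ 1#
  fermat x x≢0 n refl = *-cancelˡ-nonZero (prod h) prod-h≢0 (begin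
    prod h * x ^ n                        ≡⟨ *-comm (prod h) _ ⟩
    x ^ n * prod h                        ≡⟨ cong (_* prod h) prod-k ⟨
    prod k * prod h                       ≡⟨ ∏-distrib-* k h ⟨
    prod (λ y → k y * h y)                ≡⟨ prod-cong-≗ k*h ⟩
    prod (λ y → h (x * y))                ≡⟨ prod-permute h π ⟨
    prod h                                ≡⟨ *-identityʳ (prod h) ⟨
    prod h * 1#                           ∎)
    where
    open ≡-Reasoning
    x⁻¹ = proj₁ (inverse x x≢0)
    xx⁻¹≡1 = proj₂ (inverse x x≢0)

    -- `h` replaces 0 by 1, so that a product over the whole field is the product of the nonzero
    -- elements; `k` records the factor `x` which each nonzero element gains.
    h k : Fin (suc n) → Fin (suc n)
    h y with y ≟ 0#
    ... | yes _ = 1#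
    ... | no _ = y
    k y with y ≟ 0#
    ... | yes _ = 1#
    ... | no _ = x

    h-nonZero : ∀ y → h y ≢ 0#
    h-nonZero y with y ≟ 0#
    ... | yes _ = λ e → 0≢1 (sym e)
    ... | no y≢0 = y≢0

    prod-nonZero : ∀ {m} (t : Fin m → Fin (suc n)) → (∀ i → t i ≢ 0#) → prod t ≢ 0#
    prod-nonZero {zero} t _ e = 0≢1 (sym e)
    prod-nonZero {suc m} t t≢0 = *-nonZero (t≢0 zero) (prod-nonZero (λ i → t (suc i)) (λ i → t≢0 (suc i)))

    prod-h≢0 : prod h ≢ 0#
    prod-h≢0 = prod-nonZero h h-nonZero

    h-of-nonZero : ∀ {y} → y ≢ 0# → h y ≡ y
    h-of-nonZero {y} y≢0 with y ≟ 0#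
    ... | yes y≡0 = ⊥-elim (y≢0 y≡0)
    ... | no _ = refl

    h-0 : h 0# ≡ 1#
    h-0 with 0# ≟ 0#
    ... | yes _ = refl
    ... | no 0≢0 = ⊥-elim (0≢0 refl)

    k-0 : k 0# ≡ 1#
    k-0 with 0# ≟ 0#
    ... | yes _ = refl
    ... | no 0≢0 = ⊥-elim (0≢0 refl)

    k-nonZero : ∀ {y} → y ≢ 0# → k y ≡ x
    k-nonZero {y} y≢0 with y ≟ 0#
    ... | yes y≡0 = ⊥-elim (y≢0 y≡0)
    ... | no _ = refl

    k*h : ∀ y → k y * h y ≡ h (x * y)
    k*h y with y ≟ 0#
    ... | yes refl = trans (*-identityˡ 1#) (sym (trans (cong h (zeroʳ x)) h-0))
    ... | no y≢0 = sym (h-of-nonZero (*-nonZero x≢0 y≢0))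

    prod-k : prod k ≡ x ^ n
    prod-k = begin
      prod k                                ≡⟨ prod-remove {i = 0#} k ⟩
      k 0# * prod (removeAt k 0#)           ≡⟨ cong₂ _*_ k-0 (prod-cong-≗ (λ j → k-nonZero (punchInᵢ≢i 0# j))) ⟩
      1# * prod {n} (λ _ → x)               ≡⟨ *-identityˡ _ ⟩
      prod {n} (λ _ → x)                    ≡⟨ prod-replicate n ⟩
      x ^ n                                 ∎

    x⁻¹x : ∀ y → x⁻¹ * (x * y) ≡ y
    x⁻¹x y = trans (sym (*-assoc x⁻¹ x y)) (trans (cong (_* y) (trans (*-comm x⁻¹ x) xx⁻¹≡1)) (*-identityˡ y))

    xx⁻¹ : ∀ y → x * (x⁻¹ * y) ≡ y
    xx⁻¹ y = trans (sym (*-assoc x x⁻¹ y)) (trans (cong (_* y) xx⁻¹≡1) (*-identityˡ y))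

    π : Permutation (suc n) (suc n)
    π = permutation (x *_) (x⁻¹ *_) xx⁻¹ x⁻¹x

  x^q≡x-suc : ∀ n → q ≡ suc n → ∀ x → x ^ q ≡ x
  x^q≡x-suc n refl x with x ≟ 0#
  ... | yes refl = zeroˡ _
  ... | no x≢0 = trans (cong (x *_) (fermat x x≢0 n refl)) (*-identityʳ x)

  x^q≡x : ∀ x → x ^ q ≡ x
  x^q≡x = go q refl
    where
    go : ∀ r → q ≡ r → ∀ x → x ^ q ≡ x
    go zero e = λ x → ⊥-elim (¬Fin0 (subst Fin e x))
    go (suc n) e = x^q≡x-suc n e

  -- Polynomials with coefficients in the field are evaluated in two rings: in power series, to read
  -- off orders of vanishing, and in the field itself, where the coefficients of an expansion depend
  -- polynomially on the base point.
  record ScalarEmbedding (R : CommutativeRing 0ℓ 0ℓ) : Set where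
    private module R = CommutativeRing R
    field
      ι : Fin q → R.Carrier
      ι-0 : ι 0# R.≈ R.0#
      ι-+ : ∀ a b → ι (a + b) R.≈ ι a R.+ ι b
      ι-* : ∀ a b → ι (a * b) R.≈ ι a R.* ι b

-- Formal power series and congruences modulo powers of `T`.

module Series {q : ℕ} (F : FiniteFieldOn q) where

  open import Data.Nat using (zero; suc; _<_; z<s; s<s; s≤s; z≤n)
  import Data.Nat.Properties as ℕ
  open import Data.Product using (_,_)
  open import Data.Sum using (inj₁; inj₂)
  open import Data.Empty using (⊥-elim)
  open import Relation.Binary.PropositionalEquality
  open import Relation.Binary.Structures using (IsEquivalence)

  private module K = Field F
  open K using (0#; 1#)
  open import Algebra.Solver.Ring.NaturalCoefficients.Default K.commutativeSemiring
    using (solve; _:+_; _:*_; _:=_)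

  Series : Set
  Series = ℕ → Fin q

  infix 4 _≈_
  record _≈_ (f g : Series) : Set where
    constructor coeffwise
    field at : ∀ n → f n ≡ g n
  open _≈_ public

  private
    tail : Series → Series
    tail f n = f (suc n)

    _∔_ : Series → Series → Series
    (f ∔ g) n = f n K.+ g n

    _∗_ : Series → Series → Series
    (f ∗ g) zero = f 0 K.* g 0
    (f ∗ g) (suc n) = f 0 K.* g (suc n) K.+ (tail f ∗ g) n

  const : Fin q → Series
  const c zero = c
  const c (suc n) = 0#

  private
    negate : Series → Series
    negate f n = K.- f n

    ∗-cong : ∀ {f f' g g'} → (∀ n → f n ≡ f' n) → (∀ n → g n ≡ g' n) → ∀ n → (f ∗ g) n ≡ (f' ∗ g') n
    ∗-cong p r zero = cong₂ K._*_ (p 0) (r 0)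
    ∗-cong p r (suc n) = cong₂ K._+_ (cong₂ K._*_ (p 0) (r (suc n))) (∗-cong (λ i → p (suc i)) r n)

    ∗-distribʳ : ∀ f g h n → ((g ∔ h) ∗ f) n ≡ (g ∗ f) n K.+ (h ∗ f) n
    ∗-distribʳ f g h zero = K.distribʳ _ _ _
    ∗-distribʳ f g h (suc n) rewrite ∗-distribʳ f (tail g) (tail h) n =
      solve 5 (λ a b c x y → (a :+ b) :* c :+ (x :+ y) := (a :* c :+ x) :+ (b :* c :+ y)) refl
        (g 0) (h 0) (f (suc n)) ((tail g ∗ f) n) ((tail h ∗ f) n)

    ∗-zeroˡ : ∀ f n → ((λ _ → 0#) ∗ f) n ≡ 0#
    ∗-zeroˡ f zero = K.zeroˡ _
    ∗-zeroˡ f (suc n) = trans (cong₂ K._+_ (K.zeroˡ _) (∗-zeroˡ f n)) (K.+-identityˡ _)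

    const-∗ : ∀ c f n → (const c ∗ f) n ≡ c K.* f n
    const-∗ c f zero = refl
    const-∗ c f (suc n) = trans (cong (_ K.+_) (∗-zeroˡ f n)) (K.+-identityʳ _)

    scale-∗ : ∀ c f g n → ((λ i → c K.* f i) ∗ g) n ≡ c K.* (f ∗ g) n
    scale-∗ c f g zero = K.*-assoc _ _ _
    scale-∗ c f g (suc n) rewrite scale-∗ c (tail f) g n =
      solve 4 (λ a b d x → a :* b :* d :+ a :* x := a :* (b :* d :+ x)) refl c (f 0) (g (suc n)) ((tail f ∗ g) n)

    ∗-assoc : ∀ f g h n → ((f ∗ g) ∗ h) n ≡ (f ∗ (g ∗ h)) n
    ∗-assoc f g h zero = K.*-assoc _ _ _
    ∗-assoc f g h (suc n) rewrite ∗-distribʳ h (λ i → f 0 K.* tail g i) (tail f ∗ g) n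
      | scale-∗ (f 0) (tail g) h n | ∗-assoc (tail f) g h n =
      solve 5 (λ a b d x y → a :* b :* d :+ (a :* x :+ y) := a :* (b :* d :+ x) :+ y) refl
        (f 0) (g 0) (h (suc n)) ((tail g ∗ h) n) ((tail f ∗ (g ∗ h)) n)

    ∗-sucʳ : ∀ f g n → (f ∗ g) (suc n) ≡ f (suc n) K.* g 0 K.+ (f ∗ tail g) n
    ∗-sucʳ f g zero = K.+-comm _ _
    ∗-sucʳ f g (suc n) rewrite ∗-sucʳ (tail f) g n =
      solve 3 (λ x y z → x :+ (y :+ z) := y :+ (x :+ z)) refl _ _ _

    ∗-comm : ∀ f g n → (f ∗ g) n ≡ (g ∗ f) n
    ∗-comm f g zero = K.*-comm _ _
    ∗-comm f g (suc n) = trans (cong₂ K._+_ (K.*-comm _ _) (∗-comm (tail f) g n)) (sym (∗-sucʳ g f n))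

    ≈-isEquivalence : IsEquivalence _≈_
    ≈-isEquivalence = record
      { refl = coeffwise λ _ → refl
      ; sym = λ p → coeffwise λ n → sym (at p n)
      ; trans = λ p r → coeffwise λ n → trans (at p n) (at r n) }

  ring : CommutativeRing 0ℓ 0ℓ
  ring = record
    { Carrier = Series ; _≈_ = _≈_ ; _+_ = _∔_ ; _*_ = _∗_ ; -_ = negate ; 0# = λ _ → 0# ; 1# = const 1#
    ; isCommutativeRing = record
      { isRing = record
        { +-isAbelianGroup = record
          { isGroup = record
            { isMonoid = record
              { isSemigroup = record
                { isMagma = record
                  { isEquivalence = ≈-isEquivalence
                  ; ∙-cong = λ p r → coeffwise λ n → cong₂ K._+_ (at p n) (at r n) }
                ; assoc = λ f g h → coeffwise λ n → K.+-assoc _ _ _ }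
              ; identity = (λ f → coeffwise λ n → K.+-identityˡ _) , (λ f → coeffwise λ n → K.+-identityʳ _) }
            ; inverse = (λ f → coeffwise λ n → K.-‿inverseˡ _) , (λ f → coeffwise λ n → K.-‿inverseʳ _)
            ; ⁻¹-cong = λ p → coeffwise λ n → cong K.-_ (at p n) }
          ; comm = λ f g → coeffwise λ n → K.+-comm _ _ }
        ; *-cong = λ p r → coeffwise (∗-cong (at p) (at r))
        ; *-assoc = λ f g h → coeffwise (∗-assoc f g h)
        ; *-identity = (λ f → coeffwise λ n → trans (const-∗ 1# f n) (K.*-identityˡ _))
                     , (λ f → coeffwise λ n → trans (∗-comm f (const 1#) n) (trans (const-∗ 1# f n) (K.*-identityˡ _)))
        ; distrib = (λ f g h → coeffwise λ n → trans (∗-comm f (g ∔ h) n)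
                      (trans (∗-distribʳ f g h n) (cong₂ K._+_ (∗-comm g f n) (∗-comm h f n))))
                  , (λ f g h → coeffwise (∗-distribʳ f g h)) }
      ; *-comm = λ f g → coeffwise (∗-comm f g) } }

  T : Series
  T 0 = 0#
  T 1 = 1#
  T (suc (suc n)) = 0#

  open CommutativeRing ring using (_+_; _*_)

  T*-zero : ∀ f → (T * f) 0 ≡ 0#
  T*-zero f = K.zeroˡ _

  T*-suc : ∀ f n → (T * f) (suc n) ≡ f n
  T*-suc f n = trans (cong₂ K._+_ (K.zeroˡ _) (trans (∗-cong T≡1 (λ _ → refl) n) (const-∗ 1# f n)))
    (trans (K.+-identityˡ _) (K.*-identityˡ _))
    where
    T≡1 : ∀ n → tail T n ≡ const 1# n
    T≡1 zero = refl
    T≡1 (suc n) = refl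

  const-* : ∀ c f n → (const c * f) n ≡ c K.* f n
  const-* = const-∗

  const-homo-* : ∀ c d → const (c K.* d) ≈ const c * const d
  const-homo-* c d = coeffwise λ { zero → refl ; (suc n) → sym (trans (const-∗ c (const d) (suc n)) (K.zeroʳ _)) }

  const-homo-+ : ∀ c d → const (c K.+ d) ≈ const c + const d
  const-homo-+ c d = coeffwise λ { zero → refl ; (suc n) → sym (K.+-identityˡ _) }

  const-0 : const 0# ≈ (λ _ → 0#)
  const-0 = coeffwise λ { zero → refl ; (suc n) → refl }

  infix 4 _≈_[mod_]
  record _≈_[mod_] (f g : Series) (n : ℕ) : Set where
    constructor coeffwise<
    field at< : ∀ {i} → i < n → f i ≡ g i
  open _≈_[mod_] public

  ≈⇒mod : ∀ {n f g} → f ≈ g → f ≈ g [mod n ]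
  ≈⇒mod p = coeffwise< λ {i} _ → at p i

  mod-sym : ∀ {n f g} → f ≈ g [mod n ] → g ≈ f [mod n ]
  mod-sym p = coeffwise< λ i<n → sym (at< p i<n)

  mod-trans : ∀ {n f g h} → f ≈ g [mod n ] → g ≈ h [mod n ] → f ≈ h [mod n ]
  mod-trans p r = coeffwise< λ i<n → trans (at< p i<n) (at< r i<n)

  mod-refl : ∀ {n f} → f ≈ f [mod n ]
  mod-refl = coeffwise< λ _ → refl

  mod-+ : ∀ {n f f' g g'} → f ≈ f' [mod n ] → g ≈ g' [mod n ] → f + g ≈ f' + g' [mod n ]
  mod-+ p r = coeffwise< λ i<n → cong₂ K._+_ (at< p i<n) (at< r i<n)

  mod-* : ∀ {n f f' g g'} → f ≈ f' [mod n ] → g ≈ g' [mod n ] → f * g ≈ f' * g' [mod n ]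
  mod-* p r = coeffwise< λ {i} i<n → go i (λ j≤i → at< p (ℕ.≤-<-trans j≤i i<n)) (λ j≤i → at< r (ℕ.≤-<-trans j≤i i<n))
    where
    go : ∀ {f f' g g' : Series} n → (∀ {i} → i ℕ.≤ n → f i ≡ f' i) → (∀ {i} → i ℕ.≤ n → g i ≡ g' i) → (f ∗ g) n ≡ (f' ∗ g') n
    go zero p r = cong₂ K._*_ (p z≤n) (r z≤n)
    go (suc n) p r = cong₂ K._+_ (cong₂ K._*_ (p z≤n) (r ℕ.≤-refl))
      (go n (λ i≤n → p (s≤s i≤n)) (λ i≤n → r (ℕ.m≤n⇒m≤1+n i≤n)))

  mod-weaken : ∀ {m n f g} → m ℕ.≤ n → f ≈ g [mod n ] → f ≈ g [mod m ]
  mod-weaken m≤n p = coeffwise< λ i<m → at< p (ℕ.<-≤-trans i<m m≤n)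

  0ˢ : Series
  0ˢ _ = 0#

  T*-cancel-mod : ∀ {n f} → T * f ≈ 0ˢ [mod suc n ] → f ≈ 0ˢ [mod n ]
  T*-cancel-mod {f = f} p = coeffwise< λ {i} i<n → trans (sym (T*-suc f i)) (at< p (s<s i<n))

  -- If all coefficients of `f` before the j-th vanish, the j-th coefficient of the product is `f j`
  -- times the unit `u 0`; strong induction removes the coefficients one after another.
  unit*-cancel-mod : ∀ {n u f} → u 0 ≢ 0# → u * f ≈ 0ˢ [mod n ] → f ≈ 0ˢ [mod n ]
  unit*-cancel-mod {n} {u} {f} u≢0 p = coeffwise< λ {i} i<n → go i i<n i ℕ.≤-refl
    where
    go : ∀ i → i < n → ∀ j → j ℕ.≤ i → f j ≡ 0#
    step : ∀ j → j < n → (∀ k → k < j → f k ≡ 0#) → f j ≡ 0#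
    step j j<n lower with K.integral (trans (trans (sym (u*f j lower)) (∗-comm f u j)) (at< p j<n))
      where
      *-lowest : ∀ (f : Series) j → (∀ k → k < j → f k ≡ 0#) → ∀ g → (f ∗ g) j ≡ f j K.* g 0
      *-lowest f zero _ g = refl
      *-lowest f (suc j) l g = trans (cong₂ K._+_ (trans (cong (K._* g (suc j)) (l 0 z<s)) (K.zeroˡ _))
        (*-lowest (tail f) j (λ k k<j → l (suc k) (s<s k<j)) g)) (K.+-identityˡ _)
      u*f : ∀ j → (∀ k → k < j → f k ≡ 0#) → (f ∗ u) j ≡ f j K.* u 0
      u*f j l = *-lowest f j l u
    ... | inj₁ fj≡0 = fj≡0
    ... | inj₂ u0≡0 = ⊥-elim (u≢0 u0≡0)
    go zero i<n .zero z≤n = step 0 i<n λ k ()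
    go (suc i) i<n j j≤ with ℕ.m≤n⇒m<n∨m≡n j≤
    ... | inj₁ (s≤s j≤i) = go i (ℕ.<-trans (ℕ.n<1+n i) i<n) j j≤i
    ... | inj₂ refl = step (suc i) i<n λ { k (s≤s k≤i) → go i (ℕ.<-trans (ℕ.n<1+n i) i<n) k k≤i }

  embedding : K.ScalarEmbedding ring
  embedding = record { ι = const ; ι-0 = const-0 ; ι-+ = const-homo-+ ; ι-* = const-homo-* }

-- Polynomial functions on a ring that contains the scalars.

module Polynomial {q : ℕ} (F : FiniteFieldOn q) (R : CommutativeRing 0ℓ 0ℓ)
  (E : Field.ScalarEmbedding F R) where

  open import Data.Nat using (zero; suc; _≤_)
  import Data.Nat.Properties as ℕ
  open import Data.Vec using (Vec; []; _∷_; _++_; replicate; zipWith; map)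
  open import Data.Product using (∃; _,_)
  open import Relation.Binary.PropositionalEquality as ≡ using (_≡_)
  private module K = Field F
  open CommutativeRing R
  open Field.ScalarEmbedding E
  open import Relation.Binary.Reasoning.Setoid setoid
  open import Algebra.Solver.Ring.NaturalCoefficients.Default commutativeSemiring
    using (solve; _:+_; _:*_; _:=_)

  ev : ∀ {n} → Vec (Fin q) n → Carrier → Carrier
  ev [] x = 0#
  ev (c ∷ v) x = ι c + x * ev v x

  ev-zero : ∀ n x → ev (replicate n K.0#) x ≈ 0#
  ev-zero zero x = refl
  ev-zero (suc n) x = trans (+-cong ι-0 (trans (*-congˡ (ev-zero n x)) (zeroʳ x))) (+-identityˡ 0#)

  ev-+ : ∀ {n} (u v : Vec (Fin q) n) x → ev (zipWith K._+_ u v) x ≈ ev u x + ev v x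
  ev-+ [] [] x = sym (+-identityˡ 0#)
  ev-+ (a ∷ u) (b ∷ v) x = begin
    ι (a K.+ b) + x * ev (zipWith K._+_ u v) x    ≈⟨ +-cong (ι-+ a b) (*-congˡ (ev-+ u v x)) ⟩
    (ι a + ι b) + x * (ev u x + ev v x)           ≈⟨ solve 5 (λ a b x y z → (a :+ b) :+ x :* (y :+ z) := (a :+ x :* y) :+ (b :+ x :* z)) refl _ _ _ _ _ ⟩
    (ι a + x * ev u x) + (ι b + x * ev v x)       ∎

  ev-scale : ∀ {n} c (v : Vec (Fin q) n) x → ev (map (c K.*_) v) x ≈ ι c * ev v x
  ev-scale c [] x = sym (zeroʳ _)
  ev-scale c (a ∷ v) x = begin
    ι (c K.* a) + x * ev (map (c K.*_) v) x    ≈⟨ +-cong (ι-* c a) (*-congˡ (ev-scale c v x)) ⟩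
    ι c * ι a + x * (ι c * ev v x)             ≈⟨ solve 4 (λ c a x y → c :* a :+ x :* (c :* y) := c :* (a :+ x :* y)) refl _ _ _ _ ⟩
    ι c * (ι a + x * ev v x)                   ∎

  ev-difference : ∀ {n} (u v : Vec (Fin q) n) x → ev (zipWith (λ a b → a K.+ K.- b) u v) x + ev v x ≈ ev u x
  ev-difference [] [] x = +-identityˡ 0#
  ev-difference (a ∷ u) (b ∷ v) x = begin
    (ι (a K.+ K.- b) + x * ev w x) + (ι b + x * ev v x)    ≈⟨ solve 5 (λ a x y b z → (a :+ x :* y) :+ (b :+ x :* z) := (a :+ b) :+ x :* (y :+ z)) refl _ _ _ _ _ ⟩
    (ι (a K.+ K.- b) + ι b) + x * (ev w x + ev v x)        ≈⟨ +-cong (sym (ι-+ _ _)) (*-congˡ (ev-difference u v x)) ⟩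
    ι (a K.+ K.- b K.+ b) + x * ev u x                     ≡⟨ ≡.cong (λ c → ι c + x * ev u x) a-b+b ⟩
    ι a + x * ev u x                                       ∎
    where
    w = zipWith (λ a b → a K.+ K.- b) u v
    a-b+b : a K.+ K.- b K.+ b ≡ a
    a-b+b = ≡.trans (K.+-assoc a (K.- b) b) (≡.trans (≡.cong (a K.+_) (K.-‿inverseˡ b)) (K.+-identityʳ a))

  ev-pad : ∀ {n} (v : Vec (Fin q) n) m x → ev (v ++ replicate m K.0#) x ≈ ev v x
  ev-pad [] m x = ev-zero m x
  ev-pad (c ∷ v) m x = +-congˡ (*-congˡ (ev-pad v m x))

  -- `n` counts coefficients, so the degree is below `n`. A polynomial is treated as its function on
  -- the whole ring. On series this loses nothing, since the value at `T` recovers the coefficients;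
  -- on the field X and X^q would coincide.
  IsPoly : ℕ → (Carrier → Carrier) → Set
  IsPoly n φ = ∃ λ (v : Vec (Fin q) n) → ∀ x → φ x ≈ ev v x

  IsPoly-resp : ∀ {n φ ψ} → (∀ x → φ x ≈ ψ x) → IsPoly n φ → IsPoly n ψ
  IsPoly-resp φ≈ψ (v , p) = v , λ x → trans (sym (φ≈ψ x)) (p x)

  IsPoly-ev : ∀ {n} (v : Vec (Fin q) n) → IsPoly n (ev v)
  IsPoly-ev v = v , λ _ → refl

  IsPoly-0 : ∀ {n} → IsPoly n (λ _ → 0#)
  IsPoly-0 {n} = replicate n K.0# , λ x → sym (ev-zero n x)

  IsPoly-weaken : ∀ {n m φ} → n ≤ m → IsPoly n φ → IsPoly m φ
  IsPoly-weaken {n} {m} {φ} n≤m (v , p) = ≡.subst (λ k → IsPoly k φ) (ℕ.m+[n∸m]≡n n≤m)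
    (v ++ replicate (m ℕ.∸ n) K.0# , λ x → trans (p x) (sym (ev-pad v (m ℕ.∸ n) x)))

  IsPoly-+ : ∀ {n φ ψ} → IsPoly n φ → IsPoly n ψ → IsPoly n (λ x → φ x + ψ x)
  IsPoly-+ (u , p) (v , r) = zipWith K._+_ u v , λ x → trans (+-cong (p x) (r x)) (sym (ev-+ u v x))

  IsPoly-scale : ∀ {n φ} c → IsPoly n φ → IsPoly n (λ x → ι c * φ x)
  IsPoly-scale c (v , p) = map (c K.*_) v , λ x → trans (*-congˡ (p x)) (sym (ev-scale c v x))

  IsPoly-const : ∀ c → IsPoly 1 (λ _ → ι c)
  IsPoly-const c = c ∷ [] , λ x → sym (trans (+-congˡ (zeroʳ x)) (+-identityʳ (ι c)))

  IsPoly-x* : ∀ {n φ} → IsPoly n φ → IsPoly (suc n) (λ x → x * φ x)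
  IsPoly-x* (v , p) = K.0# ∷ v , λ x → trans (*-congˡ (p x)) (sym (trans (+-congʳ ι-0) (+-identityˡ _)))

  IsPoly-[x+a]* : ∀ {n φ} a → IsPoly n φ → IsPoly (suc n) (λ x → (x + ι a) * φ x)
  IsPoly-[x+a]* a p = IsPoly-resp (λ x → sym (distribʳ _ _ _))
    (IsPoly-+ (IsPoly-x* p) (IsPoly-weaken (ℕ.n≤1+n _) (IsPoly-scale a p)))

  IsPoly-* : ∀ {n m φ ψ} → IsPoly (suc n) φ → IsPoly m ψ → IsPoly (n ℕ.+ m) (λ x → φ x * ψ x)
  IsPoly-* {n} {m} {φ} {ψ} (v , p) ψ-poly = IsPoly-resp (λ x → *-congʳ (sym (p x))) (go v)
    where
    go : ∀ {n} (v : Vec (Fin q) (suc n)) → IsPoly (n ℕ.+ m) (λ x → ev v x * ψ x)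
    go {zero} (c ∷ []) = IsPoly-resp (λ x → *-congʳ (sym (trans (+-congˡ (zeroʳ x)) (+-identityʳ (ι c))))) (IsPoly-scale c ψ-poly)
    go {suc n} (c ∷ v) = IsPoly-resp
      (λ x → solve 4 (λ c y x z → c :* y :+ x :* (z :* y) := (c :+ x :* z) :* y) refl _ _ _ _)
      (IsPoly-+ (IsPoly-weaken (ℕ.m≤n+m m (suc n)) (IsPoly-scale c ψ-poly)) (IsPoly-x* (go v)))

-- Roots counted with multiplicity.

module RootCount {q : ℕ} (F : FiniteFieldOn q) where

  open import Data.Nat using (zero; suc; _≤_; _<_; s≤s; z<s)
  import Data.Nat.Properties as ℕ
  open import Data.Fin.Properties using (_≟_)
  open import Data.Vec using (Vec; []; _∷_; replicate)
  open import Data.List using (List; []; _∷_; _++_; length)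
  import Data.List as List
  open import Data.List.Properties using (length-++; length-replicate)
  open import Data.List.Relation.Unary.All using (All; []; _∷_)
  open import Data.List.Relation.Unary.AllPairs using ([]; _∷_)
  open import Data.List.Relation.Unary.Unique.Propositional using (Unique)
  open import Data.Product using (∃; _,_)
  open import Data.Empty using (⊥-elim)
  open import Relation.Nullary using (yes; no)
  open import Relation.Binary.PropositionalEquality as ≡ using (_≡_; _≢_)

  private module K = Field F
  open Series F hiding (ring)
  open Polynomial F (Series.ring F) (Series.embedding F)
  open CommutativeRing (Series.ring F) hiding (_≈_)
  open import Algebra.Solver.Ring.NaturalCoefficients.Default commutativeSemiring
    using (solve; _:+_; _:*_; _:=_)

  -- The expansion of the indeterminate at b, so that `ev v (X b)` is the Taylor expansion of v at b.
  X : Fin q → Series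
  X b = const b + T

  X-head : ∀ b → X b 0 ≡ b
  X-head b = K.+-identityʳ b

  const-[c-c]≈0 : ∀ c → const (c K.+ K.- c) ≈ 0ˢ
  const-[c-c]≈0 c = trans (coeffwise λ n → ≡.cong (λ e → const e n) (K.-‿inverseʳ c)) const-0

  -- Horner's scheme: the remainder of the tail is the leading entry of the new quotient. The
  -- identity holds at every series `x`, because the quotient is later expanded at other points than
  -- `b`.
  division : ∀ {n} (v : Vec (Fin q) (suc n)) b → ∃ λ r → ∃ λ (w : Vec (Fin q) n) →
    ∀ x → ev v x ≈ const r + (x + const (K.- b)) * ev w x
  division (c ∷ []) b = c , [] , λ x → +-congˡ (trans (zeroʳ x) (sym (zeroʳ _)))
  division (c ∷ v@(_ ∷ _)) b with r , w , p ← division v b =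
    c K.+ b K.* r , r ∷ w , λ x → begin
      const c + x * ev v x                                                     ≈⟨ +-congˡ (*-congˡ (p x)) ⟩
      const c + x * (const r + (x + const (K.- b)) * ev w x)                   ≈⟨ +-congˡ (*-congʳ (sym (+-identityʳ x))) ⟩
      -- Writing `x` as x + (b - b) turns the regrouping into an identity in which b and -b are
      -- independent variables; the zero is removed again afterwards.
      const c + (x + 0#) * (const r + (x + const (K.- b)) * ev w x)            ≈⟨ +-congˡ (*-congʳ (+-congˡ (trans (sym (const-[c-c]≈0 b)) (const-homo-+ b (K.- b))))) ⟩
      const c + (x + (const b + const (K.- b))) * (const r + (x + const (K.- b)) * ev w x)
        ≈⟨ solve 6 (λ c x b b' r w → c :+ (x :+ (b :+ b')) :* (r :+ (x :+ b') :* w)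
               := (c :+ b :* r) :+ (x :+ b') :* (r :+ (x :+ (b :+ b')) :* w)) refl _ _ _ _ _ _ ⟩
      (const c + const b * const r) + (x + const (K.- b)) * (const r + (x + (const b + const (K.- b))) * ev w x)
        ≈⟨ +-cong (sym (trans (const-homo-+ c (b K.* r)) (+-congˡ (const-homo-* b r))))
             (*-congˡ (+-congˡ (*-congʳ (trans (+-congˡ (trans (sym (const-homo-+ b (K.- b))) (const-[c-c]≈0 b))) (+-identityʳ x))))) ⟩
      const (c K.+ b K.* r) + (x + const (K.- b)) * (const r + x * ev w x)     ∎
    where open import Relation.Binary.Reasoning.Setoid setoid

  count : Fin q → List (Fin q) → ℕ
  count b [] = 0
  count b (c ∷ l) with b ≟ c
  ... | yes _ = suc (count b l)
  ... | no _ = count b l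

  count-here : ∀ b l → count b (b ∷ l) ≡ suc (count b l)
  count-here b l with b ≟ b
  ... | yes _ = ≡.refl
  ... | no b≢b = ⊥-elim (b≢b ≡.refl)

  X-b≈T : ∀ b → X b + const (K.- b) ≈ T
  X-b≈T b = trans (trans (solve 3 (λ b t b' → b :+ t :+ b' := b :+ b' :+ t) refl _ _ _)
    (+-congʳ (trans (sym (const-homo-+ b (K.- b))) (const-[c-c]≈0 b)))) (+-identityˡ T)

  -- The multiplicity of a root is its number of occurrences in `l`. Splitting off the factor x - b
  -- costs one coefficient and one entry of `l`: at `b` the factor expands to `T` and lowers the
  -- required order by one, at every other point it is a unit and lowers nothing.
  zero-of-many-roots : ∀ {n} (v : Vec (Fin q) n) l → n ≤ length l →
    (∀ b → ev v (X b) ≈ 0ˢ [mod count b l ]) → ∀ x → ev v x ≈ 0ˢ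
  zero-of-many-roots [] l n≤ vanish x = refl
  zero-of-many-roots v@(_ ∷ _) (b ∷ l) (s≤s n≤) vanish x with r , w , p ← division v b =
    trans (p x) (trans (+-cong (trans (coeffwise λ n → ≡.cong (λ r → const r n) r≡0) const-0)
      (trans (*-congˡ (zero-of-many-roots w l n≤ w-vanish x)) (zeroʳ _))) (+-identityˡ 0ˢ))
    where
    shift-head : ∀ b → (X b + const (K.- b)) 0 ≡ K.0#
    shift-head b = at (X-b≈T b) 0

    r≡0 : r ≡ K.0#
    r≡0 = R.begin
      r                                                     R.≡⟨ K.+-identityʳ r ⟨
      r K.+ K.0#                                            R.≡⟨ ≡.cong (r K.+_) (≡.trans (≡.cong (K._* ev w (X b) 0) (shift-head b)) (K.zeroˡ _)) ⟨
      r K.+ (X b + const (K.- b)) 0 K.* ev w (X b) 0        R.≡⟨ at (p (X b)) 0 ⟨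
      ev v (X b) 0                                          R.≡⟨ at< (vanish b) (≡.subst (0 <_) (≡.sym (count-here b l)) z<s) ⟩
      K.0#                                                  R.∎
      where module R = ≡.≡-Reasoning

    v≈ : ∀ y → ev v y ≈ (y + const (K.- b)) * ev w y
    v≈ y = trans (p y) (trans (+-congʳ (trans (coeffwise λ n → ≡.cong (λ r → const r n) r≡0) const-0)) (+-identityˡ _))

    w-vanish : ∀ c → ev w (X c) ≈ 0ˢ [mod count c l ]
    w-vanish c with c ≟ b | vanish c
    ... | yes ≡.refl | v-vanish = T*-cancel-mod (mod-trans (≈⇒mod (*-congʳ (sym (X-b≈T b)))) (mod-trans (≈⇒mod (sym (v≈ (X b)))) v-vanish))
    ... | no c≢b | v-vanish = unit*-cancel-mod unit (mod-trans (≈⇒mod (sym (v≈ (X c)))) v-vanish)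
      where
      unit : (X c + const (K.- b)) 0 ≢ K.0#
      unit e = c≢b (K.x-y≡0⇒x≡y (≡.trans (≡.cong (K._+ K.- b) (≡.sym (X-head c))) e))

  -- `ev v T` is `v` itself, continued by zeros: the constant term is the head, and dividing by `T`
  -- leaves the tail.
  coefficients-zero : ∀ {n} (v : Vec (Fin q) n) → ev v T ≈ 0ˢ [mod n ] → v ≡ replicate n K.0#
  coefficients-zero [] _ = ≡.refl
  coefficients-zero {suc n} (c ∷ v) p = ≡.cong₂ _∷_
    (≡.trans (≡.sym (≡.trans (≡.cong (c K.+_) (T*-zero (ev v T))) (K.+-identityʳ c))) (at< p z<s))
    (coefficients-zero v (T*-cancel-mod (coeffwise< λ {i} i< → ≡.trans (T*≡ i) (at< p i<))))
    where
    c≡0 : c ≡ K.0#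
    c≡0 = ≡.trans (≡.sym (≡.trans (≡.cong (c K.+_) (T*-zero (ev v T))) (K.+-identityʳ c))) (at< p z<s)
    T*≡ : ∀ i → (T * ev v T) i ≡ (const c + T * ev v T) i
    T*≡ i = ≡.trans (≡.sym (K.+-identityˡ _)) (≡.cong (K._+ (T * ev v T) i) (≡.sym (≡.trans (≡.cong (λ e → const e i) c≡0) (at const-0 i))))

  repeat : ℕ → List (Fin q) → List (Fin q)
  repeat m [] = []
  repeat m (b ∷ bs) = List.replicate m b ++ repeat m bs

  length-repeat : ∀ m bs → length (repeat m bs) ≡ length bs ℕ.* m
  length-repeat m [] = ≡.refl
  length-repeat m (b ∷ bs) = ≡.trans (length-++ (List.replicate m b))
    (≡.cong₂ ℕ._+_ (length-replicate m) (length-repeat m bs))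

  count-++ : ∀ b k l → count b (k ++ l) ≡ count b k ℕ.+ count b l
  count-++ b [] l = ≡.refl
  count-++ b (c ∷ k) l with b ≟ c
  ... | yes _ = ≡.cong suc (count-++ b k l)
  ... | no _ = count-++ b k l

  count-replicate-here : ∀ m b → count b (List.replicate m b) ≡ m
  count-replicate-here zero b = ≡.refl
  count-replicate-here (suc m) b = ≡.trans (count-here b _) (≡.cong suc (count-replicate-here m b))

  count-replicate-there : ∀ m {b c} → b ≢ c → count b (List.replicate m c) ≡ 0
  count-replicate-there zero b≢c = ≡.refl
  count-replicate-there (suc m) {b} {c} b≢c with b ≟ c
  ... | yes b≡c = ⊥-elim (b≢c b≡c)
  ... | no _ = count-replicate-there m b≢c

  count-repeat-∉ : ∀ m {b} bs → All (b ≢_) bs → count b (repeat m bs) ≡ 0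
  count-repeat-∉ m [] [] = ≡.refl
  count-repeat-∉ m {b} (c ∷ bs) (b≢c ∷ b∉) = ≡.trans (count-++ b (List.replicate m c) _)
    (≡.cong₂ ℕ._+_ (count-replicate-there m b≢c) (count-repeat-∉ m bs b∉))

  zero-of-high-order : ∀ {n} (v : Vec (Fin q) n) m bs → Unique bs → n ≤ length bs ℕ.* m →
    All (λ b → ev v (X b) ≈ 0ˢ [mod m ]) bs → ∀ x → ev v x ≈ 0ˢ
  zero-of-high-order v m bs unique n≤ vanish = zero-of-many-roots v (repeat m bs)
    (ℕ.≤-trans n≤ (ℕ.≤-reflexive (≡.sym (length-repeat m bs)))) (vanish′ bs unique vanish)
    where
    vanish′ : ∀ bs → Unique bs → All (λ b → ev v (X b) ≈ 0ˢ [mod m ]) bs → ∀ b → ev v (X b) ≈ 0ˢ [mod count b (repeat m bs) ]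
    vanish′ [] _ _ b = coeffwise< λ ()
    vanish′ (c ∷ bs) (c∉ ∷ u) (vc ∷ vs) b with b ≟ c
    ... | yes ≡.refl = mod-weaken (ℕ.≤-reflexive (≡.trans (count-++ b (List.replicate m b) _)
        (≡.trans (≡.cong₂ ℕ._+_ (count-replicate-here m b) (count-repeat-∉ m bs c∉)) (ℕ.+-identityʳ m)))) vc
    ... | no b≢c = mod-weaken (ℕ.≤-reflexive (≡.trans (count-++ b (List.replicate m c) _)
        (≡.cong (ℕ._+ count b (repeat m bs)) (count-replicate-there m b≢c)))) (vanish′ bs u vs b)

  -- A zero of order `n` at a single point already exhausts the `n` coefficients, so a polynomial is
  -- determined by its expansion anywhere.
  zero-of-expansion : ∀ {n} (v : Vec (Fin q) n) b → ev v (X b) ≈ 0ˢ → ∀ x → ev v x ≈ 0ˢ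
  zero-of-expansion {n} v b p = zero-of-high-order v n (b ∷ []) ([] ∷ []) (ℕ.≤-reflexive (≡.sym (ℕ.*-identityˡ n))) (≈⇒mod p ∷ [])

-- Additivity of the q-th power.

module Frobenius {q : ℕ} (F : FiniteFieldOn q) where

  open import Data.Nat using (zero; suc; s≤s)
  import Data.Nat.Properties as ℕ
  open import Data.Vec using (Vec; []; _∷_)
  open import Data.List using (allFin)
  open import Data.List.Properties using (length-tabulate)
  open import Data.List.Relation.Unary.All.Properties using (tabulate⁺)
  open import Data.List.Relation.Unary.Unique.Propositional.Properties using (allFin⁺)
  open import Data.Product using (∃; _,_)
  open import Data.Empty using (⊥-elim)
  open import Data.Fin.Properties using (¬Fin0)
  open import Function using (id)
  open import Relation.Binary.PropositionalEquality as ≡ using (_≡_)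

  private module K = Field F
  open Series F hiding (ring)
  open Polynomial F (Series.ring F) (Series.embedding F)
  open RootCount F using (X; X-head; zero-of-high-order)
  open CommutativeRing (Series.ring F) hiding (_≈_)
  open import Algebra.Properties.Semiring.Exp semiring using (_^_)
  open import Algebra.Solver.Ring.NaturalCoefficients.Default commutativeSemiring
    using (solve; _:+_; _:*_; _:=_)

  ^-head : ∀ f n → (f ^ n) 0 ≡ f 0 K.^ n
  ^-head f zero = ≡.refl
  ^-head f (suc n) = ≡.cong (f 0 K.*_) (^-head f n)

  IsPoly-^ : ∀ n → IsPoly (suc n) (_^ n)
  IsPoly-^ zero = IsPoly-const K.1#
  IsPoly-^ (suc n) = IsPoly-x* (IsPoly-^ n)

  -- The leading terms of the two powers cancel, so the difference has only `n` coefficients. For n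
  -- = q this is few enough for the q points of the field to force it to vanish once `a` is
  -- subtracted.
  power-of-translate : ∀ a n → ∃ λ (v : Vec (Fin q) n) → ∀ x → (x + const a) ^ n ≈ x ^ n + ev v x
  power-of-translate a zero = [] , λ x → sym (+-identityʳ _)
  power-of-translate a (suc n) with v , p ← power-of-translate a n
    with w , r ← IsPoly-+ (IsPoly-scale a (IsPoly-^ n)) (IsPoly-[x+a]* a (IsPoly-ev v)) =
    w , λ x → trans (*-congˡ (p x)) (trans
      (solve 4 (λ x a y z → (x :+ a) :* (y :+ z) := x :* y :+ (a :* y :+ (x :+ a) :* z)) refl x (const a) (x ^ n) (ev v x))
      (+-congˡ (r x)))

  -- (x + a)^q - x^q - a has degree below q and vanishes at all q points of the field.
  frobenius′ : ∀ n → q ≡ n → ∀ x a → (x + const a) ^ n ≈ x ^ n + const a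
  frobenius′ zero q≡0 x a = ⊥-elim (¬Fin0 (≡.subst Fin q≡0 a))
  frobenius′ (suc n) q≡ x a with c ∷ w , p ← power-of-translate a (suc n) = trans (p x) (+-congˡ (trans (split x)
        (trans (+-congˡ (zero-of-high-order w′ 1 (allFin q) (allFin⁺ q) n≤ (tabulate⁺ vanish) x)) (+-identityʳ _))))
    where
    w′ = (c K.+ K.- a) ∷ w
    n≤ = ℕ.≤-reflexive (≡.sym (≡.trans (ℕ.*-identityʳ _) (≡.trans (length-tabulate {n = q} id) q≡)))
    c-split : c ≡ a K.+ (c K.+ K.- a)
    c-split = ≡.sym (≡.trans (K.+-comm a _) (≡.trans (K.+-assoc c _ a) (≡.trans (≡.cong (c K.+_) (K.-‿inverseˡ a)) (K.+-identityʳ c))))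
    split : ∀ x → ev (c ∷ w) x ≈ const a + ev w′ x
    split x = trans (+-congʳ (trans (coeffwise λ i → ≡.cong (λ c → const c i) c-split) (const-homo-+ a _))) (+-assoc _ _ _)
    ^q-head : ∀ f → (f ^ suc n) 0 ≡ f 0
    ^q-head f = ≡.trans (^-head f (suc n)) (≡.trans (≡.cong (f 0 K.^_) (≡.sym q≡)) (K.x^q≡x (f 0)))
    vanish : ∀ b → ev w′ (X b) ≈ 0ˢ [mod 1 ]
    vanish b = coeffwise< λ { {zero} _ → K.+-cancelˡ a (K.+-cancelˡ b heads) ; {suc _} (s≤s ()) }
      where
      open ≡.≡-Reasoning

      heads : b K.+ (a K.+ ev w′ (X b) 0) ≡ b K.+ (a K.+ K.0#)
      heads = begin
          b K.+ (a K.+ ev w′ (X b) 0)                ≡⟨ ≡.cong (b K.+_) (at (split (X b)) 0) ⟨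
          b K.+ ev (c ∷ w) (X b) 0                   ≡⟨ ≡.cong (K._+ ev (c ∷ w) (X b) 0) (≡.trans (^q-head (X b)) (X-head b)) ⟨
          (X b ^ suc n) 0 K.+ ev (c ∷ w) (X b) 0     ≡⟨ at (p (X b)) 0 ⟨
          ((X b + const a) ^ suc n) 0                ≡⟨ ^q-head (X b + const a) ⟩
          X b 0 K.+ a                                ≡⟨ ≡.cong (K._+ a) (X-head b) ⟩
          b K.+ a                                    ≡⟨ ≡.cong (b K.+_) (K.+-identityʳ a) ⟨
          b K.+ (a K.+ K.0#)                         ∎

  frobenius : ∀ x a → (x + const a) ^ q ≈ x ^ q + const a
  frobenius = frobenius′ q ≡.refl

-- The auxiliary polynomial determines its coefficients.

module Nonvanishing {q : ℕ} (F : FiniteFieldOn q) where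

  open import Data.Nat using (zero; suc; _≤_; s≤s)
  import Data.Nat.Properties as ℕ
  open import Data.Vec using (Vec; []; _∷_; zipWith; replicate; head; tail)
  open import Data.List using (List; []; _∷_; length)
  open import Data.List.Relation.Unary.All using (All; []; _∷_)
  open import Data.Product using (_×_; _,_; proj₁; proj₂)
  open import Data.Sum using (inj₁; inj₂)
  open import Relation.Binary.PropositionalEquality as ≡ using (_≡_; _≢_)

  private module K = Field F
  open Series F hiding (ring)
  open Polynomial F (Series.ring F) (Series.embedding F)
  open RootCount F using (X; X-head; X-b≈T; coefficients-zero; zero-of-expansion)
  open Frobenius F using (frobenius)
  open CommutativeRing (Series.ring F) hiding (_≈_)
  open import Algebra.Properties.Semiring.Exp semiring using (_^_; ^-homo-*)
  open import Algebra.Properties.CommutativeSemiring.Exp commutativeSemiring using (^-distrib-*)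
  open import Algebra.Solver.Ring.NaturalCoefficients.Default commutativeSemiring
    using (solve; _:+_; _:*_; _:=_)

  shift : Series → Series
  shift f n = f (suc n)

  T*-shift : ∀ f → f 0 ≡ K.0# → f ≈ T * shift f
  T*-shift f f0≡0 = coeffwise λ { zero → ≡.trans f0≡0 (≡.sym (T*-zero (shift f))) ; (suc n) → ≡.sym (T*-suc (shift f) n) }

  T*-cancel : ∀ {f g} → T * f ≈ T * g → f ≈ g
  T*-cancel {f} {g} p = coeffwise λ n → ≡.trans (≡.sym (T*-suc f n)) (≡.trans (at p (suc n)) (T*-suc g n))

  T^-cancel : ∀ n {f g} → T ^ n * f ≈ T ^ n * g → f ≈ g
  T^-cancel zero p = trans (sym (*-identityˡ _)) (trans p (*-identityˡ _))
  T^-cancel (suc n) p = T^-cancel n (T*-cancel (trans (sym (*-assoc T _ _)) (trans p (*-assoc T _ _))))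

  T*-mod-suc : ∀ {n f} → f ≈ 0ˢ [mod n ] → T * f ≈ 0ˢ [mod suc n ]
  T*-mod-suc {f = f} p = coeffwise< λ { {zero} _ → T*-zero f ; {suc i} (s≤s i<n) → ≡.trans (T*-suc f i) (at< p i<n) }

  T^n≈0 : ∀ n → T ^ n ≈ 0ˢ [mod n ]
  T^n≈0 zero = coeffwise< λ ()
  T^n≈0 (suc n) = T*-mod-suc (T^n≈0 n)

  T^n*≈0 : ∀ n f → T ^ n * f ≈ 0ˢ [mod n ]
  T^n*≈0 n f = mod-trans (mod-* (T^n≈0 n) mod-refl) (≈⇒mod (zeroˡ f))

  mod-+-cancelʳ : ∀ {n f g} h → f + h ≈ g + h [mod n ] → f ≈ g [mod n ]
  mod-+-cancelʳ h p = coeffwise< λ {i} i<n → K.+-cancelˡ (h i) (≡.trans (K.+-comm (h i) _) (≡.trans (at< p i<n) (K.+-comm _ (h i))))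

  roots : List (Fin q) → Series → Series
  roots [] x = 1#
  roots (a ∷ as) x = (x + const a) * roots as x

  rootsK : List (Fin q) → Fin q → Fin q
  rootsK [] x = K.1#
  rootsK (a ∷ as) x = (x K.+ a) K.* rootsK as x

  roots-head : ∀ as x → roots as x 0 ≡ rootsK as (x 0)
  roots-head [] x = ≡.refl
  roots-head (a ∷ as) x = ≡.cong ((x 0 K.+ a) K.*_) (roots-head as x)

  rootsK-nonZero : ∀ as x → All (λ a → x K.+ a ≢ K.0#) as → rootsK as x ≢ K.0#
  rootsK-nonZero [] x [] 1≡0 = K.0≢1 (≡.sym 1≡0)
  rootsK-nonZero (a ∷ as) x (p ∷ ps) = K.*-nonZero p (rootsK-nonZero as x ps)

  IsPoly-roots* : ∀ as {n φ} → IsPoly n φ → IsPoly (length as ℕ.+ n) (λ x → roots as x * φ x)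
  IsPoly-roots* [] p = IsPoly-resp (λ x → sym (*-identityˡ _)) p
  IsPoly-roots* (a ∷ as) p = IsPoly-resp (λ x → sym (*-assoc _ _ _)) (IsPoly-[x+a]* a (IsPoly-roots* as p))

  IsPoly-roots^* : ∀ as n {m φ} → IsPoly m φ → IsPoly (n ℕ.* length as ℕ.+ m) (λ x → roots as x ^ n * φ x)
  IsPoly-roots^* as zero p = IsPoly-resp (λ x → sym (*-identityˡ _)) p
  IsPoly-roots^* as (suc n) {m} {φ} p = IsPoly-weaken (ℕ.≤-reflexive (≡.sym (ℕ.+-assoc (length as) (n ℕ.* length as) m)))
    (IsPoly-resp (λ x → sym (*-assoc _ _ _)) (IsPoly-roots* as (IsPoly-roots^* as n p)))

  1^n≈1 : ∀ n → 1# ^ n ≈ 1#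
  1^n≈1 zero = refl
  1^n≈1 (suc n) = trans (*-identityˡ _) (1^n≈1 n)

  -- Each factor satisfies (T + a)^q = T^q + a, which is congruent to a; so the q-th power collapses
  -- to the constant f(0).
  roots^q : ∀ as → roots as T ^ q ≈ const (rootsK as K.0#) [mod q ]
  roots^q [] = ≈⇒mod (1^n≈1 q)
  roots^q (a ∷ as) = mod-trans (≈⇒mod (^-distrib-* (T + const a) (roots as T) q))
    (mod-trans (mod-* (mod-trans (≈⇒mod (frobenius T a)) (mod-+ (T^n≈0 q) mod-refl)) (roots^q as))
      (≈⇒mod (trans (*-congʳ (trans (+-identityˡ (const a)) (coeffwise λ n → ≡.cong (λ c → const c n) (≡.sym (K.+-identityˡ a)))))
        (sym (const-homo-* _ _)))))

  -- Compare the parities of the orders of both sides.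
  odd≢even-order : ∀ n {h p r e} → h 0 ≢ K.0# → e ≢ K.0# → T * (h * (p * p)) ≈ const e * (r * r) →
    p ≈ 0ˢ [mod n ] × r ≈ 0ˢ [mod n ]
  odd≢even-order zero _ _ _ = coeffwise< (λ ()) , coeffwise< (λ ())
  odd≢even-order (suc n) {h} {p} {r} {e} h≢0 e≢0 eq = lift p≈Tp′ (proj₁ ih) , lift r≈Tr′ (proj₂ ih)
    where
    p′ = shift p
    r′ = shift r
    square-zero : ∀ {x y} → x ≢ K.0# → x K.* (y K.* y) ≡ K.0# → y ≡ K.0#
    square-zero x≢0 xyy≡0 with K.integral xyy≡0
    ... | inj₁ x≡0 with () ← x≢0 x≡0
    ... | inj₂ yy≡0 with K.integral yy≡0
    ...   | inj₁ y≡0 = y≡0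
    ...   | inj₂ y≡0 = y≡0
    r≈Tr′ : r ≈ T * r′
    r≈Tr′ = T*-shift r (square-zero e≢0 (≡.trans (≡.sym (at eq 0)) (T*-zero (h * (p * p)))))
    eq₁ : h * (p * p) ≈ T * (const e * (r′ * r′))
    eq₁ = T*-cancel (trans eq (trans (*-congˡ (*-cong r≈Tr′ r≈Tr′))
      (solve 3 (λ e t r → e :* ((t :* r) :* (t :* r)) := t :* (t :* (e :* (r :* r)))) refl (const e) T r′)))
    p≈Tp′ : p ≈ T * p′
    p≈Tp′ = T*-shift p (square-zero h≢0 (≡.trans (at eq₁ 0) (T*-zero (const e * (r′ * r′)))))
    eq₂ : T * (h * (p′ * p′)) ≈ const e * (r′ * r′)
    eq₂ = T*-cancel (trans (trans
      (solve 3 (λ h t p → t :* (t :* (h :* (p :* p))) := h :* ((t :* p) :* (t :* p))) refl h T p′)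
      (*-congˡ (*-cong (sym p≈Tp′) (sym p≈Tp′)))) eq₁)
    ih = odd≢even-order n h≢0 e≢0 eq₂
    lift : ∀ {f} → f ≈ T * shift f → shift f ≈ 0ˢ [mod n ] → f ≈ 0ˢ [mod suc n ]
    lift f≈ s = mod-trans (≈⇒mod f≈) (T*-mod-suc s)

  module _ (d : ℕ) (q≡ : q ≡ suc (d ℕ.+ d)) (a : Fin q) (as : List (Fin q))
    (simple : All (a ≢_) as) (nonZero : All (_≢ K.0#) (a ∷ as))
    (e : ℕ) (small : length (a ∷ as) ℕ.+ (e ℕ.+ suc e) ≤ q) where

    private
      f = roots (a ∷ as)

      f₀ = rootsK (a ∷ as) K.0#

      f₀≢0 : f₀ ≢ K.0#
      f₀≢0 = rootsK-nonZero (a ∷ as) K.0# (shifted nonZero)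
        where
        shifted : ∀ {l} → All (_≢ K.0#) l → All (λ a → K.0# K.+ a ≢ K.0#) l
        shifted [] = []
        shifted (p ∷ ps) = (λ z → p (≡.trans (≡.sym (K.+-identityˡ _)) z)) ∷ shifted ps

    module _ (u v : Vec (Fin q) (suc e)) (vanish : ev u T + f T ^ d * ev v T ≈ 0ˢ [mod q ]) where

      private
        p = ev u T
        r = ev v T
        g = f T ^ d

        -- With u ≡ -f^d v the left side becomes f^(2d+1) v² = f^q v². In place of a subtraction the
        -- term f^(d+1) u v is added to both sides, and each side is then a multiple of u + f^d v.
        square-relation : f T * (p * p) ≈ const f₀ * (r * r) [mod q ]
        square-relation = mod-trans (mod-+-cancelʳ (p * f T * g * r) (mod-trans (≈⇒mod
              (solve 4 (λ f p r g → f :* (p :* p) :+ p :* f :* g :* r := (p :* f) :* (p :+ g :* r)) refl (f T) p r g))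
              (mod-trans (mod-* (mod-refl {f = p * f T}) vanish) (mod-trans (≈⇒mod (zeroʳ (p * f T)))
              (mod-trans (≈⇒mod (sym (zeroʳ (g * r * f T)))) (mod-trans (mod-* (mod-refl {f = g * r * f T}) (mod-sym vanish)) (≈⇒mod
              (solve 4 (λ f p r g → (g :* r :* f) :* (p :+ g :* r) := f :* (g :* g) :* (r :* r) :+ p :* f :* g :* r) refl (f T) p r g))))))))
            (mod-* (mod-trans (≈⇒mod f^q) (roots^q (a ∷ as))) mod-refl)
          where
          f^q : f T * (g * g) ≈ f T ^ q
          f^q = trans (*-congˡ (sym (^-homo-* (f T) d d))) (reflexive (≡.cong (f T ^_) (≡.sym q≡)))

        -- Both sides have at most `q` coefficients by `small`, so the congruence modulo T^q is an
        -- identity of polynomials and can be expanded at any point.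
        relation : ∀ x → f x * (ev u x * ev u x) ≈ const f₀ * (ev v x * ev v x)
        relation x with w , w≈ ← IsPoly-weaken small (IsPoly-roots* (a ∷ as) (IsPoly-* (IsPoly-ev u) (IsPoly-ev u)))
          with z , z≈ ← IsPoly-weaken (ℕ.≤-trans (ℕ.m≤n+m (e ℕ.+ suc e) (length (a ∷ as))) small) (IsPoly-scale f₀ (IsPoly-* (IsPoly-ev v) (IsPoly-ev v))) =
          trans (w≈ x) (trans (sym (ev-difference w z x)) (trans (+-congʳ (diff≈0 x)) (trans (+-identityˡ _) (sym (z≈ x)))))
          where
          diff = zipWith (λ a b → a K.+ K.- b) w z
          diff≈0 : ∀ x → ev diff x ≈ 0ˢ
          diff≈0 x = trans (reflexive (≡.cong (λ v → ev v x) (coefficients-zero diff (mod-+-cancelʳ (ev z T)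
            (mod-trans (≈⇒mod (trans (ev-difference w z T) (sym (w≈ T)))) (mod-trans square-relation
              (≈⇒mod (trans (z≈ T) (sym (+-identityˡ _)))))))))) (ev-zero q x)

        x₀ = X (K.- a)

        -- At x = -a the factor x + a expands to `T`, while the remaining factors form a unit
        -- because `a` is a simple entry. The left side then has odd order and the right side even
        -- order, unless both vanish.
        at-simple-root : T * (roots as x₀ * (ev u x₀ * ev u x₀)) ≈ const f₀ * (ev v x₀ * ev v x₀)
        at-simple-root = trans (trans (sym (*-assoc T _ _)) (*-congʳ (*-congʳ (sym x₀+a≈T)))) (relation x₀)
          where
          x₀+a≈T : x₀ + const a ≈ T
          x₀+a≈T = trans (+-congˡ (coeffwise λ n → ≡.cong (λ c → const c n) (≡.sym (K.-‿involutive a)))) (X-b≈T (K.- a))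

        unit : roots as x₀ 0 ≢ K.0#
        unit z = rootsK-nonZero as (K.- a) (shifted simple)
          (≡.trans (≡.cong (rootsK as) (≡.sym (X-head (K.- a)))) (≡.trans (≡.sym (roots-head as x₀)) z))
          where
          shifted : ∀ {l} → All (a ≢_) l → All (λ b → K.- a K.+ b ≢ K.0#) l
          shifted [] = []
          shifted (a≢b ∷ ps) = (λ s → a≢b (≡.sym (K.+-cancelˡ (K.- a) (≡.trans s (≡.sym (K.-‿inverseˡ a)))))) ∷ shifted ps

        expansion : ∀ n → ev u x₀ ≈ 0ˢ [mod n ] × ev v x₀ ≈ 0ˢ [mod n ]
        expansion n = odd≢even-order n unit f₀≢0 at-simple-root

      both-zero : u ≡ replicate (suc e) K.0# × v ≡ replicate (suc e) K.0#
      both-zero =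
        coefficients-zero u (≈⇒mod (zero-of-expansion u (K.- a) (coeffwise λ n → at< (proj₁ (expansion (suc n))) ℕ.≤-refl) T)) ,
        coefficients-zero v (≈⇒mod (zero-of-expansion v (K.- a) (coeffwise λ n → at< (proj₂ (expansion (suc n))) ℕ.≤-refl) T))

    Coefficients : ℕ → Set
    Coefficients = Vec (Vec (Fin q) (suc e) × Vec (Fin q) (suc e))

    auxiliary : ∀ {J} → Coefficients J → Series → Series
    auxiliary [] x = 0#
    auxiliary ((u , v) ∷ s) x = (ev u x + f x ^ d * ev v x) + x ^ q * auxiliary s x

    private
      +-cancelˡ : ∀ {c x y} → c + x ≈ c + y → x ≈ y
      +-cancelˡ {c} p = coeffwise λ n → K.+-cancelˡ (c n) (at p n)

      difference-zero : ∀ {n} (u u′ : Vec (Fin q) n) → zipWith (λ a b → a K.+ K.- b) u u′ ≡ replicate n K.0# → u ≡ u′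
      difference-zero [] [] _ = ≡.refl
      difference-zero (a ∷ u) (b ∷ u′) p = ≡.cong₂ _∷_ (K.x-y≡0⇒x≡y (≡.cong head p)) (difference-zero u u′ (≡.cong tail p))

      drop-higher : ∀ {c} y → c + T ^ q * y ≈ c [mod q ]
      drop-higher {c} y = mod-trans (mod-+ mod-refl (T^n*≈0 q y)) (≈⇒mod (+-identityʳ c))

      lowest-difference : ∀ (u v u′ v′ : Vec (Fin q) (suc e)) {y y′} →
        (ev u T + f T ^ d * ev v T) + T ^ q * y ≈ (ev u′ T + f T ^ d * ev v′ T) + T ^ q * y′ →
        ev (zipWith (λ a b → a K.+ K.- b) u u′) T + f T ^ d * ev (zipWith (λ a b → a K.+ K.- b) v v′) T ≈ 0ˢ [mod q ]
      lowest-difference u v u′ v′ {y} {y′} eq = mod-+-cancelʳ (ev u′ T + f T ^ d * ev v′ T) (mod-trans (≈⇒mod (trans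
        (solve 5 (λ a b c d g → (a :+ g :* b) :+ (c :+ g :* d) := (a :+ c) :+ g :* (b :+ d)) refl (ev δu T) (ev δv T) (ev u′ T) (ev v′ T) (f T ^ d))
        (+-cong (ev-difference u u′ T) (*-congˡ (ev-difference v v′ T)))))
        (mod-trans (mod-sym (drop-higher y)) (mod-trans (≈⇒mod eq) (mod-trans (drop-higher y′) (≈⇒mod (sym (+-identityˡ _)))))))
        where
        δu = zipWith (λ a b → a K.+ K.- b) u u′
        δv = zipWith (λ a b → a K.+ K.- b) v v′

    -- This is the nonvanishing that the pigeonhole argument needs. Modulo T^q only the lowest block
    -- is visible and `both-zero` applies to the difference of the two lowest blocks; after they are
    -- removed, T^q is cancelled and the next block becomes lowest.
    auxiliary-injective : ∀ {J} (s s′ : Coefficients J) → auxiliary s T ≈ auxiliary s′ T → s ≡ s′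
    auxiliary-injective [] [] _ = ≡.refl
    auxiliary-injective ((u , v) ∷ s) ((u′ , v′) ∷ s′) eq = ≡.cong₂ _∷_ (≡.cong₂ _,_ u≡u′ v≡v′)
      (auxiliary-injective s s′ (T^-cancel q (+-cancelˡ (trans eq (+-congʳ same-lowest)))))
      where
      zeros = both-zero (zipWith (λ a b → a K.+ K.- b) u u′) (zipWith (λ a b → a K.+ K.- b) v v′)
        (lowest-difference u v u′ v′ {auxiliary s T} {auxiliary s′ T} eq)
      u≡u′ : u ≡ u′
      u≡u′ = difference-zero u u′ (proj₁ zeros)
      v≡v′ : v ≡ v′
      v≡v′ = difference-zero v v′ (proj₂ zeros)
      same-lowest : ev u′ T + f T ^ d * ev v′ T ≈ ev u T + f T ^ d * ev v T
      same-lowest = reflexive (≡.cong₂ (λ u v → ev u T + f T ^ d * ev v T) (≡.sym u≡u′) (≡.sym v≡v′))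

    IsPoly-auxiliary : ∀ {J} (s : Coefficients J) → IsPoly (J ℕ.* q ℕ.+ (d ℕ.* length (a ∷ as) ℕ.+ suc e)) (auxiliary s)
    IsPoly-auxiliary [] = IsPoly-0
    IsPoly-auxiliary {suc J} ((u , v) ∷ s) = IsPoly-+
      (IsPoly-weaken (ℕ.m≤n+m _ (suc J ℕ.* q)) (IsPoly-+ (IsPoly-weaken (ℕ.m≤n+m _ (d ℕ.* length (a ∷ as))) (IsPoly-ev u)) (IsPoly-roots^* (a ∷ as) d (IsPoly-ev v))))
      (IsPoly-weaken (ℕ.≤-reflexive (≡.sym (ℕ.+-assoc q (J ℕ.* q) _))) (IsPoly-x^* q (IsPoly-auxiliary s)))
      where
      IsPoly-x^* : ∀ n {m φ} → IsPoly m φ → IsPoly (n ℕ.+ m) (λ x → x ^ n * φ x)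
      IsPoly-x^* zero p = IsPoly-resp (λ x → sym (*-identityˡ _)) p
      IsPoly-x^* (suc n) p = IsPoly-resp (λ x → sym (*-assoc _ _ _)) (IsPoly-x* (IsPoly-x^* n p))

-- Stepanov's method: few points satisfy f^d = ε.

module Stepanov {q : ℕ} (F : FiniteFieldOn q) where

  open import Data.Nat using (zero; suc; _≤_; _<_; s≤s; z≤n)
  import Data.Nat.Properties as ℕ
  open import Data.Fin using (Fin; toℕ; fromℕ<; funToFin; finToFun)
  open import Data.Fin.Properties using (pigeonhole; funToFin-finToFin; finToFun-funToFin; toℕ-fromℕ<; <⇒≢)
  open import Data.Vec using (Vec; []; _∷_; _++_; zipWith; lookup; tabulate; splitAt)
  open import Data.Vec.Properties using (tabulate∘lookup; lookup∘tabulate; tabulate-cong)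
  open import Data.List using (List; []; _∷_; length)
  open import Data.List.Relation.Unary.All as All using (All; []; _∷_)
  open import Data.List.Relation.Unary.Unique.Propositional using (Unique)
  open import Data.Product using (∃; _,_; proj₁; proj₂)
  open import Function using (id)
  open import Relation.Nullary using (contradiction)
  open import Relation.Binary.PropositionalEquality as ≡ using (_≡_; _≢_)

  private module K = Field F

  private
    scalars : K.ScalarEmbedding K.ring
    scalars = record { ι = id ; ι-0 = ≡.refl ; ι-+ = λ _ _ → ≡.refl ; ι-* = λ _ _ → ≡.refl }
    module PK = Polynomial F K.ring scalars

  open Series F hiding (ring)
  open Polynomial F (Series.ring F) (Series.embedding F)
  open RootCount F using (X; X-head; zero-of-high-order)
  open Frobenius F using (frobenius)
  open Nonvanishing F
  open CommutativeRing (Series.ring F) hiding (_≈_)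
  open import Algebra.Properties.Semiring.Exp semiring using (_^_; ^-congˡ)
  open import Algebra.Properties.CommutativeSemiring.Exp commutativeSemiring using (^-distrib-*)
  open import Algebra.Solver.Ring.NaturalCoefficients.Default commutativeSemiring
    using (solve; _:+_; _:*_; _:=_)

  const-cong : ∀ {a b} → a ≡ b → const a ≈ const b
  const-cong ≡.refl = refl

  -- Every coefficient of the expansion at `b` is a polynomial of degree at most `e` in `b`. Fixing
  -- one coefficient at all points simultaneously therefore takes `suc e` scalar conditions,
  -- whatever the number of points.
  CoeffDegree : ℕ → (Fin q → Series) → Set
  CoeffDegree e φ = ∀ i → PK.IsPoly (suc e) (λ b → φ b i)

  CD-weaken : ∀ {e e′ φ} → e ≤ e′ → CoeffDegree e φ → CoeffDegree e′ φ
  CD-weaken e≤ p i = PK.IsPoly-weaken (s≤s e≤) (p i)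

  CD-+ : ∀ {e φ ψ} → CoeffDegree e φ → CoeffDegree e ψ → CoeffDegree e (λ b → φ b + ψ b)
  CD-+ p r i = PK.IsPoly-+ (p i) (r i)

  CD-* : ∀ {e e′ φ ψ} → CoeffDegree e φ → CoeffDegree e′ ψ → CoeffDegree (e ℕ.+ e′) (λ b → φ b * ψ b)
  CD-* {e} {e′} {φ} {ψ} p r zero = PK.IsPoly-weaken (ℕ.≤-reflexive (ℕ.+-suc e e′)) (PK.IsPoly-* (p 0) (r 0))
  CD-* {e} {e′} {φ} {ψ} p r (suc i) = PK.IsPoly-+
    (PK.IsPoly-weaken (ℕ.≤-reflexive (ℕ.+-suc e e′)) (PK.IsPoly-* (p 0) (r (suc i))))
    (CD-* {φ = λ b → shift (φ b)} {ψ = ψ} (λ j → p (suc j)) r i)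

  CD-const : ∀ {e φ} → PK.IsPoly (suc e) φ → CoeffDegree e (λ b → const (φ b))
  CD-const p zero = p
  CD-const p (suc i) = PK.IsPoly-0

  CD-constant : ∀ f → CoeffDegree 0 (λ _ → f)
  CD-constant f i = PK.IsPoly-const (f i)

  IsPoly-id : PK.IsPoly 2 id
  IsPoly-id = PK.IsPoly-resp (λ b → K.*-identityʳ b) (PK.IsPoly-x* (PK.IsPoly-const K.1#))

  CD-ev : ∀ {n} (v : Vec (Fin q) n) → CoeffDegree n (λ b → ev v (X b))
  CD-ev [] i = PK.IsPoly-0
  CD-ev (c ∷ v) = CD-+ {φ = λ _ → const c} (CD-weaken {φ = λ _ → const c} z≤n (CD-constant (const c)))
    (CD-* {φ = X} (CD-+ {φ = const} (CD-const IsPoly-id) (CD-weaken {φ = λ _ → T} z≤n (CD-constant T))) (CD-ev v))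

  IsPoly-translate^ : ∀ a j → PK.IsPoly (suc j) (λ b → (b K.+ a) K.^ j)
  IsPoly-translate^ a zero = PK.IsPoly-const K.1#
  IsPoly-translate^ a (suc j) = PK.IsPoly-[x+a]* a (IsPoly-translate^ a j)

  -- Pascal's triangle computed in the field, hence already reduced to its characteristic.
  binomial : ℕ → ℕ → Fin q
  binomial n zero = K.1#
  binomial zero (suc k) = K.0#
  binomial (suc n) (suc k) = binomial n k K.+ binomial n (suc k)

  -- z^(m - n) (z + T)ⁿ cleared of denominators; the truncation of m ∸ i only affects terms beyond Tᵐ.
  clearedPower : ℕ → ℕ → Fin q → Series
  clearedPower m n z i = binomial n i K.* z K.^ (m ℕ.∸ i)

  -- The i-th coefficient of (z + T)^n is a binomial coefficient times z^(n - i). Multiplying by z^m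
  -- and setting z^n apart leaves z^(m - i), of degree at most `m` however large `n` is. Induction
  -- by Pascal's rule involves no division, so z = 0 is included.
  clearedPower-correct : ∀ m n z → const (z K.^ m) * (const z + T) ^ n ≈ const (z K.^ n) * clearedPower m n z [mod m ]
  clearedPower-correct m n z = coeffwise< λ {i} i<m → ≡.trans (const-* _ _ i) (≡.trans (go n i i<m) (≡.sym (const-* _ _ i)))
    where
    open import Algebra.Solver.Ring.NaturalCoefficients.Default K.commutativeSemiring as Solver
      using () renaming (solve to solveK; _:+_ to _⊞_; _:*_ to _⊠_; _:=_ to _⊜_)
    step : ∀ f i → ((const z + T) * f) (suc i) ≡ z K.* f (suc i) K.+ f i
    step f i = ≡.trans (at (distribʳ f (const z) T) (suc i)) (≡.cong₂ K._+_ (const-* z f (suc i)) (T*-suc f i))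
    step₀ : ∀ f → ((const z + T) * f) 0 ≡ z K.* f 0
    step₀ f = ≡.cong (K._* f 0) (K.+-identityʳ z)
    go : ∀ n i → i < m → z K.^ m K.* ((const z + T) ^ n) i ≡ z K.^ n K.* clearedPower m n z i
    go zero zero _ = ≡.trans (K.*-comm _ _) (≡.cong (K.1# K.*_) (≡.sym (K.*-identityˡ _)))
    go zero (suc i) _ = ≡.trans (K.zeroʳ _) (≡.sym (≡.trans (≡.cong (K.1# K.*_) (K.zeroˡ _)) (K.zeroʳ _)))
    go (suc n) zero i<m = ≡.trans (≡.cong (z K.^ m K.*_) (step₀ g)) (≡.trans
      (solveK 3 (λ a z g → a ⊠ (z ⊠ g) ⊜ z ⊠ (a ⊠ g)) ≡.refl (z K.^ m) z (g 0)) (≡.trans (≡.cong (z K.*_) (go n 0 i<m))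
      (≡.sym (K.*-assoc z _ _))))
      where g = (const z + T) ^ n
    go (suc n) (suc i) i<m = ≡.trans (≡.cong (z K.^ m K.*_) (step g i)) (≡.trans
      (solveK 4 (λ a z g h → a ⊠ (z ⊠ g ⊞ h) ⊜ z ⊠ (a ⊠ g) ⊞ a ⊠ h) ≡.refl (z K.^ m) z (g (suc i)) (g i)) (≡.trans
      (≡.cong₂ (λ x y → z K.* x K.+ y) (go n (suc i) i<m) (go n i (ℕ.<-trans (ℕ.n<1+n i) i<m))) (≡.trans
      (≡.cong (λ y → z K.* (zn K.* (b′ K.* y′)) K.+ zn K.* (b K.* y)) power)
      (solveK 5 (λ z zn b′ b y → z ⊠ (zn ⊠ (b′ ⊠ y)) ⊞ zn ⊠ (b ⊠ (z ⊠ y)) ⊜ (z ⊠ zn) ⊠ ((b ⊞ b′) ⊠ y)) ≡.refl z zn b′ b y′))))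
      where
      g = (const z + T) ^ n
      zn = z K.^ n
      b = binomial n i
      b′ = binomial n (suc i)
      y′ = z K.^ (m ℕ.∸ suc i)
      y = z K.^ (m ℕ.∸ i)
      power : z K.^ (m ℕ.∸ i) ≡ z K.* y′
      power = ≡.cong (z K.^_) (ℕ.+-∸-assoc 1 (ℕ.<-trans (ℕ.n<1+n i) i<m))

  clearedPowers : ℕ → ℕ → List (Fin q) → Fin q → Series
  clearedPowers m n [] b = 1#
  clearedPowers m n (a ∷ as) b = clearedPower m n (b K.+ a) * clearedPowers m n as b

  CD-clearedPowers : ∀ m n as → CoeffDegree (length as ℕ.* m) (clearedPowers m n as)
  CD-clearedPowers m n [] = CD-constant 1#
  CD-clearedPowers m n (a ∷ as) = CD-*
    (λ i → PK.IsPoly-weaken (s≤s (ℕ.m∸n≤m m i)) (PK.IsPoly-scale (binomial n i) (IsPoly-translate^ a (m ℕ.∸ i))))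
    (CD-clearedPowers m n as)

  X+a : ∀ a b → X b + const a ≈ const (b K.+ a) + T
  X+a a b = trans (solve 3 (λ b t a → b :+ t :+ a := b :+ a :+ t) refl (const b) T (const a)) (+-congʳ (sym (const-homo-+ b a)))

  clearedPowers-correct : ∀ m n as b →
    const (rootsK as b K.^ m) * roots as (X b) ^ n ≈ const (rootsK as b K.^ n) * clearedPowers m n as b [mod m ]
  clearedPowers-correct m n [] b = ≈⇒mod (*-cong (const-cong (≡.trans (K.1^n≡1 m) (≡.sym (K.1^n≡1 n)))) (1^n≈1 n))
  clearedPowers-correct m n (a ∷ as) b = mod-trans (≈⇒mod (trans
      (*-cong (trans (const-cong (K.^-distrib-* z y m)) (const-homo-* _ _))
        (trans (^-distrib-* _ _ n) (*-congʳ (^-congˡ n (X+a a b)))))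
      (solve 4 (λ s t u v → (s :* t) :* (u :* v) := (s :* u) :* (t :* v)) refl
        (const (z K.^ m)) (const (y K.^ m)) ((const z + T) ^ n) (roots as (X b) ^ n))))
    (mod-trans (mod-* (clearedPower-correct m n z) (clearedPowers-correct m n as b)) (≈⇒mod (trans
      (solve 4 (λ s t u v → (s :* u) :* (t :* v) := (s :* t) :* (u :* v)) refl
        (const (z K.^ n)) (const (y K.^ n)) (clearedPower m n z) (clearedPowers m n as b))
      (*-congʳ (sym (trans (const-cong (K.^-distrib-* z y n)) (const-homo-* _ _)))))))
    where
    z = b K.+ a
    y = rootsK as b

  -- To order m ≤ q the power X^(qj) is thus the constant b^j. The high powers that carry the degree
  -- of the auxiliary polynomial contribute only j to the degree of the conditions in b.
  X^q : ∀ b {m} → m ≤ q → X b ^ q ≈ const b [mod m ]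
  X^q b m≤q = mod-weaken m≤q (mod-trans (≈⇒mod (trans (^-congˡ q (+-comm (const b) T)) (frobenius T b)))
    (mod-trans (mod-+ (T^n≈0 q) mod-refl) (≈⇒mod (+-identityˡ _))))

  module _ (d : ℕ) (q≡ : q ≡ suc (d ℕ.+ d)) (a : Fin q) (as₀ : List (Fin q))
    (simple : All (a ≢_) as₀) (nonZero : All (_≢ K.0#) (a ∷ as₀))
    (e : ℕ) (small : length (a ∷ as₀) ℕ.+ (e ℕ.+ suc e) ≤ q)
    (m : ℕ) (m≤q : m ≤ q) (ε : Fin q) (ε≢0 : ε ≢ K.0#) where

    private
      as = a ∷ as₀
      k = length as
      0<d : 0 < d
      0<d = ℕ.≰⇒> λ { z≤n → ℕ.<⇒≱ {1} {q} (ℕ.≤-trans (s≤s (ℕ.≤-trans (ℕ.≤-trans (s≤s z≤n) (ℕ.m≤n+m (suc e) e)) (ℕ.m≤n+m _ (length as₀)))) small)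
        (ℕ.≤-reflexive q≡) }
      Coeffs = Coefficients d q≡ a as₀ simple nonZero e small
      aux : ∀ {J} → Coeffs J → Series → Series
      aux = auxiliary d q≡ a as₀ simple nonZero e small

    -- Where f^d = ε this is f(b)ᵐ times the expansion of the auxiliary polynomial at b, but its coefficients
    -- are polynomials in b.
    expansion : ∀ {J} → Coeffs J → Fin q → Series
    expansion [] b = 0#
    expansion ((u , v) ∷ s) b = (const (rootsK as b K.^ m) * ev u (X b) + const ε * (clearedPowers m d as b * ev v (X b)))
      + const b * expansion s b

    private
      rootsK^-poly : ∀ n → PK.IsPoly (suc (n ℕ.* k)) (λ b → rootsK as b K.^ n)
      rootsK^-poly zero = PK.IsPoly-const K.1#
      rootsK^-poly (suc n) = PK.IsPoly-weaken (ℕ.≤-reflexive (ℕ.+-suc k (n ℕ.* k))) (times as (rootsK^-poly n))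
        where
        times : ∀ as {n φ} → PK.IsPoly n φ → PK.IsPoly (length as ℕ.+ n) (λ x → rootsK as x K.* φ x)
        times [] p = PK.IsPoly-resp (λ x → ≡.sym (K.*-identityˡ _)) p
        times (a ∷ as) p = PK.IsPoly-resp (λ x → ≡.sym (K.*-assoc _ _ _)) (PK.IsPoly-[x+a]* a (times as p))

    -- `J` comes from the powers of b that replace X^q, `k * m` from the cleared powers of the
    -- linear factors, and `suc e` from the blocks. Neither `d` nor `q` enters the degree, which is
    -- the gain of the method.
    CD-expansion : ∀ {J} (s : Coeffs J) → CoeffDegree (J ℕ.+ (k ℕ.* m ℕ.+ suc e)) (expansion s)
    CD-expansion [] i = PK.IsPoly-0
    CD-expansion {suc J} ((u , v) ∷ s) = CD-+
      {φ = λ b → const (rootsK as b K.^ m) * ev u (X b) + const ε * (clearedPowers m d as b * ev v (X b))}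
      (CD-weaken {φ = λ b → const (rootsK as b K.^ m) * ev u (X b) + const ε * (clearedPowers m d as b * ev v (X b))}
        (ℕ.m≤n+m _ (suc J))
        (CD-+ {φ = λ b → const (rootsK as b K.^ m) * ev u (X b)}
          (CD-* {φ = λ b → const (rootsK as b K.^ m)} (CD-const (PK.IsPoly-weaken (ℕ.≤-reflexive (≡.cong suc (ℕ.*-comm m k))) (rootsK^-poly m))) (CD-ev u))
          (CD-* {φ = λ _ → const ε} (CD-constant (const ε)) (CD-* {φ = clearedPowers m d as} (CD-clearedPowers m d as) (CD-ev v)))))
      (CD-* {φ = const} (CD-const IsPoly-id) (CD-expansion s))

    expansion-correct : ∀ b → rootsK as b K.^ d ≡ ε → ∀ {J} (s : Coeffs J) →
      const (rootsK as b K.^ m) * aux s (X b) ≈ expansion s b [mod m ]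
    expansion-correct b good [] = ≈⇒mod (zeroʳ _)
    expansion-correct b good ((u , v) ∷ s) = mod-trans (≈⇒mod
      (solve 6 (λ c u g v x r → c :* ((u :+ g :* v) :+ x :* r) := (c :* u :+ (c :* g) :* v) :+ x :* (c :* r)) refl
        (const (rootsK as b K.^ m)) (ev u (X b)) (roots as (X b) ^ d) (ev v (X b)) (X b ^ q) (aux s (X b))))
      (mod-+ (mod-+ mod-refl (mod-trans (mod-* (mod-trans (clearedPowers-correct m d as b) (≈⇒mod (*-congʳ (const-cong good)))) mod-refl)
        (≈⇒mod (*-assoc _ _ _))))
        (mod-* (X^q b m≤q) (expansion-correct b good s)))

    module _ (J : ℕ) where
      private
        -- `V` is the number of scalars in one condition, of which there are `m`, and `N` is the
        -- number of free coefficients.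
        V = suc (J ℕ.+ (k ℕ.* m ℕ.+ suc e))
        N = J ℕ.* (suc e ℕ.+ suc e)

        encode : ∀ {J} → Coeffs J → Vec (Fin q) (J ℕ.* (suc e ℕ.+ suc e))
        encode [] = []
        encode ((u , v) ∷ s) = (u ++ v) ++ encode s

        decode : ∀ {J} (w : Vec (Fin q) (J ℕ.* (suc e ℕ.+ suc e))) → ∃ λ (s : Coeffs J) → encode s ≡ w
        decode {zero} [] = [] , ≡.refl
        decode {suc J} w with x , y , ≡.refl ← splitAt (suc e ℕ.+ suc e) w with u , v , ≡.refl ← splitAt (suc e) x with s , s≡ ← decode {J} y =
          (u , v) ∷ s , ≡.cong ((u ++ v) ++_) s≡

        coefficients : Fin (q ℕ.^ N) → Coeffs J
        coefficients i = proj₁ (decode {J} (tabulate (finToFun {q} {N} i)))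

        coefficients-injective : ∀ i j → coefficients i ≡ coefficients j → i ≡ j
        coefficients-injective i j p = ≡.trans (≡.sym (funToFin-finToFin {N} {q} i))
          (≡.trans (funToFin-cong same) (funToFin-finToFin {N} {q} j))
          where
          tabulated : tabulate (finToFun {q} {N} i) ≡ tabulate (finToFun {q} {N} j)
          tabulated = ≡.trans (≡.sym (proj₂ (decode {J} (tabulate (finToFun i))))) (≡.trans (≡.cong encode p) (proj₂ (decode {J} (tabulate (finToFun j)))))
          same : ∀ x → finToFun {q} {N} i x ≡ finToFun {q} {N} j x
          same x = ≡.trans (≡.sym (lookup∘tabulate _ x)) (≡.trans (≡.cong (λ w → lookup w x) tabulated) (lookup∘tabulate _ x))
          funToFin-cong : ∀ {n} {f g : Fin n → Fin q} → (∀ x → f x ≡ g x) → funToFin f ≡ funToFin g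
          funToFin-cong {zero} _ = ≡.refl
          funToFin-cong {suc n} p = ≡.cong₂ Data.Fin.combine (p Fin.zero) (funToFin-cong (λ x → p (Fin.suc x)))

        conditions : Coeffs J → Fin m → Vec (Fin q) V
        conditions s i = proj₁ (CD-expansion s (toℕ i))

        -- The pigeonholes: all condition polynomials packed into one number. Equal codes mean equal
        -- expansions to order `m` at every point at once.
        code : Coeffs J → Fin ((q ℕ.^ V) ℕ.^ m)
        code s = funToFin (λ i → funToFin (lookup (conditions s i)))

        code≡⇒expansion≡ : ∀ s s′ → code s ≡ code s′ → ∀ b → expansion s b ≈ expansion s′ b [mod m ]
        code≡⇒expansion≡ s s′ p b = coeffwise< λ {i} i<m → ≡.subst (λ i → expansion s b i ≡ expansion s′ b i) (toℕ-fromℕ< i<m)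
          (same (fromℕ< i<m))
          where
          vec-same : ∀ i → conditions s i ≡ conditions s′ i
          vec-same i = ≡.trans (≡.sym (tabulate∘lookup _)) (≡.trans (tabulate-cong λ j →
            ≡.trans (≡.sym (finToFun-funToFin (lookup (conditions s i)) j)) (≡.trans
            (≡.cong (λ c → finToFun c j) (≡.trans (≡.sym (finToFun-funToFin (λ i → funToFin (lookup (conditions s i))) i))
              (≡.trans (≡.cong (λ c → finToFun c i) p) (finToFun-funToFin (λ i → funToFin (lookup (conditions s′ i))) i))))
            (finToFun-funToFin (lookup (conditions s′ i)) j))) (tabulate∘lookup _))
          same : ∀ i → expansion s b (toℕ i) ≡ expansion s′ b (toℕ i)
          same i = ≡.trans (proj₂ (CD-expansion s (toℕ i)) b) (≡.trans (≡.cong (λ w → PK.ev w b) (vec-same i))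
            (≡.sym (proj₂ (CD-expansion s′ (toℕ i)) b)))

      -- There are more coefficient vectors than systems of conditions, so two auxiliary polynomials have the
      -- same expansions to order m at all points with f^d = ε; their difference vanishes there.
      few-good-points : V ℕ.* m < N → ∀ bs → Unique bs → All (λ b → rootsK as b K.^ d ≡ ε) bs →
        length bs ℕ.* m < J ℕ.* q ℕ.+ (d ℕ.* k ℕ.+ suc e)
      few-good-points Vm<N bs unique good with pigeonhole q^Vm<q^N (λ i → code (coefficients i))
        where
        1<q : 1 < q
        1<q = ℕ.≤-trans (s≤s (ℕ.≤-trans 0<d (ℕ.m≤m+n d d))) (ℕ.≤-reflexive (≡.sym q≡))
        q^Vm<q^N : (q ℕ.^ V) ℕ.^ m < q ℕ.^ N
        q^Vm<q^N = ≡.subst (_< q ℕ.^ N) (≡.sym (ℕ.^-*-assoc q V m)) (ℕ.^-monoʳ-< q 1<q Vm<N)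
      ... | i , j , i<j , same-code with length bs ℕ.* m ℕ.<? J ℕ.* q ℕ.+ (d ℕ.* k ℕ.+ suc e)
      ...   | Relation.Nullary.yes p = p
      ...   | Relation.Nullary.no ¬p = contradiction (coefficients-injective i j
                (auxiliary-injective d q≡ a as₀ simple nonZero e small s s′ (agree T))) (<⇒≢ i<j)
        where
        s = coefficients i
        s′ = coefficients j
        w = proj₁ (IsPoly-auxiliary d q≡ a as₀ simple nonZero e small s)
        w≈ = proj₂ (IsPoly-auxiliary d q≡ a as₀ simple nonZero e small s)
        w′ = proj₁ (IsPoly-auxiliary d q≡ a as₀ simple nonZero e small s′)
        w′≈ = proj₂ (IsPoly-auxiliary d q≡ a as₀ simple nonZero e small s′)
        δ = zipWith (λ a b → a K.+ K.- b) w w′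
        δ+aux : ∀ x → ev δ x + aux s′ x ≈ aux s x
        δ+aux x = trans (+-congˡ (w′≈ x)) (trans (ev-difference w w′ x) (sym (w≈ x)))
        -- Since f(b)^d = ε is nonzero, so is f(b), and the factor f(b)^m that cleared the
        -- denominators can be cancelled.
        high-order : ∀ {b} → rootsK as b K.^ d ≡ ε → ev δ (X b) ≈ 0ˢ [mod m ]
        high-order {b} good = unit*-cancel-mod {u = const (rootsK as b K.^ m)} (K.^-nonZero r≢0 m)
          (mod-+-cancelʳ (const (rootsK as b K.^ m) * aux s′ (X b)) (mod-trans (≈⇒mod (trans (sym (distribˡ _ _ _)) (*-congˡ (δ+aux (X b)))))
            (mod-trans (expansion-correct b good s) (mod-trans (code≡⇒expansion≡ s s′ same-code b)
              (mod-trans (mod-sym (expansion-correct b good s′)) (≈⇒mod (sym (+-identityˡ _))))))))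
          where
          0^d : ∀ {n} → 0 < n → K.0# K.^ n ≡ K.0#
          0^d (s≤s _) = K.zeroˡ _
          r≢0 : rootsK as b ≢ K.0#
          r≢0 r≡0 = ε≢0 (≡.trans (≡.sym good) (≡.trans (≡.cong (K._^ d) r≡0) (0^d 0<d)))
        agree : ∀ x → aux s x ≈ aux s′ x
        agree x = trans (sym (δ+aux x)) (trans (+-congʳ (zero-of-high-order δ m bs unique (ℕ.≮⇒≥ ¬p) (All.map high-order good) x)) (+-identityˡ _))

-- The quadratic character.

module Character {q : ℕ} (F : FiniteFieldOn q) (d : ℕ) (q≡ : q ≡ suc (d ℕ.+ d)) (0<d : 0 ℕ.< d) where

  open import Data.Nat using (zero; z≤n; s≤s)
  import Data.Nat.Properties as ℕ
  open import Data.Fin.Properties using (_≟_)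
  open import Data.List using (allFin)
  open import Data.List.Properties using (length-tabulate)
  open import Data.List.Relation.Unary.All.Properties using (tabulate⁺)
  open import Data.List.Relation.Unary.Unique.Propositional.Properties using (allFin⁺)
  open import Data.Vec using (zipWith)
  open import Data.Integer using (ℤ; 0ℤ; 1ℤ; -1ℤ)
  import Data.Integer as ℤ
  open import Data.Product using (proj₁; proj₂)
  open import Data.Sum using (_⊎_; inj₁; inj₂)
  open import Data.Empty using (⊥-elim)
  open import Function using (id)
  open import Relation.Nullary using (yes; no)

  open Field F
  open import Algebra.Solver.Ring.NaturalCoefficients.Default commutativeSemiring
    using (solve; _:+_; _:*_; _:=_)

  square≡1 : ∀ {y} → y * y ≡ 1# → y ≡ 1# ⊎ y ≡ - 1#
  square≡1 {y} yy≡1 with integral {y + - 1#} {y + 1#} factored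
    where
    factored : (y + - 1#) * (y + 1#) ≡ 0#
    factored = begin
      (y + - 1#) * (y + 1#)                ≡⟨ solve 3 (λ y m i → (y :+ m) :* (y :+ i) := y :* y :+ (i :+ m) :* y :+ m :* i) ≡.refl y (- 1#) 1# ⟩
      y * y + (1# + - 1#) * y + - 1# * 1#  ≡⟨ ≡.cong₂ _+_ (≡.cong₂ (λ a b → a + b * y) yy≡1 (-‿inverseʳ 1#)) (*-identityʳ _) ⟩
      1# + 0# * y + - 1#                         ≡⟨ ≡.cong (λ a → 1# + a + - 1#) (zeroˡ y) ⟩
      1# + 0# + - 1#                             ≡⟨ ≡.trans (≡.cong (_+ - 1#) (+-identityʳ 1#)) (-‿inverseʳ 1#) ⟩
      0#                                         ∎
      where open ≡.≡-Reasoning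
  ... | inj₁ p = inj₁ (x-y≡0⇒x≡y p)
  ... | inj₂ p = inj₂ (+-cancelˡ 1# (≡.trans (+-comm 1# y) (≡.trans p (≡.sym (-‿inverseʳ 1#)))))

  z^d*z^d≡1 : ∀ {z} → z ≢ 0# → z ^ d * z ^ d ≡ 1#
  z^d*z^d≡1 {z} z≢0 = ≡.trans (≡.sym (^-homo-* z d d)) (fermat z z≢0 (d ℕ.+ d) q≡)

  -- Otherwise z^(d+1) = z for all z, contradicting d + 1 < q.
  1≢-1 : 1# ≢ - 1#
  1≢-1 1≡-1 = 0≢1 (≡.trans (≡.sym (S.at< (N.T^n≈0 (suc d)) (s≤s 0<d))) (S.at (all-fixed S.T) 1))
    where
    module S = Series F
    module P = Polynomial F S.ring S.embedding
    module N = Nonvanishing F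
    module Fr = Frobenius F
    module R = CommutativeRing S.ring
    open RootCount F using (X; X-head; zero-of-high-order)
    open import Algebra.Properties.Semiring.Exp R.semiring using () renaming (_^_ to _^ˢ_)
    fixed : ∀ z → z ^ suc d ≡ z
    fixed z with z ≟ 0#
    ... | yes ≡.refl = zeroˡ _
    ... | no z≢0 with square≡1 (z^d*z^d≡1 z≢0)
    ...   | inj₁ p = ≡.trans (≡.cong (z *_) p) (*-identityʳ z)
    ...   | inj₂ p = ≡.trans (≡.cong (z *_) (≡.trans p (≡.sym 1≡-1))) (*-identityʳ z)
    power-poly = Fr.IsPoly-^ (suc d)
    id-poly : P.IsPoly (suc (suc d)) id
    id-poly = P.IsPoly-weaken (s≤s (s≤s z≤n)) (P.IsPoly-resp (λ x → R.*-identityʳ x) (Fr.IsPoly-^ 1))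
    δ = zipWith (λ a b → a + - b) (proj₁ power-poly) (proj₁ id-poly)
    δ+x : ∀ x → P.ev δ x R.+ x S.≈ x ^ˢ suc d
    δ+x x = R.trans (R.+-congˡ (proj₂ id-poly x)) (R.trans (P.ev-difference (proj₁ power-poly) (proj₁ id-poly) x) (R.sym (proj₂ power-poly x)))
    vanish : ∀ b → P.ev δ (X b) S.≈ S.0ˢ [mod 1 ]
    vanish b = S.coeffwise< λ
      { {zero} _ → +-cancelˡ b (≡.trans (+-comm b _) (≡.trans (≡.cong (P.ev δ (X b) 0 +_) (≡.sym (X-head b)))
          (≡.trans (S.at (δ+x (X b)) 0) (≡.trans (Fr.^-head (X b) (suc d)) (≡.trans (≡.cong (_^ suc d) (X-head b))
          (≡.trans (fixed b) (≡.sym (+-identityʳ b))))))))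
      ; {suc _} (s≤s ()) }
    all-fixed : ∀ x → x ^ˢ suc d S.≈ x
    all-fixed x = R.trans (R.sym (δ+x x)) (R.trans (R.+-congʳ (zero-of-high-order δ 1 (allFin q) (allFin⁺ q) degree (tabulate⁺ vanish) x)) (R.+-identityˡ x))
      where
      degree = ℕ.≤-trans (s≤s (ℕ.+-monoˡ-≤ d 0<d)) (ℕ.≤-reflexive (≡.sym (≡.trans (ℕ.*-identityʳ _) (≡.trans (length-tabulate {n = q} id) q≡))))

  -- The graph of χ. Multiplicativity is checked on it case by case and carried over to χ by
  -- uniqueness of the value, which rests on 1 ≠ -1.
  data Value (z : Fin q) : ℤ → Set where
    is-zero     : z ≡ 0# → Value z 0ℤ
    is-square   : z ≢ 0# → z ^ d ≡ 1# → Value z 1ℤ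
    is-nonsquare : z ≢ 0# → z ^ d ≡ - 1# → Value z -1ℤ

  χ : Fin q → ℤ
  χ z with z ≟ 0#
  ... | yes _ = 0ℤ
  ... | no _ with z ^ d ≟ 1#
  ...   | yes _ = 1ℤ
  ...   | no _ = -1ℤ

  value : ∀ z → Value z (χ z)
  value z with z ≟ 0#
  ... | yes z≡0 = is-zero z≡0
  ... | no z≢0 with z ^ d ≟ 1#
  ...   | yes p = is-square z≢0 p
  ...   | no ¬p with square≡1 (z^d*z^d≡1 z≢0)
  ...     | inj₁ p = ⊥-elim (¬p p)
  ...     | inj₂ p = is-nonsquare z≢0 p

  value-unique : ∀ {z m n} → Value z m → Value z n → m ≡ n
  value-unique (is-zero _) (is-zero _) = ≡.refl
  value-unique (is-zero p) (is-square ¬p _) = ⊥-elim (¬p p)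
  value-unique (is-zero p) (is-nonsquare ¬p _) = ⊥-elim (¬p p)
  value-unique (is-square ¬p _) (is-zero p) = ⊥-elim (¬p p)
  value-unique (is-square _ _) (is-square _ _) = ≡.refl
  value-unique (is-square _ p) (is-nonsquare _ r) = ⊥-elim (1≢-1 (≡.trans (≡.sym p) r))
  value-unique (is-nonsquare ¬p _) (is-zero p) = ⊥-elim (¬p p)
  value-unique (is-nonsquare _ r) (is-square _ p) = ⊥-elim (1≢-1 (≡.trans (≡.sym p) r))
  value-unique (is-nonsquare _ _) (is-nonsquare _ _) = ≡.refl

  value-* : ∀ {z w m n} → Value z m → Value w n → Value (z * w) (m ℤ.* n)
  value-* {w = w} (is-zero ≡.refl) (is-zero _) = is-zero (zeroˡ w)
  value-* {w = w} (is-zero ≡.refl) (is-square _ _) = is-zero (zeroˡ w)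
  value-* {w = w} (is-zero ≡.refl) (is-nonsquare _ _) = is-zero (zeroˡ w)
  value-* {z} (is-square _ _) (is-zero ≡.refl) = is-zero (zeroʳ z)
  value-* {z} (is-nonsquare _ _) (is-zero ≡.refl) = is-zero (zeroʳ z)
  value-* {z} {w} (is-square z≢0 p) (is-square w≢0 r) = is-square (*-nonZero z≢0 w≢0)
    (≡.trans (^-distrib-* z w d) (≡.trans (≡.cong₂ _*_ p r) (*-identityˡ 1#)))
  value-* {z} {w} (is-square z≢0 p) (is-nonsquare w≢0 r) = is-nonsquare (*-nonZero z≢0 w≢0)
    (≡.trans (^-distrib-* z w d) (≡.trans (≡.cong₂ _*_ p r) (*-identityˡ _)))
  value-* {z} {w} (is-nonsquare z≢0 p) (is-square w≢0 r) = is-nonsquare (*-nonZero z≢0 w≢0)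
    (≡.trans (^-distrib-* z w d) (≡.trans (≡.cong₂ _*_ p r) (*-identityʳ _)))
  value-* {z} {w} (is-nonsquare z≢0 p) (is-nonsquare w≢0 r) = is-square (*-nonZero z≢0 w≢0)
    (≡.trans (^-distrib-* z w d) (≡.trans (≡.cong₂ _*_ p r) (≡.trans (≡.sym (-‿distribˡ-* 1# (- 1#)))
      (≡.trans (≡.cong -_ (*-identityˡ _)) (-‿involutive 1#)))))

  χ-* : ∀ z w → χ (z * w) ≡ χ z ℤ.* χ w
  χ-* z w = value-unique (value (z * w)) (value-* (value z) (value w))

  χ-1 : χ 1# ≡ 1ℤ
  χ-1 = value-unique (value 1#) (is-square (λ p → 0≢1 (≡.sym p)) (1^n≡1 d))

  χ-square : ∀ x → x ≢ 0# → χ (x * x) ≡ 1ℤ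
  χ-square x x≢0 = value-unique (value (x * x)) (is-square (*-nonZero x≢0 x≢0)
    (≡.trans (^-distrib-* x x d) (z^d*z^d≡1 x≢0)))

  χ-values : ∀ z → χ z ≡ 0ℤ ⊎ χ z ≡ 1ℤ ⊎ χ z ≡ -1ℤ
  χ-values z with χ z | value z
  ... | _ | is-zero _ = inj₁ ≡.refl
  ... | _ | is-square _ _ = inj₂ (inj₁ ≡.refl)
  ... | _ | is-nonsquare _ _ = inj₂ (inj₂ ≡.refl)

-- Finite sums of integers and counting in lists.

module Sums where

  open import Data.Integer using (ℤ; +_; -_; _+_; _*_; _≤_; 0ℤ; 1ℤ; +≤+; -[1+_]; nonNegative)
  open import Data.Integer.Properties hiding (_≟_)
  open import Data.Nat using (z≤n)
  open import Data.Product using (∃; _×_; _,_)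
  open import Data.List using (List; []; _∷_; length; filter)
  open import Data.List.Membership.Propositional using (_∈_)
  open import Data.List.Relation.Unary.Any using (here; there)
  open import Data.List.Relation.Unary.All using (All; []; _∷_)
  open import Data.List.Relation.Unary.AllPairs using ([]; _∷_)
  open import Data.List.Relation.Unary.Unique.Propositional using (Unique)
  open import Data.Empty using (⊥-elim)
  open import Relation.Nullary using (Dec; yes; no)
  open import Relation.Unary using (Decidable)
  open import Relation.Binary.Definitions using (DecidableEquality)
  open import Relation.Binary.PropositionalEquality
  open import Data.Integer.Tactic.RingSolver using (solve-∀)

  private variable
    A B : Set

  +-cancelʳ-≤ : ∀ c {a b} → a + c ≤ b + c → a ≤ b
  +-cancelʳ-≤ c {a} {b} p = ≤-trans (≤-reflexive (undo a c)) (≤-trans (+-monoˡ-≤ (- c) p) (≤-reflexive (sym (undo b c))))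
    where
    undo : ∀ a c → a ≡ a + c + - c
    undo = solve-∀

  ∑ : List A → (A → ℤ) → ℤ
  ∑ [] f = 0ℤ
  ∑ (x ∷ xs) f = f x + ∑ xs f

  ∑-cong : ∀ (xs : List A) {f g} → (∀ x → f x ≡ g x) → ∑ xs f ≡ ∑ xs g
  ∑-cong [] p = refl
  ∑-cong (x ∷ xs) p = cong₂ _+_ (p x) (∑-cong xs p)

  ∑-cong-∈ : ∀ (xs : List A) {f g} → (∀ {x} → x ∈ xs → f x ≡ g x) → ∑ xs f ≡ ∑ xs g
  ∑-cong-∈ [] p = refl
  ∑-cong-∈ (x ∷ xs) p = cong₂ _+_ (p (here refl)) (∑-cong-∈ xs (λ i → p (there i)))

  ∑-mono : ∀ (xs : List A) {f g} → (∀ x → f x ≤ g x) → ∑ xs f ≤ ∑ xs g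
  ∑-mono [] p = ≤-refl
  ∑-mono (x ∷ xs) p = +-mono-≤ (p x) (∑-mono xs p)

  ∑-mono-∈ : ∀ (xs : List A) {f g} → (∀ {x} → x ∈ xs → f x ≤ g x) → ∑ xs f ≤ ∑ xs g
  ∑-mono-∈ [] p = ≤-refl
  ∑-mono-∈ (x ∷ xs) p = +-mono-≤ (p (here refl)) (∑-mono-∈ xs (λ i → p (there i)))

  private
    interchange : ∀ a b c d → (a + b) + (c + d) ≡ (a + c) + (b + d)
    interchange = solve-∀

  ∑-+ : ∀ (xs : List A) f g → ∑ xs (λ x → f x + g x) ≡ ∑ xs f + ∑ xs g
  ∑-+ [] f g = refl
  ∑-+ (x ∷ xs) f g = trans (cong (λ e → (f x + g x) + e) (∑-+ xs f g)) (interchange (f x) (g x) (∑ xs f) (∑ xs g))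

  ∑-*ˡ : ∀ (xs : List A) c f → ∑ xs (λ x → c * f x) ≡ c * ∑ xs f
  ∑-*ˡ [] c f = sym (*-zeroʳ c)
  ∑-*ˡ (x ∷ xs) c f = trans (cong (λ e → c * f x + e) (∑-*ˡ xs c f)) (sym (*-distribˡ-+ c (f x) (∑ xs f)))

  ∑-*ʳ : ∀ (xs : List A) c f → ∑ xs (λ x → f x * c) ≡ ∑ xs f * c
  ∑-*ʳ xs c f = trans (∑-cong xs (λ x → *-comm (f x) c)) (trans (∑-*ˡ xs c f) (*-comm c _))

  ∑-const : ∀ (xs : List A) c → ∑ xs (λ _ → c) ≡ + length xs * c
  ∑-const [] c = sym (*-zeroˡ c)
  ∑-const (x ∷ xs) c = trans (cong (λ e → c + e) (∑-const xs c)) (sym (suc-* (+ length xs) c))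

  ∑-0 : ∀ (xs : List A) → ∑ xs (λ _ → 0ℤ) ≡ 0ℤ
  ∑-0 xs = trans (∑-const xs 0ℤ) (*-zeroʳ (+ length xs))

  ∑-comm : ∀ (xs : List A) (ys : List B) (f : A → B → ℤ) → ∑ xs (λ x → ∑ ys (f x)) ≡ ∑ ys (λ y → ∑ xs (λ x → f x y))
  ∑-comm [] ys f = sym (∑-0 ys)
  ∑-comm (x ∷ xs) ys f = trans (cong (λ e → ∑ ys (f x) + e) (∑-comm xs ys f)) (sym (∑-+ ys (f x) (λ y → ∑ xs (λ x → f x y))))

  ∑-square : ∀ (ys : List A) f → ∑ ys f * ∑ ys f ≡ ∑ ys (λ y → ∑ ys (λ y′ → f y * f y′))
  ∑-square ys f = trans (sym (∑-*ʳ ys (∑ ys f) f)) (∑-cong ys (λ y → sym (∑-*ˡ ys (f y) f)))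

  ∑-nonneg : ∀ (xs : List A) {f} → (∀ x → 0ℤ ≤ f x) → 0ℤ ≤ ∑ xs f
  ∑-nonneg [] p = ≤-refl
  ∑-nonneg (x ∷ xs) p = +-mono-≤ (p x) (∑-nonneg xs p)

  indicator : ∀ {P : Set} → Dec P → ℤ
  indicator (yes _) = 1ℤ
  indicator (no _) = 0ℤ

  indicator-nonneg : ∀ {P : Set} (P? : Dec P) → 0ℤ ≤ indicator P?
  indicator-nonneg (yes _) = +≤+ z≤n
  indicator-nonneg (no _) = ≤-refl

  ∑-indicator : ∀ {P : A → Set} (P? : Decidable P) xs → ∑ xs (λ x → indicator (P? x)) ≡ + length (filter P? xs)
  ∑-indicator P? [] = refl
  ∑-indicator P? (x ∷ xs) with P? x
  ... | yes _ = cong (λ e → 1ℤ + e) (∑-indicator P? xs)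
  ... | no _ = trans (+-identityˡ _) (∑-indicator P? xs)

  module _ (_≟_ : DecidableEquality A) where

    ∑-indicator-∉ : ∀ c xs → All (c ≢_) xs → ∑ xs (λ x → indicator (c ≟ x)) ≡ 0ℤ
    ∑-indicator-∉ c [] [] = refl
    ∑-indicator-∉ c (x ∷ xs) (c≢x ∷ c∉) with c ≟ x
    ... | yes c≡x = ⊥-elim (c≢x c≡x)
    ... | no _ = trans (+-identityˡ _) (∑-indicator-∉ c xs c∉)

    ∑-indicator-≤1 : ∀ c {xs} → Unique xs → ∑ xs (λ x → indicator (c ≟ x)) ≤ 1ℤ
    ∑-indicator-≤1 c [] = +≤+ z≤n
    ∑-indicator-≤1 c {x ∷ xs} (x∉ ∷ u) with c ≟ x
    ... | yes refl = ≤-reflexive (cong (λ e → 1ℤ + e) (∑-indicator-∉ c xs x∉))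
    ... | no _ = ≤-trans (≤-reflexive (+-identityˡ _)) (∑-indicator-≤1 c u)

  ∑-single : ∀ {xs : List A} {f x} → (∀ x → 0ℤ ≤ f x) → x ∈ xs → f x ≤ ∑ xs f
  ∑-single {xs = x ∷ xs} {f} p (here refl) = ≤-trans (≤-reflexive (sym (+-identityʳ (f x)))) (+-monoʳ-≤ (f x) (∑-nonneg xs p))
  ∑-single {xs = y ∷ xs} {f} p (there i) = ≤-trans (∑-single p i) (≤-trans (≤-reflexive (sym (+-identityˡ _))) (+-monoˡ-≤ (∑ xs f) (p y)))

  length≡∑1 : ∀ (xs : List A) → + length xs ≡ ∑ xs (λ _ → 1ℤ)
  length≡∑1 xs = sym (trans (∑-const xs 1ℤ) (*-identityʳ _))

  indicator-yes : ∀ {P : Set} (P? : Dec P) → P → indicator P? ≡ 1ℤ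
  indicator-yes (yes _) _ = refl
  indicator-yes (no ¬p) p = ⊥-elim (¬p p)

  -- The union bound, by exchanging the two summations: every `x` is counted at least once on the
  -- right.
  cover : ∀ {R : B → A → Set} (R? : ∀ y x → Dec (R y x)) (xs : List A) (ys : List B) →
    (∀ {x} → x ∈ xs → ∃ λ y → y ∈ ys × R y x) →
    + length xs ≤ ∑ ys (λ y → + length (filter (R? y) xs))
  cover R? xs ys covered = begin
    + length xs                                            ≡⟨ length≡∑1 xs ⟩
    ∑ xs (λ _ → 1ℤ)                                        ≤⟨ ∑-mono-∈ xs at-least-one ⟩
    ∑ xs (λ x → ∑ ys (λ y → indicator (R? y x)))           ≡⟨ ∑-comm xs ys (λ x y → indicator (R? y x)) ⟩
    ∑ ys (λ y → ∑ xs (λ x → indicator (R? y x)))           ≡⟨ ∑-cong ys (λ y → ∑-indicator (R? y) xs) ⟩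
    ∑ ys (λ y → + length (filter (R? y) xs))               ∎
    where
    open ≤-Reasoning
    at-least-one : ∀ {x} → x ∈ xs → 1ℤ ≤ ∑ ys (λ y → indicator (R? y x))
    at-least-one {x} x∈ with y , y∈ , r ← covered x∈ =
      ≤-trans (≤-reflexive (sym (indicator-yes (R? y x) r))) (∑-single (λ y → indicator-nonneg (R? y x)) y∈)

  ∑-≤-length : ∀ (ys : List A) {f} c → (∀ {y} → y ∈ ys → f y ≤ c) → ∑ ys f ≤ + length ys * c
  ∑-≤-length ys c p = ≤-trans (∑-mono-∈ ys p) (≤-reflexive (∑-const ys c))

  Unique-⊆⇒length≤ : DecidableEquality A → ∀ {xs ys : List A} → Unique xs → (∀ {x} → x ∈ xs → x ∈ ys) → length xs ℕ.≤ length ys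
  Unique-⊆⇒length≤ _≟_ {xs} {ys} u xs⊆ys = drop‿+≤+ (≤-trans (cover _≟_ xs ys (λ {x} x∈ → x , xs⊆ys x∈ , refl))
    (≤-trans (∑-≤-length ys 1ℤ (λ {y} _ → ≤-trans (≤-reflexive (sym (∑-indicator (y ≟_) xs))) (∑-indicator-≤1 _≟_ y u)))
      (≤-reflexive (*-identityʳ _))))

  -- As the entries of `xs` are distinct, each `y` is charged at most once; the entries of `ys` left
  -- over contribute nonnegatively.
  ∑-⊆ : DecidableEquality A → ∀ {xs ys : List A} {f} → Unique xs → (∀ {x} → x ∈ xs → x ∈ ys) → (∀ x → 0ℤ ≤ f x) → ∑ xs f ≤ ∑ ys f
  ∑-⊆ _≟_ {xs} {ys} {f} u xs⊆ys f≥0 = begin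
    ∑ xs f                                                  ≤⟨ ∑-mono-∈ xs (λ {x} x∈ → ≤-trans (≤-reflexive (sym (trans (cong (_* f x) (indicator-yes (x ≟ x) refl)) (*-identityˡ (f x)))))
                                                                 (∑-single {f = λ y → indicator (y ≟ x) * f y} (λ y → weight≥0 (y ≟ x) (f≥0 y)) (xs⊆ys x∈))) ⟩
    ∑ xs (λ x → ∑ ys (λ y → indicator (y ≟ x) * f y))       ≡⟨ ∑-comm xs ys (λ x y → indicator (y ≟ x) * f y) ⟩
    ∑ ys (λ y → ∑ xs (λ x → indicator (y ≟ x) * f y))       ≡⟨ ∑-cong ys (λ y → ∑-*ʳ xs (f y) (λ x → indicator (y ≟ x))) ⟩
    ∑ ys (λ y → ∑ xs (λ x → indicator (y ≟ x)) * f y)       ≤⟨ ∑-mono ys (λ y → *-monoʳ-≤-nonNeg (f y) {{nonNegative (f≥0 y)}} (∑-indicator-≤1 _≟_ y u)) ⟩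
    ∑ ys (λ y → 1ℤ * f y)                                   ≡⟨ ∑-cong ys (λ y → *-identityˡ (f y)) ⟩
    ∑ ys f                                                  ∎
    where
    open ≤-Reasoning
    weight≥0 : ∀ {P : Set} {n} (P? : Dec P) → 0ℤ ≤ n → 0ℤ ≤ indicator P? * n
    weight≥0 {n = n} (yes _) p = ≤-trans p (≤-reflexive (sym (*-identityˡ n)))
    weight≥0 {n = n} (no _) p = ≤-reflexive (sym (*-zeroˡ n))

  square≥0 : ∀ i → 0ℤ ≤ i * i
  square≥0 (+ n) = ≤-trans (+≤+ z≤n) (≤-reflexive (pos-* n n))
  square≥0 -[1+ n ] = +≤+ z≤n

-- Correlations of shifted character values.

module ShiftedProducts {q} (F : FiniteFieldOn q) (χ : Fin q → ℤ) where

  open import Data.Nat as ℕ using (ℕ)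
  open import Data.List using (List; []; _∷_; length; allFin)
  open import Data.List.Relation.Unary.All using (All)
  open import Data.List.Relation.Binary.Permutation.Propositional as Perm using (_↭_; prep; swap)
  open import Data.Integer as ℤ using (0ℤ; 1ℤ; -1ℤ)
  open import Data.Integer.Tactic.RingSolver using (solve-∀)
  open import Data.Product using (∃; _×_)
  open import Data.Sum using (_⊎_)
  open import Relation.Binary.PropositionalEquality as ≡ using (_≡_; _≢_)

  open Sums
  open Field F

  χ-product : List (Fin q) → Fin q → ℤ
  χ-product [] x = 1ℤ
  χ-product (a ∷ as) x = χ (x + a) ℤ.* χ-product as x

  χ-product-↭ : ∀ {as bs} → as ↭ bs → ∀ x → χ-product as x ≡ χ-product bs x
  χ-product-↭ Perm.refl x = ≡.refl
  χ-product-↭ (prep a p) x = ≡.cong (χ (x + a) ℤ.*_) (χ-product-↭ p x)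
  χ-product-↭ (swap {ys = bs} a b p) x = ≡.trans (≡.cong (λ t → χ (x + a) ℤ.* (χ (x + b) ℤ.* t)) (χ-product-↭ p x))
    (commute (χ (x + a)) (χ (x + b)) (χ-product bs x))
    where
    commute : ∀ r s t → r ℤ.* (s ℤ.* t) ≡ s ℤ.* (r ℤ.* t)
    commute = solve-∀
  χ-product-↭ (Perm.trans p r) x = ≡.trans (χ-product-↭ p x) (χ-product-↭ r x)

  χ-sum : List (Fin q) → ℤ
  χ-sum as = ∑ (allFin q) (χ-product as)

  -- Some shift has multiplicity one; the permutation brings it to the front, where the argument at
  -- a simple root expects it.
  HasSimpleEntry : List (Fin q) → Set
  HasSimpleEntry as = ∃ λ a → ∃ λ bs → as ↭ a ∷ bs × All (a ≢_) bs

  -- The interface between character sums and combinatorics. Length four suffices, as at most two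
  -- shifts come from the weight and two from the square of the sum over A.
  record SmallSums (C : ℕ) : Set where
    field
      χ-values : ∀ z → χ z ≡ 0ℤ ⊎ χ z ≡ 1ℤ ⊎ χ z ≡ -1ℤ
      χ-square : ∀ x → x ≢ 0# → χ (x * x) ≡ 1ℤ
      χ-sum-upper : ∀ as → length as ℕ.≤ 4 → HasSimpleEntry as → χ-sum as ℤ.≤ ℤ.+ C
      χ-sum-lower : ∀ as → length as ℕ.≤ 4 → HasSimpleEntry as → ℤ.- χ-sum as ℤ.≤ ℤ.+ C

-- Choice of the parameters and the character sum bound.

module CharacterSum {q : ℕ} (F : FiniteFieldOn q) (e : ℕ) (q≡ : q ≡ suc (suc (suc e) ℕ.+ suc (suc e)))
  (h : ℕ) (1≤h : 1 ℕ.≤ h) (36h²≤q : 36 ℕ.* (h ℕ.* h) ℕ.≤ q) (q≤144h² : q ℕ.≤ 144 ℕ.* (h ℕ.* h)) where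

  open import Data.Nat using (z≤n; s≤s; _≤_; _<_)
  import Data.Nat.Properties as ℕ
  open import Data.Nat.Tactic.RingSolver using (solve-∀)
  open import Data.Fin.Properties using (_≟_; any?)
  open import Data.List using (List; []; _∷_; length; filter; map; allFin)
  open import Data.List.Properties using (length-tabulate; length-map)
  open import Data.List.Relation.Unary.All as All using (All; []; _∷_; all?)
  import Data.List.Relation.Unary.All.Properties as All
  open import Data.List.Relation.Unary.Any using (here; there)
  open import Data.List.Relation.Unary.Unique.Propositional using (Unique)
  import Data.List.Relation.Unary.Unique.Propositional.Properties as Unique
  open import Data.List.Membership.Propositional using (_∈_; find)
  open import Data.List.Membership.Propositional.Properties using (∈-map⁺; ∈-filter⁻)
  open import Data.List.Relation.Binary.Permutation.Propositional.Properties using (↭-length)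
  open import Data.Integer as ℤ using (ℤ; 0ℤ; 1ℤ; -1ℤ; +≤+)
  import Data.Integer.Properties as ℤ
  open import Data.Product using (∃; _,_; proj₂)
  open import Data.Sum using (inj₁; inj₂)
  open import Data.Empty using (⊥-elim)
  open import Function using (id)
  open import Relation.Nullary using (yes; no; contradiction)
  open import Relation.Nullary.Decidable using (¬?; decidable-stable)

  open Sums
  open Field F
  open Nonvanishing F using (rootsK; rootsK-nonZero)
  private d = suc (suc e)
  open Character F d q≡ (s≤s z≤n)
  open ShiftedProducts F χ

  private
    D = suc e

    -- The parameters are order 2h, h + 1 blocks and D coefficients in each of P_j and Q_j. For k =
    -- 4 the unknowns exceed the conditions by 2D - (18 h² + 4 h), and 2D = q - 3 is at least 36 h²
    -- - 3.
    V-bound : ∀ {k} → k ≤ 4 → suc (suc h ℕ.+ (k ℕ.* (2 ℕ.* h) ℕ.+ D)) ℕ.* (2 ℕ.* h) < suc h ℕ.* (D ℕ.+ D)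
    V-bound {k} k≤4 = begin
      suc (suc (suc h ℕ.+ (k ℕ.* (2 ℕ.* h) ℕ.+ D)) ℕ.* (2 ℕ.* h))
        ≤⟨ s≤s (ℕ.*-monoˡ-≤ (2 ℕ.* h) (s≤s (ℕ.+-monoʳ-≤ (suc h) (ℕ.+-monoˡ-≤ D (ℕ.*-monoˡ-≤ (2 ℕ.* h) k≤4))))) ⟩
      suc (suc (suc h ℕ.+ (4 ℕ.* (2 ℕ.* h) ℕ.+ D)) ℕ.* (2 ℕ.* h))    ≡⟨ expand h D ⟩
      (18 ℕ.* (h ℕ.* h) ℕ.+ 4 ℕ.* h ℕ.+ 1) ℕ.+ h ℕ.* (D ℕ.+ D)       ≤⟨ ℕ.+-monoˡ-≤ (h ℕ.* (D ℕ.+ D)) main ⟩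
      (D ℕ.+ D) ℕ.+ h ℕ.* (D ℕ.+ D)                                  ∎
      where
      open ℕ.≤-Reasoning
      expand : ∀ h D → suc (suc (suc h ℕ.+ (4 ℕ.* (2 ℕ.* h) ℕ.+ D)) ℕ.* (2 ℕ.* h)) ≡ (18 ℕ.* (h ℕ.* h) ℕ.+ 4 ℕ.* h ℕ.+ 1) ℕ.+ h ℕ.* (D ℕ.+ D)
      expand = solve-∀
      split : ∀ x h → 18 ℕ.* x ℕ.+ 4 ℕ.* h ℕ.+ 1 ℕ.+ 3 ≡ 18 ℕ.* x ℕ.+ (4 ℕ.* h ℕ.+ 4)
      split = solve-∀
      split′ : ∀ x → 36 ℕ.* x ≡ 18 ℕ.* x ℕ.+ (8 ℕ.* x ℕ.+ 10 ℕ.* x)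
      split′ = solve-∀
      eight : ∀ h → 4 ℕ.* h ℕ.+ 4 ℕ.* h ≡ 8 ℕ.* h
      eight = solve-∀
      q-form : ∀ e → suc (suc (suc e) ℕ.+ suc (suc e)) ≡ suc e ℕ.+ suc e ℕ.+ 3
      q-form = solve-∀
      h≤h² : h ≤ h ℕ.* h
      h≤h² = ℕ.≤-trans (ℕ.≤-reflexive (≡.sym (ℕ.*-identityˡ h))) (ℕ.*-monoˡ-≤ h 1≤h)
      main : 18 ℕ.* (h ℕ.* h) ℕ.+ 4 ℕ.* h ℕ.+ 1 ≤ D ℕ.+ D
      main = ℕ.+-cancelʳ-≤ 3 _ _ (begin
        18 ℕ.* (h ℕ.* h) ℕ.+ 4 ℕ.* h ℕ.+ 1 ℕ.+ 3                 ≡⟨ split (h ℕ.* h) h ⟩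
        18 ℕ.* (h ℕ.* h) ℕ.+ (4 ℕ.* h ℕ.+ 4)                     ≤⟨ ℕ.+-monoʳ-≤ (18 ℕ.* (h ℕ.* h)) (ℕ.+-monoʳ-≤ (4 ℕ.* h) (ℕ.*-monoʳ-≤ 4 1≤h)) ⟩
        18 ℕ.* (h ℕ.* h) ℕ.+ (4 ℕ.* h ℕ.+ 4 ℕ.* h)               ≡⟨ ≡.cong (18 ℕ.* (h ℕ.* h) ℕ.+_) (eight h) ⟩
        18 ℕ.* (h ℕ.* h) ℕ.+ 8 ℕ.* h                             ≤⟨ ℕ.+-monoʳ-≤ (18 ℕ.* (h ℕ.* h)) (ℕ.*-monoʳ-≤ 8 h≤h²) ⟩
        18 ℕ.* (h ℕ.* h) ℕ.+ 8 ℕ.* (h ℕ.* h)                     ≤⟨ ℕ.+-monoʳ-≤ (18 ℕ.* (h ℕ.* h)) (ℕ.m≤m+n _ _) ⟩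
        18 ℕ.* (h ℕ.* h) ℕ.+ (8 ℕ.* (h ℕ.* h) ℕ.+ 10 ℕ.* (h ℕ.* h)) ≡⟨ split′ (h ℕ.* h) ⟨
        36 ℕ.* (h ℕ.* h)                                         ≤⟨ 36h²≤q ⟩
        q                                                        ≡⟨ q≡ ⟩
        suc (suc (suc e) ℕ.+ suc (suc e))                        ≡⟨ q-form e ⟩
        D ℕ.+ D ℕ.+ 3                                            ∎)

    -- Twice the degree divided by the order 2h has main term q. What remains is at most 7q / (2h),
    -- and q ≤ 144 h² turns it into 7 · 144 / 2 = 504 times h.
    count-bound : ∀ {k N} → k ≤ 4 → N ℕ.* (2 ℕ.* h) < suc h ℕ.* q ℕ.+ (d ℕ.* k ℕ.+ D) → 2 ℕ.* N ≤ q ℕ.+ 504 ℕ.* h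
    count-bound {k} {N} k≤4 N< = ℕ.*-cancelʳ-≤ (2 ℕ.* N) (q ℕ.+ 504 ℕ.* h) (2 ℕ.* h) {{2h≢0}} (begin
      2 ℕ.* N ℕ.* (2 ℕ.* h)                                    ≡⟨ ℕ.*-assoc 2 N (2 ℕ.* h) ⟩
      2 ℕ.* (N ℕ.* (2 ℕ.* h))                                  ≤⟨ ℕ.*-monoʳ-≤ 2 (ℕ.<⇒≤ N<) ⟩
      2 ℕ.* (suc h ℕ.* q ℕ.+ (d ℕ.* k ℕ.+ D))                  ≤⟨ ℕ.*-monoʳ-≤ 2 (ℕ.+-monoʳ-≤ (suc h ℕ.* q) (ℕ.+-mono-≤ (ℕ.*-monoʳ-≤ d k≤4) (ℕ.n≤1+n D))) ⟩
      2 ℕ.* (suc h ℕ.* q ℕ.+ (d ℕ.* 4 ℕ.+ d))                  ≡⟨ regroup h q d ⟩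
      q ℕ.* (2 ℕ.* h) ℕ.+ (2 ℕ.* q ℕ.+ 5 ℕ.* (d ℕ.+ d))        ≤⟨ ℕ.+-monoʳ-≤ (q ℕ.* (2 ℕ.* h)) (ℕ.+-monoʳ-≤ (2 ℕ.* q) (ℕ.*-monoʳ-≤ 5 2d≤q)) ⟩
      q ℕ.* (2 ℕ.* h) ℕ.+ (2 ℕ.* q ℕ.+ 5 ℕ.* q)                ≡⟨ ≡.cong (q ℕ.* (2 ℕ.* h) ℕ.+_) (≡.sym (ℕ.*-distribʳ-+ q 2 5)) ⟩
      q ℕ.* (2 ℕ.* h) ℕ.+ 7 ℕ.* q                              ≤⟨ ℕ.+-monoʳ-≤ (q ℕ.* (2 ℕ.* h)) (ℕ.*-monoʳ-≤ 7 q≤144h²) ⟩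
      q ℕ.* (2 ℕ.* h) ℕ.+ 7 ℕ.* (144 ℕ.* (h ℕ.* h))            ≡⟨ factor h q ⟩
      (q ℕ.+ 504 ℕ.* h) ℕ.* (2 ℕ.* h)                          ∎)
      where
      open ℕ.≤-Reasoning
      2h≢0 : ℕ.NonZero (2 ℕ.* h)
      2h≢0 = ℕ.>-nonZero (ℕ.≤-trans 1≤h (ℕ.m≤m+n h _))
      2d≤q : d ℕ.+ d ≤ q
      2d≤q = ℕ.≤-trans (ℕ.n≤1+n _) (ℕ.≤-reflexive (≡.sym q≡))
      regroup : ∀ h q d → 2 ℕ.* (suc h ℕ.* q ℕ.+ (d ℕ.* 4 ℕ.+ d)) ≡ q ℕ.* (2 ℕ.* h) ℕ.+ (2 ℕ.* q ℕ.+ 5 ℕ.* (d ℕ.+ d))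
      regroup = solve-∀
      factor : ∀ h q → q ℕ.* (2 ℕ.* h) ℕ.+ 7 ℕ.* (144 ℕ.* (h ℕ.* h)) ≡ (q ℕ.+ 504 ℕ.* h) ℕ.* (2 ℕ.* h)
      factor = solve-∀

    h≤h² : h ≤ h ℕ.* h
    h≤h² = ℕ.≤-trans (ℕ.≤-reflexive (≡.sym (ℕ.*-identityˡ h))) (ℕ.*-monoˡ-≤ h 1≤h)

    36h≤q : 36 ℕ.* h ≤ q
    36h≤q = ℕ.≤-trans (ℕ.*-monoʳ-≤ 36 h≤h²) 36h²≤q

    36≤q : 36 ≤ q
    36≤q = ℕ.≤-trans (ℕ.*-monoʳ-≤ 36 1≤h) 36h≤q

  length-allFin : length (allFin q) ≡ q
  length-allFin = length-tabulate {n = q} id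

  few-roots : ∀ as → length (filter (λ x → rootsK as x ≟ 0#) (allFin q)) ≤ length as
  few-roots as = ℕ.≤-trans (Unique-⊆⇒length≤ _≟_ (Unique.filter⁺ (λ x → rootsK as x ≟ 0#) (Unique.allFin⁺ q))
      (λ x∈ → root as (proj₂ (∈-filter⁻ (λ x → rootsK as x ≟ 0#) {xs = allFin q} x∈))))
    (ℕ.≤-reflexive (length-map -_ as))
    where
    root : ∀ as {x} → rootsK as x ≡ 0# → x ∈ map -_ as
    root [] 1≡0 = ⊥-elim (0≢1 (≡.sym 1≡0))
    root (a ∷ as) {x} p with integral p
    ... | inj₁ x+a≡0 = here (+-cancelˡ a (≡.trans (+-comm a x) (≡.trans x+a≡0 (≡.sym (-‿inverseʳ a)))))
    ... | inj₂ r = there (root as r)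

  -- The nonvanishing argument requires f(0) ≠ 0. Fewer than q translations are excluded, one for
  -- each factor, so an admissible `c` remains.
  translate-off-roots : ∀ as → length as < q → ∃ λ c → All (λ a → c + a ≢ 0#) as
  translate-off-roots as k<q with any? (λ c → all? (λ a → ¬? (c + a ≟ 0#)) as)
  ... | yes p = p
  ... | no ¬p = contradiction (Unique-⊆⇒length≤ _≟_ (Unique.allFin⁺ q) (λ {c} _ → hit c))
      (ℕ.<⇒≱ (ℕ.≤-trans (s≤s (ℕ.≤-reflexive (length-map -_ as))) (ℕ.≤-trans k<q (ℕ.≤-reflexive (≡.sym length-allFin)))))
    where
    hit : ∀ c → c ∈ map -_ as
    hit c with find (All.¬All⇒Any¬ (λ a → ¬? (c + a ≟ 0#)) as (λ all → ¬p (c , all)))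
    ... | a , a∈ , ¬¬c+a≡0 = ≡.subst (_∈ map -_ as) (≡.sym (+-cancelˡ a (≡.trans (+-comm a c)
      (≡.trans (decidable-stable (c + a ≟ 0#) ¬¬c+a≡0) (≡.sym (-‿inverseʳ a)))))) (∈-map⁺ -_ a∈)

  -- Replacing each shift a by c + a and each point b by b - c changes no value of the product and
  -- no count, and moves 0 off the roots.
  good-points : ∀ a as → All (a ≢_) as → length (a ∷ as) ≤ 4 → ∀ ε → ε ≢ 0# →
    2 ℕ.* length (filter (λ x → rootsK (a ∷ as) x ^ d ≟ ε) (allFin q)) ≤ q ℕ.+ 504 ℕ.* h
  good-points a as simple k≤4 ε ε≢0 with c , off ← translate-off-roots (a ∷ as) (ℕ.≤-trans (s≤s k≤4) (ℕ.≤-trans (ℕ.m≤m+n 5 31) 36≤q)) =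
    ≡.subst (λ n → 2 ℕ.* n ≤ q ℕ.+ 504 ℕ.* h) (length-map (_+ - c) bs)
      (count-bound {N = length (map (_+ - c) bs)} k′≤4 (Stepanov.few-good-points F d q≡ (c + a) (map (c +_) as) simple′ nonZero e small (2 ℕ.* h) 2h≤q ε ε≢0 (suc h)
        (V-bound k′≤4) (map (_+ - c) bs) unique good))
    where
    bs = filter (λ x → rootsK (a ∷ as) x ^ d ≟ ε) (allFin q)
    k′≤4 : length (map (c +_) (a ∷ as)) ≤ 4
    k′≤4 = ℕ.≤-trans (ℕ.≤-reflexive (length-map (c +_) (a ∷ as))) k≤4
    simple′ : All (c + a ≢_) (map (c +_) as)
    simple′ = All.map⁺ (All.map (λ a≢ p → a≢ (+-cancelˡ c p)) simple)
    nonZero : All (_≢ 0#) (map (c +_) (a ∷ as))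
    nonZero = All.map⁺ off
    small : length (map (c +_) (a ∷ as)) ℕ.+ (e ℕ.+ suc e) ≤ q
    small = ℕ.≤-trans (ℕ.+-monoˡ-≤ (e ℕ.+ suc e) k′≤4) (ℕ.≤-reflexive (≡.trans (form e) (≡.sym q≡)))
      where
      form : ∀ e → 4 ℕ.+ (e ℕ.+ suc e) ≡ suc (suc (suc e) ℕ.+ suc (suc e))
      form = solve-∀
    2h≤q : 2 ℕ.* h ≤ q
    2h≤q = ℕ.≤-trans (ℕ.*-monoˡ-≤ h (ℕ.m≤m+n 2 34)) 36h≤q
    unique : Unique (map (_+ - c) bs)
    unique = Unique.map⁺ (λ {x} {y} p → +-cancelˡ (- c) (≡.trans (+-comm (- c) x) (≡.trans p (+-comm y (- c)))))
      (Unique.filter⁺ (λ x → rootsK (a ∷ as) x ^ d ≟ ε) (Unique.allFin⁺ q))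
    rootsK-translate : ∀ as b → rootsK (map (c +_) as) (b + - c) ≡ rootsK as b
    rootsK-translate [] b = ≡.refl
    rootsK-translate (a ∷ as) b = ≡.cong₂ _*_ (≡.trans (+-assoc b (- c) (c + a)) (≡.cong (b +_)
      (≡.trans (≡.sym (+-assoc (- c) c a)) (≡.trans (≡.cong (_+ a) (-‿inverseˡ c)) (+-identityˡ a))))) (rootsK-translate as b)
    good : All (λ b → rootsK (map (c +_) (a ∷ as)) b ^ d ≡ ε) (map (_+ - c) bs)
    good = All.map⁺ (All.map (λ {b} p → ≡.trans (≡.cong (_^ d) (rootsK-translate (a ∷ as) b)) p)
      (All.all-filter (λ x → rootsK (a ∷ as) x ^ d ≟ ε) (allFin q)))

  χ-product≡χ : ∀ as x → χ-product as x ≡ χ (rootsK as x)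
  χ-product≡χ [] x = ≡.sym χ-1
  χ-product≡χ (a ∷ as) x = ≡.trans (≡.cong (χ (x + a) ℤ.*_) (χ-product≡χ as x)) (≡.sym (χ-* (x + a) (rootsK as x)))

  -- `sign` is 1 or -1, `ε` its image in the field; counting the points where the product equals ε
  -- bounds the sum of sign · χ from above.
  signed-bound : ∀ {sign ε} → ε ≢ 0# → (∀ z → sign ℤ.* χ z ℤ.+ 1ℤ ℤ.≤ ℤ.+ 2 ℤ.* indicator (z ^ d ≟ ε) ℤ.+ indicator (z ≟ 0#)) →
    ∀ as → length as ≤ 4 → HasSimpleEntry as → sign ℤ.* χ-sum as ℤ.≤ ℤ.+ (508 ℕ.* h)
  signed-bound {sign} {ε} ε≢0 pointwise as k≤4 (a , bs , as↭ , simple) = +-cancelʳ-≤ (ℤ.+ q) (begin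
    sign ℤ.* χ-sum as ℤ.+ ℤ.+ q
      ≡⟨ ≡.cong₂ ℤ._+_ (≡.trans (≡.cong (sign ℤ.*_) (∑-cong U (λ x → ≡.trans (χ-product-↭ as↭ x) (χ-product≡χ (a ∷ bs) x)))) (≡.sym (∑-*ˡ U sign (λ x → χ (g x)))))
           (≡.trans (≡.cong ℤ.+_ (≡.sym length-allFin)) (length≡∑1 U)) ⟩
    ∑ U (λ x → sign ℤ.* χ (g x)) ℤ.+ ∑ U (λ _ → 1ℤ)
      ≡⟨ ∑-+ U (λ x → sign ℤ.* χ (g x)) (λ _ → 1ℤ) ⟨
    ∑ U (λ x → sign ℤ.* χ (g x) ℤ.+ 1ℤ)
      ≤⟨ ∑-mono U (λ x → pointwise (g x)) ⟩
    ∑ U (λ x → ℤ.+ 2 ℤ.* indicator (g x ^ d ≟ ε) ℤ.+ indicator (g x ≟ 0#))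
      ≡⟨ ∑-+ U (λ x → ℤ.+ 2 ℤ.* indicator (g x ^ d ≟ ε)) (λ x → indicator (g x ≟ 0#)) ⟩
    ∑ U (λ x → ℤ.+ 2 ℤ.* indicator (g x ^ d ≟ ε)) ℤ.+ ∑ U (λ x → indicator (g x ≟ 0#))
      ≡⟨ ≡.cong₂ ℤ._+_ (≡.trans (∑-*ˡ U (ℤ.+ 2) (λ x → indicator (g x ^ d ≟ ε))) (≡.cong (ℤ.+ 2 ℤ.*_) (∑-indicator (λ x → g x ^ d ≟ ε) U)))
           (∑-indicator (λ x → g x ≟ 0#) U) ⟩
    ℤ.+ 2 ℤ.* ℤ.+ N ℤ.+ ℤ.+ Z
      ≡⟨ ≡.cong (ℤ._+ ℤ.+ Z) (≡.sym (ℤ.pos-* 2 N)) ⟩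
    ℤ.+ (2 ℕ.* N ℕ.+ Z)
      ≤⟨ +≤+ total ⟩
    ℤ.+ (508 ℕ.* h ℕ.+ q)
      ≡⟨⟩
    ℤ.+ (508 ℕ.* h) ℤ.+ ℤ.+ q ∎)
    where
    open ℤ.≤-Reasoning
    U = allFin q
    g = rootsK (a ∷ bs)
    N = length (filter (λ x → g x ^ d ≟ ε) U)
    Z = length (filter (λ x → g x ≟ 0#) U)
    k′≤4 : length (a ∷ bs) ≤ 4
    k′≤4 = ℕ.≤-trans (ℕ.≤-reflexive (≡.sym (↭-length as↭))) k≤4
    form : ∀ q h → (q ℕ.+ 504 ℕ.* h) ℕ.+ 4 ℕ.* h ≡ 508 ℕ.* h ℕ.+ q
    form = solve-∀
    -- The zeros of the product number at most four, hence at most 4h; they raise the constant from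
    -- 504 to 508.
    total : 2 ℕ.* N ℕ.+ Z ≤ 508 ℕ.* h ℕ.+ q
    total = ℕ.≤-trans (ℕ.+-mono-≤ (good-points a bs simple k′≤4 ε ε≢0)
      (ℕ.≤-trans (few-roots (a ∷ bs)) (ℕ.≤-trans k′≤4 (ℕ.*-monoʳ-≤ 4 1≤h)))) (ℕ.≤-reflexive (form q h))

  private
    2a+b-nonneg : ∀ {a b} → 0ℤ ℤ.≤ a → 0ℤ ℤ.≤ b → 0ℤ ℤ.≤ ℤ.+ 2 ℤ.* a ℤ.+ b
    2a+b-nonneg p r = ℤ.+-mono-≤ (ℤ.*-monoˡ-≤-nonNeg (ℤ.+ 2) p) r

  χ-sum-upper : ∀ as → length as ≤ 4 → HasSimpleEntry as → χ-sum as ℤ.≤ ℤ.+ (508 ℕ.* h)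
  χ-sum-upper as k≤4 simple = ≡.subst (ℤ._≤ ℤ.+ (508 ℕ.* h)) (ℤ.*-identityˡ (χ-sum as))
    (signed-bound {1ℤ} {1#} (λ p → 0≢1 (≡.sym p)) pointwise as k≤4 simple)
    where
    pointwise : ∀ z → 1ℤ ℤ.* χ z ℤ.+ 1ℤ ℤ.≤ ℤ.+ 2 ℤ.* indicator (z ^ d ≟ 1#) ℤ.+ indicator (z ≟ 0#)
    pointwise z with χ z | value z
    ... | _ | is-nonsquare _ _ = 2a+b-nonneg (indicator-nonneg (z ^ d ≟ 1#)) (indicator-nonneg (z ≟ 0#))
    ... | _ | is-zero z≡0 = ℤ.+-mono-≤ (ℤ.*-monoˡ-≤-nonNeg (ℤ.+ 2) (indicator-nonneg (z ^ d ≟ 1#))) (ℤ.≤-reflexive (≡.sym (indicator-yes (z ≟ 0#) z≡0)))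
    ... | _ | is-square _ p = ℤ.+-mono-≤ {ℤ.+ 2} (ℤ.≤-reflexive (≡.sym (≡.cong (ℤ.+ 2 ℤ.*_) (indicator-yes (z ^ d ≟ 1#) p)))) (indicator-nonneg (z ≟ 0#))

  χ-sum-lower : ∀ as → length as ≤ 4 → HasSimpleEntry as → ℤ.- χ-sum as ℤ.≤ ℤ.+ (508 ℕ.* h)
  χ-sum-lower as k≤4 simple = ≡.subst (ℤ._≤ ℤ.+ (508 ℕ.* h)) (ℤ.-1*i≡-i (χ-sum as))
    (signed-bound { -1ℤ} { - 1#} -1≢0 pointwise as k≤4 simple)
    where
    -1≢0 : - 1# ≢ 0#
    -1≢0 p = 0≢1 (≡.trans (≡.sym (-‿inverseʳ 1#)) (≡.trans (≡.cong (1# +_) p) (+-identityʳ 1#)))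
    pointwise : ∀ z → -1ℤ ℤ.* χ z ℤ.+ 1ℤ ℤ.≤ ℤ.+ 2 ℤ.* indicator (z ^ d ≟ - 1#) ℤ.+ indicator (z ≟ 0#)
    pointwise z with χ z | value z
    ... | _ | is-square _ _ = 2a+b-nonneg (indicator-nonneg (z ^ d ≟ - 1#)) (indicator-nonneg (z ≟ 0#))
    ... | _ | is-zero z≡0 = ℤ.+-mono-≤ (ℤ.*-monoˡ-≤-nonNeg (ℤ.+ 2) (indicator-nonneg (z ^ d ≟ - 1#))) (ℤ.≤-reflexive (≡.sym (indicator-yes (z ≟ 0#) z≡0)))
    ... | _ | is-nonsquare _ p = ℤ.+-mono-≤ {ℤ.+ 2} (ℤ.≤-reflexive (≡.sym (≡.cong (ℤ.+ 2 ℤ.*_) (indicator-yes (z ^ d ≟ - 1#) p)))) (indicator-nonneg (z ≟ 0#))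

  small-sums : SmallSums (508 ℕ.* h)
  small-sums = record { χ-values = χ-values ; χ-square = χ-square ; χ-sum-upper = χ-sum-upper ; χ-sum-lower = χ-sum-lower }

-- Moments of the sums of χ(x + y) over y in a set.

module Sumset {q} (F : FiniteFieldOn q) (χ : Fin q → ℤ) (C : ℕ) (small : ShiftedProducts.SmallSums F χ C) where

  open import Data.Nat using (z≤n; s≤s)
  open import Data.Fin.Properties using (_≟_)
  open import Data.List using (List; []; _∷_; length; allFin)
  open import Data.List.Properties using (length-tabulate)
  open import Data.List.Relation.Unary.All using ([]; _∷_)
  open import Data.List.Relation.Unary.AllPairs using ([]; _∷_)
  open import Data.List.Relation.Unary.Unique.Propositional using (Unique)
  import Data.List.Relation.Unary.Unique.Propositional.Properties as Unique
  open import Data.List.Relation.Binary.Permutation.Propositional as Perm using (prep; swap)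
  open import Data.Integer as ℤ using (+_; 0ℤ; 1ℤ; -1ℤ; +≤+; _≤_) renaming (_+_ to _+ᶻ_; _*_ to _*ᶻ_)
  open import Data.Integer.Properties hiding (_≟_)
  open import Data.Integer.Tactic.RingSolver using (solve-∀)
  open import Data.Product using (_,_)
  open import Data.Sum using (_⊎_; inj₁; inj₂)
  open import Data.Empty using (⊥-elim)
  open import Function using (id)
  open import Relation.Nullary using (Dec; yes; no)

  open Sums
  open Field F using (_+_; _*_; -_; 0#; 1#)
  private module K = Field F
  open ShiftedProducts F χ
  open SmallSums small

  private
    U = allFin q

    ∣U∣≡q : length U ≡ q
    ∣U∣≡q = length-tabulate {n = q} id

    pos : ∀ n → 0ℤ ≤ + n
    pos n = +≤+ z≤n

  -1≤χ : ∀ z → -1ℤ ≤ χ z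
  -1≤χ z with χ z | χ-values z
  ... | _ | inj₁ ≡.refl = ℤ.-≤+
  ... | _ | inj₂ (inj₁ ≡.refl) = ℤ.-≤+
  ... | _ | inj₂ (inj₂ ≡.refl) = ≤-refl

  χ-product-values : ∀ as x → χ-product as x ≡ 0ℤ ⊎ χ-product as x ≡ 1ℤ ⊎ χ-product as x ≡ -1ℤ
  χ-product-values [] x = inj₂ (inj₁ ≡.refl)
  χ-product-values (a ∷ as) x with χ (x + a) | χ-values (x + a) | χ-product as x | χ-product-values as x
  ... | _ | inj₁ ≡.refl | p | _ = inj₁ (*-zeroˡ p)
  ... | _ | inj₂ (inj₁ ≡.refl) | _ | inj₁ ≡.refl = inj₁ ≡.refl
  ... | _ | inj₂ (inj₁ ≡.refl) | _ | inj₂ (inj₁ ≡.refl) = inj₂ (inj₁ ≡.refl)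
  ... | _ | inj₂ (inj₁ ≡.refl) | _ | inj₂ (inj₂ ≡.refl) = inj₂ (inj₂ ≡.refl)
  ... | _ | inj₂ (inj₂ ≡.refl) | _ | inj₁ ≡.refl = inj₁ ≡.refl
  ... | _ | inj₂ (inj₂ ≡.refl) | _ | inj₂ (inj₁ ≡.refl) = inj₂ (inj₂ ≡.refl)
  ... | _ | inj₂ (inj₂ ≡.refl) | _ | inj₂ (inj₂ ≡.refl) = inj₂ (inj₁ ≡.refl)

  χ-sum≤q : ∀ as → χ-sum as ≤ + q
  χ-sum≤q as = ≤-trans (∑-≤-length U 1ℤ (λ {x} _ → le (χ-product-values as x))) (≤-reflexive (≡.trans (*-identityʳ _) (≡.cong +_ ∣U∣≡q)))
    where
    le : ∀ {v} → v ≡ 0ℤ ⊎ v ≡ 1ℤ ⊎ v ≡ -1ℤ → v ≤ 1ℤ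
    le (inj₁ ≡.refl) = +≤+ z≤n
    le (inj₂ (inj₁ ≡.refl)) = ≤-refl
    le (inj₂ (inj₂ ≡.refl)) = ℤ.-≤+

  pair-sum : ∀ y z → χ-sum (y ∷ z ∷ []) ≤ + q *ᶻ indicator (y ≟ z) +ᶻ + C
  pair-sum y z with y ≟ z
  ... | yes _ = ≤-trans (χ-sum≤q (y ∷ z ∷ [])) (≤-trans (≤-reflexive (≡.sym (*-identityʳ (+ q)))) (≤-trans (≤-reflexive (≡.sym (+-identityʳ _))) (+-monoʳ-≤ (+ q *ᶻ 1ℤ) (pos C))))
  ... | no y≢z = ≤-trans (χ-sum-upper (y ∷ z ∷ []) (s≤s (s≤s z≤n)) (y , z ∷ [] , Perm.refl , y≢z ∷ []))
    (≤-reflexive (≡.sym (≡.trans (≡.cong (_+ᶻ + C) (*-zeroʳ (+ q))) (+-identityˡ _))))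

  single-sum : ∀ a → χ-sum (a ∷ []) ≤ + C
  single-sum a = χ-sum-upper (a ∷ []) (s≤s z≤n) (a , [] , Perm.refl , [])

  -- Three shifts cannot cancel in pairs: either one of them is simple, or all coincide and χ³ = χ
  -- reduces to a single shift.
  triple-sum : ∀ a y z → χ-sum (a ∷ y ∷ z ∷ []) ≤ + C
  triple-sum a y z with y ≟ z | a ≟ y
  ... | yes ≡.refl | yes ≡.refl = ≤-trans (≤-reflexive (∑-cong U cube)) (single-sum a)
    where
    cube : ∀ x → χ-product (a ∷ a ∷ a ∷ []) x ≡ χ-product (a ∷ []) x
    cube x with χ (x + a) | χ-values (x + a)
    ... | _ | inj₁ ≡.refl = ≡.refl
    ... | _ | inj₂ (inj₁ ≡.refl) = ≡.refl
    ... | _ | inj₂ (inj₂ ≡.refl) = ≡.refl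
  ... | yes ≡.refl | no a≢y = χ-sum-upper _ (s≤s (s≤s (s≤s z≤n))) (a , _ , Perm.refl , a≢y ∷ a≢y ∷ [])
  ... | no y≢z | no a≢y = χ-sum-upper _ (s≤s (s≤s (s≤s z≤n))) (y , _ , swap a y Perm.refl , (λ p → a≢y (≡.sym p)) ∷ y≢z ∷ [])
  ... | no y≢z | yes ≡.refl = χ-sum-upper _ (s≤s (s≤s (s≤s z≤n)))
    (z , _ , Perm.trans (prep a (swap a z Perm.refl)) (swap a z Perm.refl) , (λ p → y≢z (≡.sym p)) ∷ (λ p → y≢z (≡.sym p)) ∷ [])

  coincidences : Fin q → Fin q → Fin q → Fin q → ℤ
  coincidences a b y z = indicator (a ≟ y) *ᶻ indicator (b ≟ z) +ᶻ indicator (b ≟ y) *ᶻ indicator (a ≟ z)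

  -- As a ≠ b, all multiplicities are even only when {y, z} = {a, b}, which is what `coincidences`
  -- counts. There the trivial bound q is used; otherwise a or b is simple.
  quadruple-sum : ∀ {a b} y z → a ≢ b → χ-sum (a ∷ b ∷ y ∷ z ∷ []) ≤ + q *ᶻ coincidences a b y z +ᶻ + C
  quadruple-sum {a} {b} y z a≢b = go (a ≟ y) (b ≟ z) (b ≟ y) (a ≟ z)
    where
    four = s≤s (s≤s (s≤s (s≤s z≤n)))
    ⁻ : ∀ {x y : Fin q} → x ≢ y → y ≢ x
    ⁻ p r = p (≡.sym r)
    simple-bound : ∀ {k} → 0ℤ ≤ k → HasSimpleEntry (a ∷ b ∷ y ∷ z ∷ []) → χ-sum (a ∷ b ∷ y ∷ z ∷ []) ≤ + q *ᶻ k +ᶻ + C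
    simple-bound {k} 0≤k simple = ≤-trans (χ-sum-upper _ four simple) (≤-trans (≤-reflexive (≡.sym (+-identityˡ (+ C))))
      (+-monoˡ-≤ (+ C) (≤-trans (≤-reflexive (≡.sym (*-zeroʳ (+ q)))) (*-monoˡ-≤-nonNeg (+ q) 0≤k))))
    trivial-bound : ∀ {k} → 1ℤ ≤ k → χ-sum (a ∷ b ∷ y ∷ z ∷ []) ≤ + q *ᶻ k +ᶻ + C
    trivial-bound {k} 1≤k = ≤-trans (χ-sum≤q (a ∷ b ∷ y ∷ z ∷ [])) (≤-trans (≤-reflexive (≡.sym (*-identityʳ (+ q))))
      (≤-trans (*-monoˡ-≤-nonNeg (+ q) 1≤k) (≤-trans (≤-reflexive (≡.sym (+-identityʳ _))) (+-monoʳ-≤ (+ q *ᶻ k) (pos C)))))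
    first-simple : a ≢ y → a ≢ z → HasSimpleEntry (a ∷ b ∷ y ∷ z ∷ [])
    first-simple a≢y a≢z = a , _ , Perm.refl , a≢b ∷ a≢y ∷ a≢z ∷ []
    second-simple : b ≢ y → b ≢ z → HasSimpleEntry (a ∷ b ∷ y ∷ z ∷ [])
    second-simple b≢y b≢z = b , _ , swap a b Perm.refl , ⁻ a≢b ∷ b≢y ∷ b≢z ∷ []
    go : (p : Dec (a ≡ y)) (r : Dec (b ≡ z)) (s : Dec (b ≡ y)) (t : Dec (a ≡ z)) →
      χ-sum (a ∷ b ∷ y ∷ z ∷ []) ≤ + q *ᶻ (indicator p *ᶻ indicator r +ᶻ indicator s *ᶻ indicator t) +ᶻ + C
    go (yes _) (yes _) s t = trivial-bound (≤-trans (≤-reflexive (≡.sym (+-identityʳ 1ℤ))) (+-monoʳ-≤ 1ℤ (nonneg s t)))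
      where
      nonneg : ∀ {P R : Set} (s : Dec P) (t : Dec R) → 0ℤ ≤ indicator s *ᶻ indicator t
      nonneg (yes _) (yes _) = +≤+ z≤n
      nonneg (yes _) (no _) = +≤+ z≤n
      nonneg (no _) (yes _) = +≤+ z≤n
      nonneg (no _) (no _) = +≤+ z≤n
    go (yes ≡.refl) (no b≢z) (yes b≡y) t = ⊥-elim (a≢b (≡.sym b≡y))
    go (yes ≡.refl) (no b≢z) (no b≢y) (yes _) = simple-bound (+≤+ z≤n) (second-simple b≢y b≢z)
    go (yes ≡.refl) (no b≢z) (no b≢y) (no _) = simple-bound (+≤+ z≤n) (second-simple b≢y b≢z)
    go (no a≢y) (yes _) (yes _) (yes _) = trivial-bound ≤-refl
    go (no a≢y) (no _) (yes _) (yes _) = trivial-bound ≤-refl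
    go (no a≢y) (yes _) (yes _) (no a≢z) = simple-bound (+≤+ z≤n) (first-simple a≢y a≢z)
    go (no a≢y) (no _) (yes _) (no a≢z) = simple-bound (+≤+ z≤n) (first-simple a≢y a≢z)
    go (no a≢y) r (no b≢y) (no a≢z) = simple-bound (nonneg r) (first-simple a≢y a≢z)
      where
      nonneg : ∀ {P : Set} (r : Dec P) → 0ℤ ≤ 0ℤ *ᶻ indicator r +ᶻ 0ℤ
      nonneg (yes _) = +≤+ z≤n
      nonneg (no _) = +≤+ z≤n
    go (no a≢y) (yes ≡.refl) (no b≢y) (yes a≡z) = ⊥-elim (a≢b a≡z)
    go (no a≢y) (no b≢z) (no b≢y) (yes ≡.refl) = simple-bound (+≤+ z≤n) (second-simple b≢y b≢z)

  translates : List (Fin q) → Fin q → ℤ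
  translates Y x = ∑ Y (λ y → χ (x + y))

  weighted-square : ∀ Y (w : Fin q → ℤ) → ∑ U (λ x → w x *ᶻ (translates Y x *ᶻ translates Y x)) ≡
    ∑ Y (λ y → ∑ Y (λ z → ∑ U (λ x → w x *ᶻ (χ (x + y) *ᶻ χ (x + z)))))
  weighted-square Y w = begin
    ∑ U (λ x → w x *ᶻ (translates Y x *ᶻ translates Y x))
      ≡⟨ ∑-cong U (λ x → ≡.trans (≡.cong (w x *ᶻ_) (∑-square Y (λ y → χ (x + y))))
           (≡.trans (≡.sym (∑-*ˡ Y (w x) (λ y → ∑ Y (λ z → χ (x + y) *ᶻ χ (x + z)))))
           (∑-cong Y (λ y → ≡.sym (∑-*ˡ Y (w x) (λ z → χ (x + y) *ᶻ χ (x + z))))))) ⟩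
    ∑ U (λ x → ∑ Y (λ y → ∑ Y (λ z → w x *ᶻ (χ (x + y) *ᶻ χ (x + z)))))
      ≡⟨ ∑-comm U Y (λ x y → ∑ Y (λ z → w x *ᶻ (χ (x + y) *ᶻ χ (x + z)))) ⟩
    ∑ Y (λ y → ∑ U (λ x → ∑ Y (λ z → w x *ᶻ (χ (x + y) *ᶻ χ (x + z)))))
      ≡⟨ ∑-cong Y (λ y → ∑-comm U Y (λ x z → w x *ᶻ (χ (x + y) *ᶻ χ (x + z)))) ⟩
    ∑ Y (λ y → ∑ Y (λ z → ∑ U (λ x → w x *ᶻ (χ (x + y) *ᶻ χ (x + z))))) ∎
    where open ≡.≡-Reasoning

  diagonal-sum : ∀ {Y : List (Fin q)} → Unique Y → ∀ c e → 0ℤ ≤ c → ∑ Y (λ y → ∑ Y (λ z → c *ᶻ indicator (y ≟ z) +ᶻ e)) ≤ + length Y *ᶻ (c +ᶻ + length Y *ᶻ e)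
  diagonal-sum {Y} u c e 0≤c = ∑-≤-length Y _ λ {y} _ → begin
    ∑ Y (λ z → c *ᶻ indicator (y ≟ z) +ᶻ e)                      ≡⟨ ∑-+ Y (λ z → c *ᶻ indicator (y ≟ z)) (λ _ → e) ⟩
    ∑ Y (λ z → c *ᶻ indicator (y ≟ z)) +ᶻ ∑ Y (λ _ → e)          ≡⟨ ≡.cong₂ _+ᶻ_ (∑-*ˡ Y c (λ z → indicator (y ≟ z))) (∑-const Y e) ⟩
    c *ᶻ ∑ Y (λ z → indicator (y ≟ z)) +ᶻ + length Y *ᶻ e        ≤⟨ +-monoˡ-≤ (+ length Y *ᶻ e) (*-monoˡ-≤-nonNeg c {{ℤ.nonNegative 0≤c}} (∑-indicator-≤1 _≟_ y u)) ⟩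
    c *ᶻ 1ℤ +ᶻ + length Y *ᶻ e                                   ≡⟨ ≡.cong (_+ᶻ + length Y *ᶻ e) (*-identityʳ c) ⟩
    c +ᶻ + length Y *ᶻ e                                         ∎
    where open ≤-Reasoning

  -- In the expanded square only the diagonal y = z has correlations of size q.
  second-moment : ∀ {Y} → Unique Y →
    ∑ U (λ x → translates Y x *ᶻ translates Y x) ≤ + length Y *ᶻ (+ q +ᶻ + length Y *ᶻ + C)
  second-moment {Y} u = begin
    ∑ U (λ x → translates Y x *ᶻ translates Y x)                     ≡⟨ ∑-cong U (λ x → ≡.sym (*-identityˡ (translates Y x *ᶻ translates Y x))) ⟩
    ∑ U (λ x → 1ℤ *ᶻ (translates Y x *ᶻ translates Y x))             ≡⟨ weighted-square Y (λ _ → 1ℤ) ⟩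
    ∑ Y (λ y → ∑ Y (λ z → ∑ U (λ x → 1ℤ *ᶻ (χ (x + y) *ᶻ χ (x + z))))) ≡⟨ ∑-cong Y (λ y → ∑-cong Y (λ z → ∑-cong U (λ x → rearrange (χ (x + y)) (χ (x + z))))) ⟩
    ∑ Y (λ y → ∑ Y (λ z → χ-sum (y ∷ z ∷ [])))                       ≤⟨ ∑-mono Y (λ y → ∑-mono Y (λ z → pair-sum y z)) ⟩
    ∑ Y (λ y → ∑ Y (λ z → + q *ᶻ indicator (y ≟ z) +ᶻ + C))          ≤⟨ diagonal-sum u (+ q) (+ C) (pos q) ⟩
    + length Y *ᶻ (+ q +ᶻ + length Y *ᶻ + C)                         ∎
    where
    open ≤-Reasoning
    rearrange : ∀ s t → 1ℤ *ᶻ (s *ᶻ t) ≡ s *ᶻ (t *ᶻ 1ℤ)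
    rearrange = solve-∀

-- Both summands of a decomposition are large.

module SumsetSize {q} (F : FiniteFieldOn q) (χ : Fin q → ℤ) (C : ℕ) (small : ShiftedProducts.SmallSums F χ C)
  (1≢-1 : Field.1# F ≢ Field.-_ F (Field.1# F)) where

  open import Data.Nat using (suc; z≤n; s≤s)
  import Data.Nat.Properties as ℕ
  import Data.Nat.Tactic.RingSolver as ℕ
  open import Data.Fin.Properties using (_≟_)
  open import Data.List using (List; []; _∷_; length; filter; map; allFin; cartesianProductWith)
  open import Data.List.Properties using (length-tabulate; length-map; length-++)
  open import Data.List.Relation.Unary.All using ([]; _∷_)
  open import Data.List.Relation.Unary.AllPairs using ([]; _∷_)
  open import Data.List.Relation.Unary.Any using (here; there)
  open import Data.List.Relation.Unary.Unique.Propositional using (Unique)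
  import Data.List.Relation.Unary.Unique.Propositional.Properties as Unique
  open import Data.List.Membership.Propositional using (_∈_)
  open import Data.List.Membership.Propositional.Properties using (∈-allFin; ∈-filter⁻; ∈-filter⁺; ∈-cartesianProductWith⁺)
  import Data.List.Relation.Binary.Permutation.Propositional as Perm
  open import Data.Integer as ℤ using (+_; 0ℤ; 1ℤ; -1ℤ; +≤+; _≤_) renaming (_+_ to _+ᶻ_; _*_ to _*ᶻ_; -_ to -ᶻ_)
  open import Data.Integer.Properties hiding (_≟_)
  open import Data.Integer.Tactic.RingSolver using (solve-∀)
  open import Data.Product using (∃; _×_; _,_; proj₂)
  open import Data.Sum using (_⊎_; inj₁; inj₂)
  open import Function using (id)
  open import Relation.Nullary using (Dec; yes; no)
  open import Relation.Nullary.Decidable using (_×-dec_; _⊎-dec_)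

  open Sums
  open Field F using (_+_; _*_; -_; 0#; 1#)
  private module K = Field F
  open ShiftedProducts F χ
  open SmallSums small
  open Sumset F χ C small

  private
    U = allFin q

  1+χ≥0 : ∀ z → 0ℤ ≤ 1ℤ +ᶻ χ z
  1+χ≥0 z = +-monoʳ-≤ 1ℤ (-1≤χ z)

  *-nonneg : ∀ {i j} → 0ℤ ≤ i → 0ℤ ≤ j → 0ℤ ≤ i *ᶻ j
  *-nonneg {i} {j} 0≤i 0≤j = ≤-trans (≤-reflexive (≡.sym (*-zeroʳ i))) (*-monoˡ-≤-nonNeg i {{ℤ.nonNegative 0≤i}} 0≤j)

  coincidences-total : ∀ a b {Y} → Unique Y → ∑ Y (λ y → ∑ Y (λ z → coincidences a b y z)) ≤ + 2
  coincidences-total a b {Y} u = begin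
    ∑ Y (λ y → ∑ Y (λ z → coincidences a b y z))
      ≡⟨ ∑-cong Y (λ y → ∑-+ Y (λ z → indicator (a ≟ y) *ᶻ indicator (b ≟ z)) (λ z → indicator (b ≟ y) *ᶻ indicator (a ≟ z))) ⟩
    ∑ Y (λ y → ∑ Y (λ z → indicator (a ≟ y) *ᶻ indicator (b ≟ z)) +ᶻ ∑ Y (λ z → indicator (b ≟ y) *ᶻ indicator (a ≟ z)))
      ≡⟨ ∑-+ Y (λ y → ∑ Y (λ z → indicator (a ≟ y) *ᶻ indicator (b ≟ z))) (λ y → ∑ Y (λ z → indicator (b ≟ y) *ᶻ indicator (a ≟ z))) ⟩
    ∑ Y (λ y → ∑ Y (λ z → indicator (a ≟ y) *ᶻ indicator (b ≟ z))) +ᶻ ∑ Y (λ y → ∑ Y (λ z → indicator (b ≟ y) *ᶻ indicator (a ≟ z)))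
      ≤⟨ +-mono-≤ (one a b) (one b a) ⟩
    + 2 ∎
    where
    open ≤-Reasoning
    one : ∀ a b → ∑ Y (λ y → ∑ Y (λ z → indicator (a ≟ y) *ᶻ indicator (b ≟ z))) ≤ 1ℤ
    one a b = begin
      ∑ Y (λ y → ∑ Y (λ z → indicator (a ≟ y) *ᶻ indicator (b ≟ z)))    ≡⟨ ∑-cong Y (λ y → ∑-*ˡ Y (indicator (a ≟ y)) (λ z → indicator (b ≟ z))) ⟩
      ∑ Y (λ y → indicator (a ≟ y) *ᶻ ∑ Y (λ z → indicator (b ≟ z)))    ≡⟨ ∑-*ʳ Y (∑ Y (λ z → indicator (b ≟ z))) (λ y → indicator (a ≟ y)) ⟩
      ∑ Y (λ y → indicator (a ≟ y)) *ᶻ ∑ Y (λ z → indicator (b ≟ z))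
        ≤⟨ *-monoˡ-≤-nonNeg (∑ Y (λ y → indicator (a ≟ y))) {{ℤ.nonNegative (∑-nonneg Y (λ y → indicator-nonneg (a ≟ y)))}} (∑-indicator-≤1 _≟_ b u) ⟩
      ∑ Y (λ y → indicator (a ≟ y)) *ᶻ 1ℤ                               ≡⟨ *-identityʳ _ ⟩
      ∑ Y (λ y → indicator (a ≟ y))                                     ≤⟨ ∑-indicator-≤1 _≟_ a u ⟩
      1ℤ                                                                ∎

  AllSquares : List (Fin q) → List (Fin q) → Set
  AllSquares Y Z = ∀ {y z} → y ∈ Y → z ∈ Z → χ (z + y) ≡ 1ℤ

  module _ {a b : Fin q} (a≢b : a ≢ b) where

    private
      w : Fin q → ℤ
      w x = (1ℤ +ᶻ χ (x + a)) *ᶻ (1ℤ +ᶻ χ (x + b))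

      -- Expanding the two weights leaves one pair, two triples and one quadruple of shifts. Terms
      -- of size q arise only from y = z and from {y, z} = {a, b}.
      summand-bound : ∀ y z → ∑ U (λ x → w x *ᶻ (χ (x + y) *ᶻ χ (x + z))) ≤ (+ q *ᶻ indicator (y ≟ z) +ᶻ + 4 *ᶻ + C) +ᶻ + q *ᶻ coincidences a b y z
      summand-bound y z = begin
        ∑ U (λ x → w x *ᶻ (χ (x + y) *ᶻ χ (x + z)))
          ≡⟨ ∑-cong U (λ x → expand (χ (x + a)) (χ (x + b)) (χ (x + y)) (χ (x + z))) ⟩
        ∑ U (λ x → (p₂ x +ᶻ pₐ x) +ᶻ (p_b x +ᶻ p₄ x))
          ≡⟨ ≡.trans (∑-+ U (λ x → p₂ x +ᶻ pₐ x) (λ x → p_b x +ᶻ p₄ x)) (≡.cong₂ _+ᶻ_ (∑-+ U p₂ pₐ) (∑-+ U p_b p₄)) ⟩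
        (∑ U p₂ +ᶻ ∑ U pₐ) +ᶻ (∑ U p_b +ᶻ ∑ U p₄)
          ≤⟨ +-mono-≤ (+-mono-≤ (pair-sum y z) (triple-sum a y z)) (+-mono-≤ (triple-sum b y z) (quadruple-sum y z a≢b)) ⟩
        ((+ q *ᶻ indicator (y ≟ z) +ᶻ + C) +ᶻ + C) +ᶻ (+ C +ᶻ (+ q *ᶻ coincidences a b y z +ᶻ + C))
          ≡⟨ collect (+ q *ᶻ indicator (y ≟ z)) (+ C) (+ q *ᶻ coincidences a b y z) ⟩
        (+ q *ᶻ indicator (y ≟ z) +ᶻ + 4 *ᶻ + C) +ᶻ + q *ᶻ coincidences a b y z ∎
        where
        open ≤-Reasoning
        p₂ = χ-product (y ∷ z ∷ [])
        pₐ = χ-product (a ∷ y ∷ z ∷ [])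
        p_b = χ-product (b ∷ y ∷ z ∷ [])
        p₄ = χ-product (a ∷ b ∷ y ∷ z ∷ [])
        expand : ∀ r s t u → (1ℤ +ᶻ r) *ᶻ (1ℤ +ᶻ s) *ᶻ (t *ᶻ u) ≡
          (t *ᶻ (u *ᶻ 1ℤ) +ᶻ r *ᶻ (t *ᶻ (u *ᶻ 1ℤ))) +ᶻ (s *ᶻ (t *ᶻ (u *ᶻ 1ℤ)) +ᶻ r *ᶻ (s *ᶻ (t *ᶻ (u *ᶻ 1ℤ))))
        expand = solve-∀
        collect : ∀ r s t → ((r +ᶻ s) +ᶻ s) +ᶻ (s +ᶻ (t +ᶻ s)) ≡ (r +ᶻ + 4 *ᶻ s) +ᶻ t
        collect = solve-∀

    -- Each z ∈ Z contributes 4n² to the sum of (1 + χ(x + a)) (1 + χ(x + b)) (Σ_{y ∈ Y} χ(x + y))².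
    product-bound : ∀ {Y Z} → Unique Y → Unique Z → a ∈ Y → b ∈ Y → AllSquares Y Z →
      + length Z *ᶻ (+ 4 *ᶻ (+ length Y *ᶻ + length Y)) ≤ + length Y *ᶻ (+ q +ᶻ + length Y *ᶻ (+ 4 *ᶻ + C)) +ᶻ + q *ᶻ + 2
    product-bound {Y} {Z} uY uZ a∈Y b∈Y squares = begin
      + length Z *ᶻ (+ 4 *ᶻ (n *ᶻ n))                      ≡⟨ ∑-const Z (+ 4 *ᶻ (n *ᶻ n)) ⟨
      ∑ Z (λ _ → + 4 *ᶻ (n *ᶻ n))                          ≡⟨ ∑-cong-∈ Z (λ z∈ → ≡.sym (value z∈)) ⟩
      ∑ Z f                                                ≤⟨ ∑-⊆ _≟_ uZ (λ {x} _ → ∈-allFin x) (λ x → *-nonneg (*-nonneg (1+χ≥0 (x + a)) (1+χ≥0 (x + b))) (square≥0 (translates Y x))) ⟩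
      ∑ U f                                                ≡⟨ weighted-square Y w ⟩
      ∑ Y (λ y → ∑ Y (λ z → ∑ U (λ x → w x *ᶻ (χ (x + y) *ᶻ χ (x + z)))))
        ≤⟨ ∑-mono Y (λ y → ∑-mono Y (λ z → summand-bound y z)) ⟩
      ∑ Y (λ y → ∑ Y (λ z → diag y z +ᶻ + q *ᶻ coincidences a b y z))
        ≡⟨ ≡.trans (∑-cong Y (λ y → ∑-+ Y (diag y) (λ z → + q *ᶻ coincidences a b y z))) (∑-+ Y (λ y → ∑ Y (diag y)) (λ y → ∑ Y (λ z → + q *ᶻ coincidences a b y z))) ⟩
      ∑ Y (λ y → ∑ Y (diag y)) +ᶻ ∑ Y (λ y → ∑ Y (λ z → + q *ᶻ coincidences a b y z))
        ≡⟨ ≡.cong (∑ Y (λ y → ∑ Y (diag y)) +ᶻ_) (≡.trans (∑-cong Y (λ y → ∑-*ˡ Y (+ q) (coincidences a b y))) (∑-*ˡ Y (+ q) (λ y → ∑ Y (coincidences a b y)))) ⟩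
      ∑ Y (λ y → ∑ Y (diag y)) +ᶻ + q *ᶻ ∑ Y (λ y → ∑ Y (coincidences a b y))
        ≤⟨ +-mono-≤ (diagonal-sum uY (+ q) (+ 4 *ᶻ + C) (+≤+ z≤n)) (*-monoˡ-≤-nonNeg (+ q) (coincidences-total a b uY)) ⟩
      n *ᶻ (+ q +ᶻ n *ᶻ (+ 4 *ᶻ + C)) +ᶻ + q *ᶻ + 2 ∎
      where
      open ≤-Reasoning
      n = + length Y
      f : Fin q → ℤ
      f x = w x *ᶻ (translates Y x *ᶻ translates Y x)
      diag : Fin q → Fin q → ℤ
      diag y z = + q *ᶻ indicator (y ≟ z) +ᶻ + 4 *ᶻ + C
      value : ∀ {z} → z ∈ Z → f z ≡ + 4 *ᶻ (n *ᶻ n)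
      value {z} z∈ = ≡.cong₂ _*ᶻ_ (≡.cong₂ (λ s t → (1ℤ +ᶻ s) *ᶻ (1ℤ +ᶻ t)) (squares a∈Y z∈) (squares b∈Y z∈)) (≡.cong₂ _*ᶻ_ total total)
        where
        total : translates Y z ≡ n
        total = ≡.trans (∑-cong-∈ Y (λ y∈ → squares y∈ z∈)) (≡.sym (length≡∑1 Y))

  square-fibre : ∀ z → length (filter (λ x → x * x ≟ z) U) ℕ.≤ 2
  square-fibre z with filter (λ x → x * x ≟ z) U in eq
  ... | [] = z≤n
  ... | x₀ ∷ xs = Unique-⊆⇒length≤ _≟_ {ys = x₀ ∷ - x₀ ∷ []} (≡.subst Unique eq (Unique.filter⁺ (λ x → x * x ≟ z) (Unique.allFin⁺ q))) root
    where
    in-fibre : ∀ {x} → x ∈ x₀ ∷ xs → x * x ≡ z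
    in-fibre x∈ = proj₂ (∈-filter⁻ (λ x → x * x ≟ z) {xs = U} (≡.subst (_ ∈_) (≡.sym eq) x∈))
    root : ∀ {x} → x ∈ x₀ ∷ xs → x ∈ x₀ ∷ - x₀ ∷ []
    root {x} x∈ with K.integral {x + - x₀} {x + x₀} factored
      where
      open ≡.≡-Reasoning
      open import Algebra.Solver.Ring.NaturalCoefficients.Default K.commutativeSemiring using (solve; _:+_; _:*_; _:=_)
      factored : (x + - x₀) * (x + x₀) ≡ 0#
      factored = begin
        (x + - x₀) * (x + x₀)                     ≡⟨ solve 3 (λ x m x₀ → (x :+ m) :* (x :+ x₀) := x :* x :+ (x₀ :+ m) :* x :+ m :* x₀) ≡.refl x (- x₀) x₀ ⟩
        x * x + (x₀ + - x₀) * x + - x₀ * x₀       ≡⟨ ≡.cong₂ _+_ (≡.cong₂ _+_ (≡.trans (in-fibre x∈) (≡.sym (in-fibre (here ≡.refl)))) (≡.trans (≡.cong (_* x) (K.-‿inverseʳ x₀)) (K.zeroˡ x))) (≡.sym (K.-‿distribˡ-* x₀ x₀)) ⟩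
        x₀ * x₀ + 0# + - (x₀ * x₀)                ≡⟨ ≡.trans (≡.cong (_+ - (x₀ * x₀)) (K.+-identityʳ _)) (K.-‿inverseʳ _) ⟩
        0#                                        ∎
    ... | inj₁ p = here (K.x-y≡0⇒x≡y p)
    ... | inj₂ p = there (here (K.+-cancelˡ x₀ (≡.trans (K.+-comm x₀ x) (≡.trans p (≡.sym (K.-‿inverseʳ x₀))))))

  -- Squaring is at most two-to-one, and `0# ∷ L` meets every fibre; the entry 0 accounts for the
  -- additive 2.
  many-squares : ∀ L → (∀ x → x ≢ 0# → x * x ∈ L) → q ℕ.≤ 2 ℕ.+ 2 ℕ.* length L
  many-squares L squares∈L = drop‿+≤+ (begin
    + q                                                            ≡⟨ ≡.cong +_ (length-tabulate {n = q} id) ⟨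
    + length U                                                     ≤⟨ cover (λ z x → x * x ≟ z) U (0# ∷ L) (λ {x} _ → covered x) ⟩
    ∑ (0# ∷ L) (λ z → + length (filter (λ x → x * x ≟ z) U))       ≤⟨ ∑-≤-length (0# ∷ L) (+ 2) (λ {z} _ → +≤+ (square-fibre z)) ⟩
    + suc (length L) *ᶻ + 2                                        ≡⟨ pos-* (suc (length L)) 2 ⟨
    + (suc (length L) ℕ.* 2)                                       ≡⟨ ≡.cong +_ (ℕ.*-comm (suc (length L)) 2) ⟩
    + (2 ℕ.* suc (length L))                                       ≡⟨ ≡.cong +_ (ℕ.*-suc 2 (length L)) ⟩
    + (2 ℕ.+ 2 ℕ.* length L)                                       ∎)
    where
    open ≤-Reasoning
    covered : ∀ x → ∃ λ z → z ∈ 0# ∷ L × x * x ≡ z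
    covered x with x ≟ 0#
    ... | yes ≡.refl = 0# , here ≡.refl , K.zeroˡ 0#
    ... | no x≢0 = x * x , there (squares∈L x x≢0) , ≡.refl

  Covers : List (Fin q) → List (Fin q) → Set
  Covers Y Z = ∀ x → x ≢ 0# → ∃ λ y → ∃ λ z → y ∈ Y × z ∈ Z × z + y ≡ x * x

  private
    length-sums : ∀ (Z Y : List (Fin q)) → length (cartesianProductWith _+_ Z Y) ≡ length Z ℕ.* length Y
    length-sums [] Y = ≡.refl
    length-sums (z ∷ Z) Y = ≡.trans (length-++ (map (λ y → z + y) Y)) (≡.cong₂ ℕ._+_ (length-map (λ y → z + y) Y) (length-sums Z Y))

  -- With two summands a and b, every nonzero square stays a square after adding b - a or a - b. Only about
  -- 3q/8 points have this property.
  module _ {a b : Fin q} (a≢b : a ≢ b) {Z} (squares : AllSquares (a ∷ b ∷ []) Z) (covers : Covers (a ∷ b ∷ []) Z) where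

    private
      δ = b + - a
      δ′ = a + - b

      δ+δ′≡0 : δ + δ′ ≡ 0#
      δ+δ′≡0 = ≡.trans (solve 4 (λ a b a′ b′ → (b :+ a′) :+ (a :+ b′) := (b :+ b′) :+ (a :+ a′)) ≡.refl a b (- a) (- b))
        (≡.trans (≡.cong₂ _+_ (K.-‿inverseʳ b) (K.-‿inverseʳ a)) (K.+-identityʳ 0#))
        where open import Algebra.Solver.Ring.NaturalCoefficients.Default K.commutativeSemiring using (solve; _:+_; _:*_; _:=_)

      0≢δ : 0# ≢ δ
      0≢δ p = a≢b (≡.sym (K.x-y≡0⇒x≡y (≡.sym p)))

      0≢δ′ : 0# ≢ δ′
      0≢δ′ p = a≢b (K.x-y≡0⇒x≡y (≡.sym p))

      -- Since δ′ = -δ, equality would give 1 = -1. As 0, δ and -δ are distinct, every product of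
      -- these shifts below has a simple entry.
      δ≢δ′ : δ ≢ δ′
      δ≢δ′ p = 1≢-1 (K.*-cancelˡ-nonZero δ (λ z → 0≢δ (≡.sym z)) (≡.trans (K.*-identityʳ δ) (≡.trans p (≡.trans δ′≡-δ
        (≡.trans (≡.cong -_ (≡.sym (K.*-identityʳ δ))) (K.-‿distribʳ-* δ 1#))))))
        where
        δ′≡-δ : δ′ ≡ - δ
        δ′≡-δ = K.+-cancelˡ δ (≡.trans δ+δ′≡0 (≡.sym (K.-‿inverseʳ δ)))

      Paired : Fin q → Set
      Paired x = χ (x + 0#) ≡ 1ℤ × (χ (x + δ) ≡ 1ℤ ⊎ χ (x + δ′) ≡ 1ℤ)

      paired? : ∀ x → Dec (Paired x)
      paired? x = (χ (x + 0#) ℤ.≟ 1ℤ) ×-dec ((χ (x + δ) ℤ.≟ 1ℤ) ⊎-dec (χ (x + δ′) ℤ.≟ 1ℤ))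

      P = filter paired? U

      square-paired : ∀ x → x ≢ 0# → x * x ∈ P
      square-paired x x≢0 with covers x x≢0
      ... | _ , z , here ≡.refl , z∈ , z+a≡xx = ∈-filter⁺ paired? (∈-allFin (x * x))
            (≡.trans (≡.cong χ (K.+-identityʳ _)) (χ-square x x≢0) , inj₁ (≡.trans (≡.cong χ xx+δ) (squares (there (here ≡.refl)) z∈)))
        where
        xx+δ : x * x + δ ≡ z + b
        xx+δ = ≡.trans (≡.cong (_+ δ) (≡.sym z+a≡xx)) (≡.trans (K.+-assoc z a _) (≡.cong (λ y → z + y)
          (≡.trans (≡.cong (λ y → a + y) (K.+-comm b (- a))) (≡.trans (≡.sym (K.+-assoc a (- a) b)) (≡.trans (≡.cong (_+ b) (K.-‿inverseʳ a)) (K.+-identityˡ b))))))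
      ... | _ , z , there (here ≡.refl) , z∈ , z+b≡xx = ∈-filter⁺ paired? (∈-allFin (x * x))
            (≡.trans (≡.cong χ (K.+-identityʳ _)) (χ-square x x≢0) , inj₂ (≡.trans (≡.cong χ xx+δ′) (squares (here ≡.refl) z∈)))
        where
        xx+δ′ : x * x + δ′ ≡ z + a
        xx+δ′ = ≡.trans (≡.cong (_+ δ′) (≡.sym z+b≡xx)) (≡.trans (K.+-assoc z b _) (≡.cong (λ y → z + y)
          (≡.trans (≡.cong (λ y → b + y) (K.+-comm a (- b))) (≡.trans (≡.sym (K.+-assoc b (- b) a)) (≡.trans (≡.cong (_+ a) (K.-‿inverseʳ b)) (K.+-identityˡ a))))))

      -- (1 + c) (4 - (1 - u) (1 - v))
      weight : ℤ → ℤ → ℤ → ℤ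
      weight c u v = (1ℤ +ᶻ c) *ᶻ (+ 3 +ᶻ u +ᶻ v +ᶻ -ᶻ (u *ᶻ v))

      W : Fin q → ℤ
      W x = weight (χ (x + 0#)) (χ (x + δ)) (χ (x + δ′))

      W≥0 : ∀ x → 0ℤ ≤ W x
      W≥0 x = *-nonneg (1+χ≥0 (x + 0#)) (factor (χ-values (x + δ)) (χ-values (x + δ′)))
        where
        factor : ∀ {u v} → u ≡ 0ℤ ⊎ u ≡ 1ℤ ⊎ u ≡ -1ℤ → v ≡ 0ℤ ⊎ v ≡ 1ℤ ⊎ v ≡ -1ℤ → 0ℤ ≤ + 3 +ᶻ u +ᶻ v +ᶻ -ᶻ (u *ᶻ v)
        factor (inj₁ ≡.refl) (inj₁ ≡.refl) = +≤+ z≤n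
        factor (inj₁ ≡.refl) (inj₂ (inj₁ ≡.refl)) = +≤+ z≤n
        factor (inj₁ ≡.refl) (inj₂ (inj₂ ≡.refl)) = +≤+ z≤n
        factor (inj₂ (inj₁ ≡.refl)) (inj₁ ≡.refl) = +≤+ z≤n
        factor (inj₂ (inj₁ ≡.refl)) (inj₂ (inj₁ ≡.refl)) = +≤+ z≤n
        factor (inj₂ (inj₁ ≡.refl)) (inj₂ (inj₂ ≡.refl)) = +≤+ z≤n
        factor (inj₂ (inj₂ ≡.refl)) (inj₁ ≡.refl) = +≤+ z≤n
        factor (inj₂ (inj₂ ≡.refl)) (inj₂ (inj₁ ≡.refl)) = +≤+ z≤n
        factor (inj₂ (inj₂ ≡.refl)) (inj₂ (inj₂ ≡.refl)) = +≤+ z≤n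

      W≡8 : ∀ {x} → Paired x → W x ≡ + 8
      W≡8 {x} (c≡1 , inj₁ u≡1) = ≡.trans (≡.cong₂ (λ c u → weight c u (χ (x + δ′))) c≡1 u≡1) (u-cancels (χ (x + δ′)))
        where
        u-cancels : ∀ v → (1ℤ +ᶻ 1ℤ) *ᶻ (+ 3 +ᶻ 1ℤ +ᶻ v +ᶻ -ᶻ (1ℤ *ᶻ v)) ≡ + 8
        u-cancels = solve-∀
      W≡8 {x} (c≡1 , inj₂ v≡1) = ≡.trans (≡.cong₂ (λ c v → weight c (χ (x + δ)) v) c≡1 v≡1) (identity (χ (x + δ)))
        where
        identity : ∀ u → (1ℤ +ᶻ 1ℤ) *ᶻ (+ 3 +ᶻ u +ᶻ 1ℤ +ᶻ -ᶻ (u *ᶻ 1ℤ)) ≡ + 8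
        identity = solve-∀

      -- Only the constant term 3 of the expanded weight has a main contribution. The other
      -- coefficients have absolute values adding up to 9, rounded up to 10.
      total-weight : ∑ U W ≤ + q *ᶻ + 3 +ᶻ + 10 *ᶻ + C
      total-weight = begin
        ∑ U W
          ≡⟨ ∑-cong U (λ x → expand (χ (x + 0#)) (χ (x + δ)) (χ (x + δ′))) ⟩
        ∑ U (λ x → (+ 3 +ᶻ + 3 *ᶻ p 0# x) +ᶻ ((p δ x +ᶻ p δ′ x) +ᶻ ((p₂ 0# δ x +ᶻ p₂ 0# δ′ x) +ᶻ (-1ℤ *ᶻ p₂ δ δ′ x +ᶻ -1ℤ *ᶻ p₃ x))))
          ≡⟨ ≡.trans (∑-+ U (λ x → + 3 +ᶻ + 3 *ᶻ p 0# x) (λ x → (p δ x +ᶻ p δ′ x) +ᶻ ((p₂ 0# δ x +ᶻ p₂ 0# δ′ x) +ᶻ (-1ℤ *ᶻ p₂ δ δ′ x +ᶻ -1ℤ *ᶻ p₃ x))))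
               (≡.cong₂ _+ᶻ_ (≡.trans (∑-+ U (λ _ → + 3) (λ x → + 3 *ᶻ p 0# x)) (≡.cong₂ _+ᶻ_ (≡.trans (∑-const U (+ 3)) (≡.cong (λ k → + k *ᶻ + 3) (length-tabulate {n = q} id))) (∑-*ˡ U (+ 3) (p 0#))))
               (≡.trans (∑-+ U (λ x → p δ x +ᶻ p δ′ x) (λ x → (p₂ 0# δ x +ᶻ p₂ 0# δ′ x) +ᶻ (-1ℤ *ᶻ p₂ δ δ′ x +ᶻ -1ℤ *ᶻ p₃ x)))
               (≡.cong₂ _+ᶻ_ (∑-+ U (p δ) (p δ′))
               (≡.trans (∑-+ U (λ x → p₂ 0# δ x +ᶻ p₂ 0# δ′ x) (λ x → -1ℤ *ᶻ p₂ δ δ′ x +ᶻ -1ℤ *ᶻ p₃ x))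
               (≡.cong₂ _+ᶻ_ (∑-+ U (p₂ 0# δ) (p₂ 0# δ′))
               (≡.trans (∑-+ U (λ x → -1ℤ *ᶻ p₂ δ δ′ x) (λ x → -1ℤ *ᶻ p₃ x))
               (≡.cong₂ _+ᶻ_ (negated (p₂ δ δ′)) (negated p₃)))))))) ⟩
        (+ q *ᶻ + 3 +ᶻ + 3 *ᶻ ∑ U (p 0#)) +ᶻ ((∑ U (p δ) +ᶻ ∑ U (p δ′)) +ᶻ ((∑ U (p₂ 0# δ) +ᶻ ∑ U (p₂ 0# δ′)) +ᶻ (-ᶻ ∑ U (p₂ δ δ′) +ᶻ -ᶻ ∑ U p₃)))
          ≤⟨ +-mono-≤ (+-monoʳ-≤ (+ q *ᶻ + 3) (*-monoˡ-≤-nonNeg (+ 3) (single-sum 0#)))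
               (+-mono-≤ (+-mono-≤ (single-sum δ) (single-sum δ′)) (+-mono-≤ (+-mono-≤ (two 0≢δ) (two 0≢δ′))
                 (+-mono-≤ (χ-sum-lower _ (s≤s (s≤s z≤n)) (δ , _ , Perm.refl , δ≢δ′ ∷ [])) (χ-sum-lower _ (s≤s (s≤s (s≤s z≤n))) (0# , _ , Perm.refl , 0≢δ ∷ 0≢δ′ ∷ []))))) ⟩
        (+ q *ᶻ + 3 +ᶻ + 3 *ᶻ + C) +ᶻ ((+ C +ᶻ + C) +ᶻ ((+ C +ᶻ + C) +ᶻ (+ C +ᶻ + C)))
          ≤⟨ +-monoʳ-≤ (+ q *ᶻ + 3 +ᶻ + 3 *ᶻ + C) (≤-trans (≤-reflexive (≡.sym (+-identityʳ _))) (+-monoʳ-≤ ((+ C +ᶻ + C) +ᶻ ((+ C +ᶻ + C) +ᶻ (+ C +ᶻ + C))) (+≤+ (z≤n {C})))) ⟩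
        (+ q *ᶻ + 3 +ᶻ + 3 *ᶻ + C) +ᶻ (((+ C +ᶻ + C) +ᶻ ((+ C +ᶻ + C) +ᶻ (+ C +ᶻ + C))) +ᶻ + C)
          ≡⟨ collect (+ q *ᶻ + 3) (+ C) ⟩
        + q *ᶻ + 3 +ᶻ + 10 *ᶻ + C ∎
        where
        open ≤-Reasoning
        p : Fin q → Fin q → ℤ
        p a = χ-product (a ∷ [])
        p₂ : Fin q → Fin q → Fin q → ℤ
        p₂ a b = χ-product (a ∷ b ∷ [])
        p₃ = χ-product (0# ∷ δ ∷ δ′ ∷ [])
        two : ∀ {a b} → a ≢ b → χ-sum (a ∷ b ∷ []) ≤ + C
        two a≢b = χ-sum-upper _ (s≤s (s≤s z≤n)) (_ , _ , Perm.refl , a≢b ∷ [])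
        negated : ∀ f → ∑ U (λ x → -1ℤ *ᶻ f x) ≡ -ᶻ ∑ U f
        negated f = ≡.trans (∑-*ˡ U -1ℤ f) (-1*i≡-i (∑ U f))
        expand : ∀ c u v → (1ℤ +ᶻ c) *ᶻ (+ 3 +ᶻ u +ᶻ v +ᶻ -ᶻ (u *ᶻ v)) ≡
          (+ 3 +ᶻ + 3 *ᶻ (c *ᶻ 1ℤ)) +ᶻ (((u *ᶻ 1ℤ) +ᶻ (v *ᶻ 1ℤ)) +ᶻ ((c *ᶻ (u *ᶻ 1ℤ) +ᶻ c *ᶻ (v *ᶻ 1ℤ)) +ᶻ (-1ℤ *ᶻ (u *ᶻ (v *ᶻ 1ℤ)) +ᶻ -1ℤ *ᶻ (c *ᶻ (u *ᶻ (v *ᶻ 1ℤ))))))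
        expand = solve-∀
        collect : ∀ r s → (r +ᶻ + 3 *ᶻ s) +ᶻ (((s +ᶻ s) +ᶻ ((s +ᶻ s) +ᶻ (s +ᶻ s))) +ᶻ s) ≡ r +ᶻ + 10 *ᶻ s
        collect = solve-∀

    -- All nonzero squares lie in `P` and each point of `P` has weight 8, so the total weight is at
    -- least about 4q; but it is only about 3q. The difference q is absorbed by the error terms.
    two-element-bound : q ℕ.≤ 8 ℕ.+ 10 ℕ.* C
    two-element-bound = ℕ.+-cancelʳ-≤ (q ℕ.* 3) q (8 ℕ.+ 10 ℕ.* C) (begin
      q ℕ.+ q ℕ.* 3                              ≡⟨ four q ⟩
      4 ℕ.* q                                    ≤⟨ ℕ.*-monoʳ-≤ 4 (many-squares P square-paired) ⟩
      4 ℕ.* (2 ℕ.+ 2 ℕ.* length P)               ≡⟨ eight (length P) ⟩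
      8 ℕ.+ length P ℕ.* 8                       ≤⟨ ℕ.+-monoʳ-≤ 8 (drop‿+≤+ bound) ⟩
      8 ℕ.+ (q ℕ.* 3 ℕ.+ 10 ℕ.* C)               ≡⟨ reorder (q ℕ.* 3) (10 ℕ.* C) ⟩
      8 ℕ.+ 10 ℕ.* C ℕ.+ q ℕ.* 3                 ∎)
      where
      open ℕ.≤-Reasoning
      four : ∀ q → q ℕ.+ q ℕ.* 3 ≡ 4 ℕ.* q
      four = ℕ.solve-∀
      eight : ∀ p → 4 ℕ.* (2 ℕ.+ 2 ℕ.* p) ≡ 8 ℕ.+ p ℕ.* 8
      eight = ℕ.solve-∀
      reorder : ∀ x y → 8 ℕ.+ (x ℕ.+ y) ≡ 8 ℕ.+ y ℕ.+ x
      reorder = ℕ.solve-∀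
      bound : + (length P ℕ.* 8) ≤ + (q ℕ.* 3 ℕ.+ 10 ℕ.* C)
      bound = ≤-trans (≤-reflexive (≡.trans (pos-* (length P) 8) (≡.trans (≡.sym (∑-const P (+ 8)))
          (∑-cong-∈ P (λ x∈ → ≡.sym (W≡8 (proj₂ (∈-filter⁻ paired? {xs = U} x∈))))))))
        (≤-trans (∑-⊆ _≟_ (Unique.filter⁺ paired? (Unique.allFin⁺ q)) (λ {x} _ → ∈-allFin x) W≥0) (≤-trans total-weight
          (≤-reflexive (≡.sym (≡.cong₂ _+ᶻ_ (pos-* q 3) (pos-* 10 C))))))

  -- With n = |Y|, multiply q ≤ 2 + 2 |Y| |Z| by 2n and insert `product-bound`: what remains on the
  -- left is (n - 2) q. So n = 2 is handled by `two-element-bound`, and for n ≥ 3 division by n - 2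
  -- uses 4n ≤ 12 (n - 2), the origin of the 12.
  size-bound : ∀ {Y Z} → Unique Y → Unique Z → 2 ℕ.≤ length Y → AllSquares Y Z → Covers Y Z →
    q ℕ.≤ 12 ℕ.+ 12 ℕ.* (C ℕ.* length Y)
  size-bound {_ ∷ []} _ _ (s≤s ()) _ _
  size-bound {a ∷ b ∷ []} ((a≢b ∷ []) ∷ _) _ _ squares covers = ℕ.≤-trans (two-element-bound a≢b squares covers)
    (ℕ.+-mono-≤ (ℕ.m≤m+n 8 4) (ℕ.*-mono-≤ (ℕ.m≤m+n 10 2) (ℕ.≤-trans (ℕ.≤-reflexive (≡.sym (ℕ.*-identityʳ C))) (ℕ.*-monoʳ-≤ C (ℕ.m≤m+n 1 1)))))
  size-bound {Y@(a ∷ b ∷ Y′@(_ ∷ Y″))} {Z} uY@((a≢b ∷ _) ∷ _) uZ _ squares covers =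
    ℕ.*-cancelˡ-≤ (suc t) (ℕ.+-cancelʳ-≤ ((5 ℕ.+ t) ℕ.* q) _ _ (begin
      suc t ℕ.* q ℕ.+ (5 ℕ.+ t) ℕ.* q                        ≡⟨ double t q ⟩
      2 ℕ.* n ℕ.* q                                          ≤⟨ ℕ.*-monoʳ-≤ (2 ℕ.* n) (many-squares (cartesianProductWith _+_ Z Y) all-sums) ⟩
      2 ℕ.* n ℕ.* (2 ℕ.+ 2 ℕ.* length (cartesianProductWith _+_ Z Y)) ≡⟨ ≡.cong (λ l → 2 ℕ.* n ℕ.* (2 ℕ.+ 2 ℕ.* l)) (length-sums Z Y) ⟩
      2 ℕ.* n ℕ.* (2 ℕ.+ 2 ℕ.* (β ℕ.* n))                    ≡⟨ expand n β ⟩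
      4 ℕ.* n ℕ.+ β ℕ.* (4 ℕ.* (n ℕ.* n))                    ≤⟨ ℕ.+-monoʳ-≤ (4 ℕ.* n) (drop‿+≤+ bound) ⟩
      4 ℕ.* n ℕ.+ (n ℕ.* (q ℕ.+ n ℕ.* (4 ℕ.* C)) ℕ.+ q ℕ.* 2)    ≡⟨ collect t q C ⟩
      4 ℕ.* (3 ℕ.+ t) ℕ.+ 4 ℕ.* (3 ℕ.+ t) ℕ.* (C ℕ.* n) ℕ.+ (5 ℕ.+ t) ℕ.* q
        ≤⟨ ℕ.+-monoˡ-≤ ((5 ℕ.+ t) ℕ.* q) (ℕ.+-mono-≤ 4n≤ (ℕ.*-monoˡ-≤ (C ℕ.* n) 4n≤)) ⟩
      suc t ℕ.* 12 ℕ.+ suc t ℕ.* 12 ℕ.* (C ℕ.* n) ℕ.+ (5 ℕ.+ t) ℕ.* q ≡⟨ ≡.cong (ℕ._+ (5 ℕ.+ t) ℕ.* q) (factor (suc t) (C ℕ.* n)) ⟩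
      suc t ℕ.* (12 ℕ.+ 12 ℕ.* (C ℕ.* n)) ℕ.+ (5 ℕ.+ t) ℕ.* q ∎))
    where
    open ℕ.≤-Reasoning
    t = length Y″
    n = length Y
    β = length Z
    4n≤ : 4 ℕ.* (3 ℕ.+ t) ℕ.≤ suc t ℕ.* 12
    4n≤ = ℕ.≤-trans (ℕ.m≤m+n _ (8 ℕ.* t)) (ℕ.≤-reflexive (form t))
      where
      form : ∀ t → 4 ℕ.* (3 ℕ.+ t) ℕ.+ 8 ℕ.* t ≡ suc t ℕ.* 12
      form = ℕ.solve-∀
    double : ∀ t q → suc t ℕ.* q ℕ.+ (5 ℕ.+ t) ℕ.* q ≡ 2 ℕ.* (3 ℕ.+ t) ℕ.* q
    double = ℕ.solve-∀
    expand : ∀ n β → 2 ℕ.* n ℕ.* (2 ℕ.+ 2 ℕ.* (β ℕ.* n)) ≡ 4 ℕ.* n ℕ.+ β ℕ.* (4 ℕ.* (n ℕ.* n))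
    expand = ℕ.solve-∀
    collect : ∀ t q C → 4 ℕ.* (3 ℕ.+ t) ℕ.+ ((3 ℕ.+ t) ℕ.* (q ℕ.+ (3 ℕ.+ t) ℕ.* (4 ℕ.* C)) ℕ.+ q ℕ.* 2) ≡
      4 ℕ.* (3 ℕ.+ t) ℕ.+ 4 ℕ.* (3 ℕ.+ t) ℕ.* (C ℕ.* (3 ℕ.+ t)) ℕ.+ (5 ℕ.+ t) ℕ.* q
    collect = ℕ.solve-∀
    factor : ∀ s c → s ℕ.* 12 ℕ.+ s ℕ.* 12 ℕ.* c ≡ s ℕ.* (12 ℕ.+ 12 ℕ.* c)
    factor = ℕ.solve-∀
    all-sums : ∀ x → x ≢ 0# → x * x ∈ cartesianProductWith _+_ Z Y
    all-sums x x≢0 with y , z , y∈ , z∈ , z+y≡ ← covers x x≢0 = ≡.subst (_∈ cartesianProductWith _+_ Z Y) z+y≡ (∈-cartesianProductWith⁺ _+_ z∈ y∈)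
    bound : + (β ℕ.* (4 ℕ.* (n ℕ.* n))) ≤ + (n ℕ.* (q ℕ.+ n ℕ.* (4 ℕ.* C)) ℕ.+ q ℕ.* 2)
    bound = ≤-trans (≤-reflexive (≡.trans (pos-* β (4 ℕ.* (n ℕ.* n))) (≡.cong (+ β *ᶻ_) (≡.trans (pos-* 4 (n ℕ.* n)) (≡.cong (+ 4 *ᶻ_) (pos-* n n))))))
      (≤-trans (product-bound a≢b uY uZ (here ≡.refl) (there (here ≡.refl)) squares)
        (≤-reflexive (≡.sym (≡.cong₂ _+ᶻ_ (≡.trans (pos-* n (q ℕ.+ n ℕ.* (4 ℕ.* C))) (≡.cong (λ k → + n *ᶻ (+ q +ᶻ k)) (≡.trans (pos-* n (4 ℕ.* C)) (≡.cong (+ n *ᶻ_) (pos-* 4 C))))) (pos-* q 2)))))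

-- Lists of subsets and of their elements.

module SubsetLists where

  open import Data.Nat using (ℕ; zero; suc; _+_; _^_; _≤_; s≤s)
  open import Data.Nat.Properties
  open import Data.Fin using (Fin; zero; suc)
  import Data.Fin.Properties as Fin
  open import Data.Fin.Subset using (Subset; ⊥; ⁅_⁆; _∪_; _-_; ∣_∣; inside; outside) renaming (_∈_ to _∈ˢ_)
  open import Data.Fin.Subset.Properties
  open import Data.List using (List; []; _∷_; _++_; map; length; filter; allFin)
  open import Data.List.Properties using (length-++; length-map)
  open import Data.List.Membership.Propositional using (_∈_)
  open import Data.List.Membership.Propositional.Properties using (∈-map⁺; ∈-++⁺ˡ; ∈-++⁺ʳ; ∈-filter⁺; ∈-filter⁻; ∈-allFin)
  open import Data.List.Relation.Unary.Any using (here; there)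
  open import Data.List.Relation.Unary.Unique.Propositional using (Unique)
  import Data.List.Relation.Unary.Unique.Propositional.Properties as Unique
  import Data.Vec as Vec
  open import Data.Product using (proj₂)
  open import Data.Sum using (inj₁; inj₂)
  open import Relation.Nullary using (yes; no; ¬_; contradiction)
  open import Relation.Binary.PropositionalEquality

  private variable
    n : ℕ

  subsets : List (Fin n) → List (Subset n)
  subsets [] = ⊥ ∷ []
  subsets (x ∷ X) = subsets X ++ map (⁅ x ⁆ ∪_) (subsets X)

  length-subsets : ∀ (X : List (Fin n)) → length (subsets X) ≡ 2 ^ length X
  length-subsets [] = refl
  length-subsets (x ∷ X) = trans (length-++ (subsets X)) (trans
    (cong₂ _+_ (length-subsets X) (trans (length-map (⁅ x ⁆ ∪_) (subsets X)) (length-subsets X)))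
    (cong (2 ^ length X +_) (sym (+-identityʳ _))))

  x∉p-x : ∀ (p : Subset n) x → ¬ x ∈ˢ p - x
  x∉p-x p x x∈ = <⇒≢ (x∈p⇒∣p-x∣<∣p∣ x∈) (cong ∣_∣ (p─q─q≡p─q p ⁅ x ⁆))

  subsets-complete : ∀ (X : List (Fin n)) {A : Subset n} → (∀ {x} → x ∈ˢ A → x ∈ X) → A ∈ subsets X
  subsets-complete [] A⊆ = here (⊆-antisym (λ x∈ → contradiction (A⊆ x∈) λ ()) (λ x∈ → contradiction x∈ ∉⊥))
  subsets-complete (x ∷ X) {A} A⊆ with x ∈? A
  ... | yes x∈A = ∈-++⁺ʳ (subsets X) (subst (_∈ map (⁅ x ⁆ ∪_) (subsets X)) (⊆-antisym ⊆₁ ⊆₂) (∈-map⁺ (⁅ x ⁆ ∪_) (subsets-complete X rest)))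
    where
    rest : ∀ {y} → y ∈ˢ A - x → y ∈ X
    rest {y} y∈ with A⊆ (p─q⊆p A ⁅ x ⁆ y∈)
    ... | here refl = contradiction y∈ (x∉p-x A x)
    ... | there y∈X = y∈X
    ⊆₁ : ∀ {y} → y ∈ˢ ⁅ x ⁆ ∪ (A - x) → y ∈ˢ A
    ⊆₁ y∈ with x∈p∪q⁻ ⁅ x ⁆ (A - x) y∈
    ... | inj₁ y∈x rewrite x∈⁅y⁆⇒x≡y x y∈x = x∈A
    ... | inj₂ y∈A-x = p─q⊆p A ⁅ x ⁆ y∈A-x
    ⊆₂ : ∀ {y} → y ∈ˢ A → y ∈ˢ ⁅ x ⁆ ∪ (A - x)
    ⊆₂ {y} y∈A with y Fin.≟ x
    ... | yes refl = x∈p∪q⁺ (inj₁ (x∈⁅x⁆ x))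
    ... | no y≢x = x∈p∪q⁺ (inj₂ (x∈p∧x≢y⇒x∈p-y y∈A y≢x))
  ... | no x∉A = ∈-++⁺ˡ (subsets-complete X rest)
    where
    rest : ∀ {y} → y ∈ˢ A → y ∈ X
    rest y∈A with A⊆ y∈A
    ... | here refl = contradiction y∈A x∉A
    ... | there y∈X = y∈X

  ∣p∣≤1+∣p-x∣ : ∀ (p : Subset n) x → ∣ p ∣ ≤ suc ∣ p - x ∣
  ∣p∣≤1+∣p-x∣ (inside Vec.∷ p) zero = s≤s (≤-reflexive (cong ∣_∣ (sym (p─⊥≡p p))))
  ∣p∣≤1+∣p-x∣ (outside Vec.∷ p) zero = m≤n⇒m≤1+n (≤-reflexive (cong ∣_∣ (sym (p─⊥≡p p))))
  ∣p∣≤1+∣p-x∣ (inside Vec.∷ p) (suc x) = s≤s (∣p∣≤1+∣p-x∣ p x)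
  ∣p∣≤1+∣p-x∣ (outside Vec.∷ p) (suc x) = ∣p∣≤1+∣p-x∣ p x

  ∣p∣≤length : ∀ (X : List (Fin n)) (p : Subset n) → (∀ {x} → x ∈ˢ p → x ∈ X) → ∣ p ∣ ≤ length X
  ∣p∣≤length {n} [] p p⊆ = ≤-trans (p⊆q⇒∣p∣≤∣q∣ {p = p} {⊥} (λ x∈ → contradiction (p⊆ x∈) λ ())) (≤-reflexive (∣⊥∣≡0 n))
  ∣p∣≤length (x ∷ X) p p⊆ = ≤-trans (∣p∣≤1+∣p-x∣ p x) (s≤s (∣p∣≤length X (p - x) rest))
    where
    rest : ∀ {y} → y ∈ˢ p - x → y ∈ X
    rest y∈ with p⊆ (p─q⊆p p ⁅ x ⁆ y∈)
    ... | here refl = contradiction y∈ (x∉p-x p x)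
    ... | there y∈X = y∈X

  elements : Subset n → List (Fin n)
  elements {n} A = filter (_∈? A) (allFin n)

  elements-unique : ∀ (A : Subset n) → Unique (elements A)
  elements-unique {n} A = Unique.filter⁺ (_∈? A) (Unique.allFin⁺ n)

  ∈-elements⁺ : ∀ {A : Subset n} {x} → x ∈ˢ A → x ∈ elements A
  ∈-elements⁺ {A = A} {x} x∈A = ∈-filter⁺ (_∈? A) (∈-allFin x) x∈A

  ∈-elements⁻ : ∀ {A : Subset n} {x} → x ∈ elements A → x ∈ˢ A
  ∈-elements⁻ {n} {A} x∈ = proj₂ (∈-filter⁻ (_∈? A) {xs = allFin n} x∈)

  ∣A∣≤length-elements : ∀ (A : Subset n) → ∣ A ∣ ≤ length (elements A)
  ∣A∣≤length-elements A = ∣p∣≤length (elements A) A ∈-elements⁺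

-- Counting decompositions by containers.

module Counting {q} (F : FiniteFieldOn q) (χ : Fin q → ℤ) (h : ℕ) (1≤h : 1 ℕ.≤ h)
  (36h²≤q : 36 ℕ.* (h ℕ.* h) ℕ.≤ q) (q≤144h² : q ℕ.≤ 144 ℕ.* (h ℕ.* h))
  (small : ShiftedProducts.SmallSums F χ (508 ℕ.* h))
  (1≢-1 : Field.1# F ≢ Field.-_ F (Field.1# F))
  (t : ℕ) (t-large : 4 ℕ.* (24988 ℕ.* h) ℕ.≤ t) where

  open import Data.Nat using (suc; zero; z≤n; s≤s)
  import Data.Nat.Properties as ℕ
  import Data.Nat.Tactic.RingSolver as ℕ
  open import Data.Fin.Properties using (_≟_)
  open import Data.Fin.Subset using (Subset) renaming (_∈_ to _∈ˢ_)
  open import Data.Fin.Subset.Properties using (_∈?_)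
  open import Data.List using (List; []; _∷_; length; filter; map; allFin)
  open import Data.List.Properties using (length-tabulate; length-map)
  open import Data.List.Relation.Unary.All as All using (All; []; _∷_; all?)
  import Data.List.Relation.Unary.All.Properties as All
  open import Data.List.Relation.Unary.Any using (here; there)
  open import Data.List.Relation.Unary.Unique.Propositional using (Unique)
  import Data.List.Relation.Unary.Unique.Propositional.Properties as Unique
  open import Data.List.Membership.Propositional using (_∈_; find)
  open import Data.List.Membership.Propositional.Properties using (∈-allFin; ∈-filter⁻; ∈-filter⁺; ∈-map⁺)
  open import Data.Maybe using (Maybe; just; nothing)
  open import Data.Integer as ℤ using (+_; 1ℤ; -1ℤ; +≤+; _≤_) renaming (_+_ to _+ᶻ_; _*_ to _*ᶻ_)
  open import Data.Integer.Properties hiding (_≟_)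
  open import Data.Integer.Tactic.RingSolver using (solve-∀)
  open import Data.Product using (∃; _×_; _,_; proj₁; proj₂)
  import Data.Product.Properties as Product
  import Data.Vec.Properties as Vec
  import Data.Bool.Properties as Bool
  open import Data.Empty using (⊥; ⊥-elim)
  open import Function using (id)
  open import Function.Bundles using (Equivalence)
  open import Relation.Nullary using (Dec; yes; no; ¬_)
  open import Relation.Nullary.Decidable using (_×-dec_; ¬?)
  open import Relation.Binary.Definitions using (DecidableEquality)

  open Sums
  open SubsetLists
  open Field F using (_+_; _*_; 0#)
  private module K = Field F
  open ShiftedProducts.SmallSums small
  open Sumset F χ (508 ℕ.* h) small
  open SumsetSize F χ (508 ℕ.* h) small 1≢-1

  private
    U = allFin q

    Pair = Subset q × Subset q

    _≟ˢ_ : DecidableEquality (Subset q)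
    _≟ˢ_ = Vec.≡-dec Bool._≟_

    _≟ᵖ_ : DecidableEquality Pair
    _≟ᵖ_ = Product.≡-dec _≟ˢ_ _≟ˢ_

  module _ {A B : Subset q} (dec : DecomposesSquares F (A , B)) where

    private
      sum-square : ∀ {y z} → y ∈ elements A → z ∈ elements B → χ (y + z) ≡ 1ℤ
      sum-square {y} {z} y∈ z∈ with x , x≢0 , xx≡ ← Equivalence.to (proj₂ (proj₂ dec) (y + z)) (y , z , ∈-elements⁻ y∈ , ∈-elements⁻ z∈ , ≡.refl) =
        ≡.trans (≡.cong χ (≡.sym xx≡)) (χ-square x x≢0)

      representation : ∀ x → x ≢ 0# → ∃ λ y → ∃ λ z → y ∈ elements A × z ∈ elements B × y + z ≡ x * x
      representation x x≢0 with y , z , y∈ , z∈ , e ← Equivalence.from (proj₂ (proj₂ dec) (x * x)) (x , x≢0 , ≡.refl) =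
        y , z , ∈-elements⁺ y∈ , ∈-elements⁺ z∈ , e

    squares-left : AllSquares (elements A) (elements B)
    squares-left {y} {z} y∈ z∈ = ≡.trans (≡.cong χ (K.+-comm z y)) (sum-square y∈ z∈)

    squares-right : AllSquares (elements B) (elements A)
    squares-right y∈ z∈ = sum-square z∈ y∈

    private
      -- Both sides are compared after multiplying by 36 h. Since 12 ≤ 12 h n, the right side is at
      -- most 12 · 509 h n; rounding 509 up to 510 makes the quotient by 36 the integer 170.
      linear-size : ∀ {n} → 2 ℕ.≤ n → q ℕ.≤ 12 ℕ.+ 12 ℕ.* (508 ℕ.* h ℕ.* n) → h ℕ.≤ 170 ℕ.* n
      linear-size {n} 2≤n q≤ = ℕ.*-cancelˡ-≤ 36 (ℕ.*-cancelʳ-≤ (36 ℕ.* h) (36 ℕ.* (170 ℕ.* n)) h {{ℕ.>-nonZero 1≤h}} (begin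
        36 ℕ.* h ℕ.* h                                ≡⟨ ℕ.*-assoc 36 h h ⟩
        36 ℕ.* (h ℕ.* h)                              ≤⟨ 36h²≤q ⟩
        q                                             ≤⟨ q≤ ⟩
        12 ℕ.+ 12 ℕ.* (508 ℕ.* h ℕ.* n)               ≤⟨ ℕ.+-monoˡ-≤ _ (ℕ.*-monoʳ-≤ 12 (ℕ.*-mono-≤ 1≤h (ℕ.≤-trans (ℕ.n≤1+n 1) 2≤n))) ⟩
        12 ℕ.* (h ℕ.* n) ℕ.+ 12 ℕ.* (508 ℕ.* h ℕ.* n) ≤⟨ ℕ.m≤m+n _ (12 ℕ.* (h ℕ.* n)) ⟩
        12 ℕ.* (h ℕ.* n) ℕ.+ 12 ℕ.* (508 ℕ.* h ℕ.* n) ℕ.+ 12 ℕ.* (h ℕ.* n) ≡⟨ collect h n ⟩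
        36 ℕ.* (170 ℕ.* n) ℕ.* h                      ∎))
        where
        open ℕ.≤-Reasoning
        collect : ∀ h n → 12 ℕ.* (h ℕ.* n) ℕ.+ 12 ℕ.* (508 ℕ.* h ℕ.* n) ℕ.+ 12 ℕ.* (h ℕ.* n) ≡ 36 ℕ.* (170 ℕ.* n) ℕ.* h
        collect = ℕ.solve-∀

      2≤∣A∣ = ℕ.≤-trans (proj₁ dec) (∣A∣≤length-elements A)
      2≤∣B∣ = ℕ.≤-trans (proj₁ (proj₂ dec)) (∣A∣≤length-elements B)

    size-left : h ℕ.≤ 170 ℕ.* length (elements A)
    size-left = linear-size 2≤∣A∣ (size-bound (elements-unique A) (elements-unique B) 2≤∣A∣ squares-left
      (λ x x≢0 → let y , z , y∈ , z∈ , e = representation x x≢0 in y , z , y∈ , z∈ , ≡.trans (K.+-comm z y) e))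

    size-right : h ℕ.≤ 170 ℕ.* length (elements B)
    size-right = linear-size 2≤∣B∣ (size-bound (elements-unique B) (elements-unique A) 2≤∣B∣ squares-right
      (λ x x≢0 → let y , z , y∈ , z∈ , e = representation x x≢0 in z , y , z∈ , y∈ , e))

  -- Markov's inequality for the second moment.
  few-biased : ∀ c {Y Z} → c ℕ.≤ 2 → Unique Y → Unique Z → h ℕ.≤ 170 ℕ.* length Y →
    (∀ {z} → z ∈ Z → + length Y ≤ + c *ᶻ translates Y z) → length Z ℕ.≤ t
  few-biased c {Y} {Z} c≤2 uY uZ h≤170n biased = ℕ.≤-trans (ℕ.*-cancelʳ-≤ (length Z) (c ℕ.* c ℕ.* (24988 ℕ.* h)) n {{n≢0}}
      (ℕ.*-cancelʳ-≤ (length Z ℕ.* n) (c ℕ.* c ℕ.* (24988 ℕ.* h) ℕ.* n) n {{n≢0}} main))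
      (ℕ.≤-trans (ℕ.*-monoˡ-≤ (24988 ℕ.* h) (ℕ.*-mono-≤ c≤2 c≤2)) t-large)
    where
    n = length Y
    n≢0 : ℕ.NonZero n
    n≢0 = ℕ.>-nonZero (ℕ.≰⇒> λ n≤0 → ℕ.<⇒≱ 1≤h (ℕ.≤-trans h≤170n (ℕ.≤-trans (ℕ.*-monoʳ-≤ 170 n≤0) (ℕ.≤-reflexive (ℕ.*-zeroʳ 170)))))
    square-mono : ∀ {i} m → + m ≤ i → + m *ᶻ + m ≤ i *ᶻ i
    square-mono {+ k} m (+≤+ m≤k) = ≤-trans (≤-reflexive (≡.sym (pos-* m m))) (≤-trans (+≤+ (ℕ.*-mono-≤ m≤k m≤k)) (≤-reflexive (pos-* k k)))
    moment : + (length Z ℕ.* (n ℕ.* n)) ≤ + (c ℕ.* c ℕ.* (n ℕ.* (q ℕ.+ n ℕ.* (508 ℕ.* h))))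
    moment = begin
      + (length Z ℕ.* (n ℕ.* n))                                  ≡⟨ ≡.trans (pos-* (length Z) (n ℕ.* n)) (≡.cong (+ length Z *ᶻ_) (pos-* n n)) ⟩
      + length Z *ᶻ (+ n *ᶻ + n)                                  ≡⟨ ∑-const Z (+ n *ᶻ + n) ⟨
      ∑ Z (λ _ → + n *ᶻ + n)                                      ≤⟨ ∑-mono-∈ Z (λ z∈ → square-mono n (biased z∈)) ⟩
      ∑ Z (λ z → (+ c *ᶻ g z) *ᶻ (+ c *ᶻ g z))                    ≤⟨ ∑-⊆ _≟_ uZ (λ {x} _ → ∈-allFin x) (λ x → square≥0 (+ c *ᶻ g x)) ⟩
      ∑ U (λ z → (+ c *ᶻ g z) *ᶻ (+ c *ᶻ g z))                    ≡⟨ ∑-cong U (λ z → regroup (+ c) (g z)) ⟩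
      ∑ U (λ z → (+ c *ᶻ + c) *ᶻ (g z *ᶻ g z))                    ≡⟨ ∑-*ˡ U (+ c *ᶻ + c) (λ z → g z *ᶻ g z) ⟩
      (+ c *ᶻ + c) *ᶻ ∑ U (λ z → g z *ᶻ g z)                      ≡⟨ ≡.cong (_*ᶻ ∑ U (λ z → g z *ᶻ g z)) (pos-* c c) ⟨
      + (c ℕ.* c) *ᶻ ∑ U (λ z → g z *ᶻ g z)                       ≤⟨ *-monoˡ-≤-nonNeg (+ (c ℕ.* c)) (second-moment uY) ⟩
      + (c ℕ.* c) *ᶻ (+ n *ᶻ (+ q +ᶻ + n *ᶻ + (508 ℕ.* h)))       ≡⟨ ≡.cong (λ k → + (c ℕ.* c) *ᶻ (+ n *ᶻ (+ q +ᶻ k))) (pos-* n (508 ℕ.* h)) ⟨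
      + (c ℕ.* c) *ᶻ (+ n *ᶻ + (q ℕ.+ n ℕ.* (508 ℕ.* h)))         ≡⟨ ≡.cong (+ (c ℕ.* c) *ᶻ_) (pos-* n (q ℕ.+ n ℕ.* (508 ℕ.* h))) ⟨
      + (c ℕ.* c) *ᶻ + (n ℕ.* (q ℕ.+ n ℕ.* (508 ℕ.* h)))          ≡⟨ pos-* (c ℕ.* c) _ ⟨
      + (c ℕ.* c ℕ.* (n ℕ.* (q ℕ.+ n ℕ.* (508 ℕ.* h))))           ∎
      where
      open ≤-Reasoning
      g = translates Y
      regroup : ∀ c g → (c *ᶻ g) *ᶻ (c *ᶻ g) ≡ (c *ᶻ c) *ᶻ (g *ᶻ g)
      regroup = solve-∀
    main : length Z ℕ.* n ℕ.* n ℕ.≤ c ℕ.* c ℕ.* (24988 ℕ.* h) ℕ.* n ℕ.* n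
    main = begin
      length Z ℕ.* n ℕ.* n                                           ≡⟨ ℕ.*-assoc (length Z) n n ⟩
      length Z ℕ.* (n ℕ.* n)                                         ≤⟨ drop‿+≤+ moment ⟩
      c ℕ.* c ℕ.* (n ℕ.* (q ℕ.+ n ℕ.* (508 ℕ.* h)))                  ≤⟨ ℕ.*-monoʳ-≤ (c ℕ.* c) (ℕ.*-monoʳ-≤ n (ℕ.+-monoˡ-≤ (n ℕ.* (508 ℕ.* h)) q≤)) ⟩
      c ℕ.* c ℕ.* (n ℕ.* (144 ℕ.* (h ℕ.* (170 ℕ.* n)) ℕ.+ n ℕ.* (508 ℕ.* h))) ≡⟨ collect (c ℕ.* c) n h ⟩
      c ℕ.* c ℕ.* (24988 ℕ.* h) ℕ.* n ℕ.* n                          ∎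
      where
      open ℕ.≤-Reasoning
      -- One factor h of 144 h² is traded for 170 n. Together with the off-diagonal error this
      -- yields 144 · 170 + 508 = 24988.
      q≤ = ℕ.≤-trans q≤144h² (ℕ.*-monoʳ-≤ 144 (ℕ.*-monoʳ-≤ h h≤170n))
      collect : ∀ c n h → c ℕ.* (n ℕ.* (144 ℕ.* (h ℕ.* (170 ℕ.* n)) ℕ.+ n ℕ.* (508 ℕ.* h))) ≡ c ℕ.* (24988 ℕ.* h) ℕ.* n ℕ.* n
      collect = ℕ.solve-∀

  commonNeighbours : List (Fin q) → List (Fin q)
  commonNeighbours Y = filter (λ z → all? (λ y → χ (z + y) ℤ.≟ 1ℤ) Y) U

  -- At a common neighbour of `Y` every character value is 1, so the sum equals the size of `Y` and
  -- the bias bound applies with c = 1.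
  few-common-neighbours : ∀ {Y} → Unique Y → h ℕ.≤ 170 ℕ.* length Y → length (commonNeighbours Y) ℕ.≤ t
  few-common-neighbours {Y} uY h≤ = few-biased 1 (s≤s z≤n) uY (Unique.filter⁺ common? (Unique.allFin⁺ q)) h≤ λ {z} z∈ →
    ≤-reflexive (≡.trans (length≡∑1 Y) (≡.trans
      (∑-cong-∈ Y (λ y∈ → ≡.sym (All.lookup (proj₂ (∈-filter⁻ common? {xs = U} z∈)) y∈))) (≡.sym (*-identityˡ _))))
    where
    common? = λ z → all? (λ y → χ (z + y) ℤ.≟ 1ℤ) Y

  neighboursIn : List (Fin q) → Fin q → List (Fin q)
  neighboursIn Y x = filter (λ y → χ (x + y) ℤ.≟ 1ℤ) Y

  Bad : List (Fin q) → Fin q → Set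
  Bad Y x = 3 ℕ.* length Y ℕ.< 4 ℕ.* length (neighboursIn Y x)

  bad? : ∀ Y x → Dec (Bad Y x)
  bad? Y x = 3 ℕ.* length Y ℕ.<? 4 ℕ.* length (neighboursIn Y x)

  -- A non-neighbour contributes at least -1, so a bad x has a character sum above 3n/4 - n/4 = n/2;
  -- this is the case c = 2, which accounts for the factor 4 in the lower bound on `t`.
  few-bad : ∀ {Y} → Unique Y → h ℕ.≤ 170 ℕ.* length Y → length (filter (bad? Y) U) ℕ.≤ t
  few-bad {Y} uY h≤ = few-biased 2 ℕ.≤-refl uY (Unique.filter⁺ (bad? Y) (Unique.allFin⁺ q)) h≤
    λ {x} x∈ → biased x (proj₂ (∈-filter⁻ (bad? Y) {xs = U} x∈))
    where
    n = length Y
    biased : ∀ x → Bad Y x → + n ≤ + 2 *ᶻ translates Y x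
    biased x bad = +-cancelʳ-≤ (+ 2 *ᶻ + n) (begin
      + n +ᶻ + 2 *ᶻ + n                                           ≡⟨ triple (+ n) ⟩
      + 3 *ᶻ + n                                                  ≡⟨ pos-* 3 n ⟨
      + (3 ℕ.* n)                                                 ≤⟨ +≤+ (ℕ.<⇒≤ bad) ⟩
      + (4 ℕ.* length (neighboursIn Y x))                         ≡⟨ pos-* 4 (length (neighboursIn Y x)) ⟩
      + 4 *ᶻ + length (neighboursIn Y x)                          ≡⟨ ≡.cong (+ 4 *ᶻ_) (∑-indicator (λ y → χ (x + y) ℤ.≟ 1ℤ) Y) ⟨
      + 4 *ᶻ ∑ Y (λ y → indicator (χ (x + y) ℤ.≟ 1ℤ))             ≡⟨ *-assoc (+ 2) (+ 2) _ ⟩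
      + 2 *ᶻ (+ 2 *ᶻ ∑ Y (λ y → indicator (χ (x + y) ℤ.≟ 1ℤ)))    ≡⟨ ≡.cong (+ 2 *ᶻ_) (∑-*ˡ Y (+ 2) (λ y → indicator (χ (x + y) ℤ.≟ 1ℤ))) ⟨
      + 2 *ᶻ ∑ Y (λ y → + 2 *ᶻ indicator (χ (x + y) ℤ.≟ 1ℤ))      ≤⟨ *-monoˡ-≤-nonNeg (+ 2) (∑-mono Y (λ y → pointwise (χ (x + y)) (-1≤χ (x + y)))) ⟩
      + 2 *ᶻ ∑ Y (λ y → χ (x + y) +ᶻ 1ℤ)                          ≡⟨ ≡.cong (+ 2 *ᶻ_) (≡.trans (∑-+ Y (λ y → χ (x + y)) (λ _ → 1ℤ)) (≡.cong (translates Y x +ᶻ_) (≡.sym (length≡∑1 Y)))) ⟩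
      + 2 *ᶻ (translates Y x +ᶻ + n)                              ≡⟨ *-distribˡ-+ (+ 2) (translates Y x) (+ n) ⟩
      + 2 *ᶻ translates Y x +ᶻ + 2 *ᶻ + n                         ∎)
      where
      open ≤-Reasoning
      triple : ∀ n → n +ᶻ + 2 *ᶻ n ≡ + 3 *ᶻ n
      triple = solve-∀
      pointwise : ∀ v → -1ℤ ≤ v → + 2 *ᶻ indicator (v ℤ.≟ 1ℤ) ≤ v +ᶻ 1ℤ
      pointwise v -1≤v with v ℤ.≟ 1ℤ
      ... | yes ≡.refl = ≤-refl
      ... | no _ = +-monoˡ-≤ 1ℤ -1≤v

  Good : List Pair → Set
  Good ps = ∀ {p} → p ∈ ps → DecomposesSquares F p

  private
    2^-mono : ∀ {m n} → m ℕ.≤ n → 2 ℕ.^ m ℕ.≤ 2 ℕ.^ n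
    2^-mono = ℕ.^-monoʳ-≤ 2

    empty-length : ∀ {A : Set} (xs : List A) → (∀ {x} → x ∈ xs → ⊥) → ∀ {n} → length xs ℕ.≤ n
    empty-length [] _ = z≤n
    empty-length (x ∷ xs) none = ⊥-elim (none (here ≡.refl))

  count-fixed-left : ∀ A ps → Unique ps → Good ps → (∀ {p} → p ∈ ps → A ≡ proj₁ p) → length ps ℕ.≤ 2 ℕ.^ t
  -- The lower bound on the size of A comes from a member of the list, so the empty list is treated
  -- apart.
  count-fixed-left A [] _ _ _ = z≤n
  count-fixed-left A ps@(p ∷ _) u good same with ≡.refl ← same (here ≡.refl) = begin
    length ps                                          ≤⟨ Unique-⊆⇒length≤ _≟ᵖ_ u inside-list ⟩
    length (map (A ,_) (subsets N))                    ≡⟨ length-map (A ,_) (subsets N) ⟩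
    length (subsets N)                                 ≡⟨ length-subsets N ⟩
    2 ℕ.^ length N                                     ≤⟨ 2^-mono (few-common-neighbours (elements-unique A) (size-left (good (here ≡.refl)))) ⟩
    2 ℕ.^ t                                            ∎
    where
    open ℕ.≤-Reasoning
    N = commonNeighbours (elements A)
    inside-list : ∀ {p} → p ∈ ps → p ∈ map (A ,_) (subsets N)
    inside-list {A′ , B} p∈ with ≡.refl ← same p∈ = ∈-map⁺ (A ,_) (subsets-complete N λ {b} b∈B →
      ∈-filter⁺ (λ z → all? (λ y → χ (z + y) ℤ.≟ 1ℤ) (elements A)) (∈-allFin b)
        (All.tabulate λ a∈ → squares-left (good p∈) a∈ (∈-elements⁺ b∈B)))

  count-inside : ∀ X ps → length X ℕ.≤ t → Unique ps → Good ps → (∀ {p} → p ∈ ps → ∀ {x} → x ∈ˢ proj₁ p → x ∈ X) →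
    length ps ℕ.≤ 2 ℕ.^ t ℕ.* 2 ℕ.^ t
  count-inside X ps X≤ u good inside = drop‿+≤+ (begin
    + length ps                                                               ≤⟨ cover same? ps (subsets X) (λ {p} p∈ → proj₁ p , subsets-complete X (inside p∈) , ≡.refl) ⟩
    ∑ (subsets X) (λ A → + length (filter (same? A) ps))                      ≤⟨ ∑-≤-length (subsets X) (+ (2 ℕ.^ t)) (λ {A} _ → +≤+ (fixed A)) ⟩
    + length (subsets X) *ᶻ + (2 ℕ.^ t)                                       ≡⟨ ≡.trans (≡.cong (λ l → + l *ᶻ + (2 ℕ.^ t)) (length-subsets X)) (≡.sym (pos-* (2 ℕ.^ length X) (2 ℕ.^ t))) ⟩
    + (2 ℕ.^ length X ℕ.* 2 ℕ.^ t)                                            ≤⟨ +≤+ (ℕ.*-monoˡ-≤ (2 ℕ.^ t) (2^-mono X≤)) ⟩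
    + (2 ℕ.^ t ℕ.* 2 ℕ.^ t)                                                   ∎)
    where
    open ≤-Reasoning
    same? : ∀ A (p : Pair) → Dec (A ≡ proj₁ p)
    same? A p = A ≟ˢ proj₁ p
    fixed : ∀ A → length (filter (same? A) ps) ℕ.≤ 2 ℕ.^ t
    fixed A = count-fixed-left A (filter (same? A) ps) (Unique.filter⁺ (same? A) u)
      (λ p∈ → good (proj₁ (∈-filter⁻ (same? A) {xs = ps} p∈))) (λ p∈ → proj₂ (∈-filter⁻ (same? A) {xs = ps} p∈))

  -- Either A consists of elements bad for Y, of which there are few, or choosing some x ∈ A that
  -- is not bad confines B to three quarters of Y.
  count-by-containers : ∀ r Y ps → Unique Y → length Y ℕ.* 3 ℕ.^ r ℕ.< 4 ℕ.^ r → Unique ps → Good ps →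
    (∀ {p} → p ∈ ps → ∀ {y} → y ∈ˢ proj₂ p → y ∈ Y) → length ps ℕ.≤ 2 ℕ.^ t ℕ.* 2 ℕ.^ t ℕ.* suc q ℕ.^ r
  -- At r = 0 the size hypothesis leaves only the empty `Y`, which contains no B with two elements;
  -- `r` therefore limits the number of shrinking steps.
  count-by-containers zero [] ps _ _ _ good B⊆Y = empty-length ps λ {p} p∈ →
    no-size (ℕ.≤-trans (proj₁ (proj₂ (good p∈))) (∣p∣≤length [] (proj₂ p) (B⊆Y p∈)))
    where
    no-size : 2 ℕ.≤ 0 → ⊥
    no-size ()
  count-by-containers zero (_ ∷ _) ps _ (s≤s ()) _ _ _
  count-by-containers (suc r) Y ps uY Y< u good B⊆Y = drop‿+≤+ (begin
    + length ps                                                     ≤⟨ cover R? ps options (λ p∈ → covered p∈) ⟩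
    ∑ options (λ o → + length (filter (R? o) ps))                   ≤⟨ ∑-≤-length options (+ (E ℕ.* suc q ℕ.^ r)) (λ {o} _ → +≤+ (option-bound o)) ⟩
    + length options *ᶻ + (E ℕ.* suc q ℕ.^ r)                       ≡⟨ ≡.trans (≡.cong (λ l → + l *ᶻ + (E ℕ.* suc q ℕ.^ r)) length-options) (≡.sym (pos-* (suc q) (E ℕ.* suc q ℕ.^ r))) ⟩
    + (suc q ℕ.* (E ℕ.* suc q ℕ.^ r))                               ≡⟨ ≡.cong +_ (rotate (suc q) E (suc q ℕ.^ r)) ⟩
    + (E ℕ.* (suc q ℕ.* suc q ℕ.^ r))                               ∎)
    where
    open ≤-Reasoning
    E = 2 ℕ.^ t ℕ.* 2 ℕ.^ t
    rotate : ∀ a b c → a ℕ.* (b ℕ.* c) ≡ b ℕ.* (a ℕ.* c)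
    rotate = ℕ.solve-∀
    -- `nothing` stands for the case that A consists of bad elements, `just x` for a chosen element
    -- of A that is not bad.
    options : List (Maybe (Fin q))
    options = nothing ∷ map just U
    length-options : length options ≡ suc q
    length-options = ≡.cong suc (≡.trans (length-map just U) (length-tabulate {n = q} id))
    R : Maybe (Fin q) → Pair → Set
    R nothing (A , B) = All (Bad Y) (elements A)
    R (just x) (A , B) = x ∈ˢ A × ¬ Bad Y x
    R? : ∀ o p → Dec (R o p)
    R? nothing (A , B) = all? (bad? Y) (elements A)
    R? (just x) (A , B) = (x ∈? A) ×-dec ¬? (bad? Y x)
    covered : ∀ {p} → p ∈ ps → ∃ λ o → o ∈ options × R o p
    covered {A , B} _ with all? (bad? Y) (elements A)
    ... | yes all-bad = nothing , here ≡.refl , all-bad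
    ... | no ¬all-bad with x , x∈ , ¬bad ← find (All.¬All⇒Any¬ (bad? Y) (elements A) ¬all-bad) =
      just x , there (∈-map⁺ just (∈-allFin x)) , ∈-elements⁻ x∈ , ¬bad
    filtered : ∀ o {p} → p ∈ filter (R? o) ps → p ∈ ps × R o p
    filtered o p∈ = ∈-filter⁻ (R? o) {xs = ps} p∈
    -- B stays inside every container, so containers never shrink below the size of B and the bound
    -- on bad elements remains available at each step.
    Y-large : ∀ {p} → p ∈ ps → h ℕ.≤ 170 ℕ.* length Y
    Y-large {A , B} p∈ = ℕ.≤-trans (size-right (good p∈)) (ℕ.*-monoʳ-≤ 170 (Unique-⊆⇒length≤ _≟_ (elements-unique B) (λ y∈ → B⊆Y p∈ (∈-elements⁻ y∈))))
    bad-bound : ∀ ps′ → (∀ {p} → p ∈ ps′ → p ∈ ps × R nothing p) → Unique ps′ → length ps′ ℕ.≤ E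
    bad-bound [] _ _ = z≤n
    bad-bound ps′@(p ∷ _) sub u′ = count-inside (filter (bad? Y) U) ps′ (few-bad uY (Y-large (proj₁ (sub (here ≡.refl))))) u′
      (λ p∈ → good (proj₁ (sub p∈))) (λ p∈ {x} x∈ → ∈-filter⁺ (bad? Y) (∈-allFin x) (All.lookup (proj₂ (sub p∈)) (∈-elements⁺ x∈)))
    shrink : ∀ x → ¬ Bad Y x → length (neighboursIn Y x) ℕ.* 3 ℕ.^ r ℕ.< 4 ℕ.^ r
    shrink x ¬bad = ℕ.*-cancelˡ-< 4 _ _ (ℕ.≤-<-trans (ℕ.≤-trans (ℕ.≤-reflexive (≡.sym (ℕ.*-assoc 4 (length (neighboursIn Y x)) (3 ℕ.^ r))))
      (ℕ.≤-trans (ℕ.*-monoˡ-≤ (3 ℕ.^ r) (ℕ.≮⇒≥ ¬bad)) (ℕ.≤-reflexive (≡.trans (ℕ.*-assoc 3 (length Y) (3 ℕ.^ r)) (rotate 3 (length Y) (3 ℕ.^ r)))))) Y<)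
    option-bound : ∀ o → length (filter (R? o) ps) ℕ.≤ E ℕ.* suc q ℕ.^ r
    option-bound nothing = ℕ.≤-trans (bad-bound (filter (R? nothing) ps) (filtered nothing) (Unique.filter⁺ (R? nothing) u))
      (ℕ.≤-trans (ℕ.≤-reflexive (≡.sym (ℕ.*-identityʳ E))) (ℕ.*-monoʳ-≤ E (ℕ.m^n>0 (suc q) r)))
    option-bound (just x) with bad? Y x
    ... | yes bad = empty-length (filter (R? (just x)) ps) (λ p∈ → proj₂ (proj₂ (filtered (just x) p∈)) bad)
    ... | no ¬bad = count-by-containers r (neighboursIn Y x) (filter (R? (just x)) ps) (Unique.filter⁺ (λ y → χ (x + y) ℤ.≟ 1ℤ) uY) (shrink x ¬bad)
      (Unique.filter⁺ (R? (just x)) u) (λ p∈ → good (proj₁ (filtered (just x) p∈)))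
      (λ p∈ {y} y∈ → ∈-filter⁺ (λ y → χ (x + y) ℤ.≟ 1ℤ) (B⊆Y (proj₁ (filtered (just x) p∈)) y∈)
        (squares-right (good (proj₁ (filtered (just x) p∈))) (∈-elements⁺ y∈) (∈-elements⁺ (proj₁ (proj₂ (filtered (just x) p∈))))))

open import Data.Nat using (ℕ; _≤_; _*_; _^_)
open import Data.Nat.Properties using (m≤m+n; ≤-refl)
open import Data.Nat.Divisibility using (_∣_)
open import Data.Fin.Subset using (Subset)
open import Data.Product using (∃; _×_; _,_)
open import Data.List using (List; length)
open import Data.List.Relation.Unary.All using (All)
open import Data.List.Relation.Unary.Unique.Propositional using (Unique)
open import Relation.Nullary using (¬_)

-- Numerical estimates and small fields.

module Assembly where
  open import Data.Nat using (zero; suc; _+_; _<_; z≤n; s≤s; >-nonZero)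
  open import Data.Nat.Properties
  open import Data.Nat.Divisibility using (divides)
  open import Data.Nat.Tactic.RingSolver using (solve-∀)
  open import Data.Fin using (Fin)
  import Data.Vec.Properties as Vec
  import Data.Bool.Properties as Bool
  import Data.Product.Properties as Product
  open import Data.List using (allFin; cartesianProductWith; map; _∷_; [])
  open import Data.List.Properties using (length-tabulate; length-map; length-++)
  open import Data.List.Membership.Propositional using (_∈_)
  open import Data.List.Membership.Propositional.Properties using (∈-allFin; ∈-cartesianProductWith⁺)
  import Data.List.Relation.Unary.All as All
  open import Data.List.Relation.Unary.Unique.Propositional.Properties using (allFin⁺)
  open import Data.Product using (proj₁; proj₂)
  open import Data.Sum using (_⊎_; inj₁; inj₂)
  open import Function using (id)
  open import Relation.Nullary using (yes; no; contradiction)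
  open import Relation.Binary.PropositionalEquality hiding ([_])
  open Sums using (Unique-⊆⇒length≤)
  open SubsetLists using (subsets; subsets-complete; length-subsets)
  open ≤-Reasoning

  parity : ∀ n → (∃ λ d → n ≡ d + d) ⊎ (∃ λ d → n ≡ suc (d + d))
  parity zero = inj₁ (0 , refl)
  parity (suc n) with parity n
  ... | inj₁ (d , refl) = inj₂ (d , refl)
  ... | inj₂ (d , refl) = inj₁ (suc d , cong suc (sym (+-suc d d)))

  odd-form : ∀ {q} → ¬ (2 ∣ q) → ∃ λ d → q ≡ suc (d + d)
  odd-form {q} odd with parity q
  ... | inj₁ (d , refl) = contradiction (divides d (double d)) odd
    where
    double : ∀ d → d + d ≡ d * 2
    double = solve-∀
  ... | inj₂ p = p

  -- `h` is the integer part of √(q/36). The 36 is what `V-bound` requires, and h ≥ 1 then also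
  -- gives q ≤ 144 h².
  scaled-root : ∀ q → ∃ λ h → 36 * (h * h) ≤ q × q < 36 * (suc h * suc h)
  scaled-root zero = 0 , z≤n , s≤s z≤n
  scaled-root (suc q) with scaled-root q
  ... | h , lower , upper with suc q <? 36 * (suc h * suc h)
  ...   | yes p = h , m≤n⇒m≤1+n lower , p
  ...   | no ¬p = suc h , ≮⇒≥ ¬p , ≤-<-trans upper (*-monoʳ-< 36 (*-mono-< (n<1+n (suc h)) (n<1+n (suc h))))

  square-reflects-≤ : ∀ {m n} → m * m ≤ n * n → m ≤ n
  square-reflects-≤ {m} {n} p with m ≤? n
  ... | yes m≤n = m≤n
  ... | no m≰n = contradiction p (<⇒≱ (*-mono-< (≰⇒> m≰n) (≰⇒> m≰n)))

  n<2^n : ∀ n → suc n ≤ 2 ^ n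
  n<2^n zero = s≤s z≤n
  n<2^n (suc n) = +-mono-≤ (m^n>0 2 n) (≤-trans (n<2^n n) (m≤m+n (2 ^ n) 0))

  dyadic : ∀ h → 1 ≤ h → ∃ λ w → h ≤ 2 ^ w × 2 ^ w ≤ 2 * h
  dyadic (suc zero) _ = 0 , s≤s z≤n , s≤s z≤n
  dyadic (suc (suc h)) _ with dyadic (suc h) (s≤s z≤n)
  ... | w , lower , upper with suc (suc h) ≤? 2 ^ w
  ...   | yes p = w , p , ≤-trans upper (*-monoʳ-≤ 2 (n≤1+n (suc h)))
  ...   | no ¬p = suc w , ≤-trans (+-mono-≤ (s≤s (z≤n {h})) (≤-refl {suc h})) (≤-trans (≤-reflexive (two (suc h))) (*-monoʳ-≤ 2 lower)) , *-monoʳ-≤ 2 (m≤n⇒m≤1+n (≤-pred (≰⇒> ¬p)))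
    where
    two : ∀ x → x + x ≡ 2 * x
    two = solve-∀

  -- Applied to the binary logarithm of h, this is the estimate that log² q is of lower order than
  -- √q, so the choices made along the container steps fit into exp(O(h)).
  n²≤4*2^n : ∀ n → n * n ≤ 4 * 2 ^ n
  n²≤4*2^n zero = z≤n
  n²≤4*2^n (suc n) = begin
    suc n * suc n                  ≤⟨ m≤m+n _ 1 ⟩
    suc n * suc n + 1              ≡⟨ expand n ⟩
    n * n + 2 * suc n              ≤⟨ +-mono-≤ (n²≤4*2^n n) (*-monoʳ-≤ 2 (n<2^n n)) ⟩
    4 * 2 ^ n + 2 * 2 ^ n          ≤⟨ +-monoʳ-≤ (4 * 2 ^ n) (*-monoˡ-≤ (2 ^ n) (m≤m+n 2 2)) ⟩
    4 * 2 ^ n + 4 * 2 ^ n          ≡⟨ collect (2 ^ n) ⟩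
    4 * (2 * 2 ^ n)                ∎
    where
    expand : ∀ n → suc n * suc n + 1 ≡ n * n + 2 * suc n
    expand = solve-∀
    collect : ∀ x → 4 * x + 4 * x ≡ 4 * (2 * x)
    collect = solve-∀

  -- v is about log₂ q and h is about √q.
  few-steps : ∀ {q} h → 1 ≤ h → q ≤ 144 * (h * h) → ∃ λ v → q < 2 ^ v × v * (3 * v) ≤ 1056 * h
  few-steps {q} h 1≤h q≤ with w , lower , upper ← dyadic h 1≤h = v , q<2^v , (begin
    v * (3 * v)                              ≡⟨ expand w ⟩
    192 + 96 * w + 12 * (w * w)              ≤⟨ +-mono-≤ (+-mono-≤ (*-monoʳ-≤ 192 1≤h) (*-monoʳ-≤ 96 (≤-trans (n≤n² w) w²≤8h))) (*-monoʳ-≤ 12 w²≤8h) ⟩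
    192 * h + 96 * (8 * h) + 12 * (8 * h)    ≡⟨ collect h ⟩
    1056 * h                                 ∎)
    where
    -- With h ≤ 2^w one has q ≤ 144 · 2^(2w), and 144 is below 2^8.
    v = 8 + (w + w)
    expand : ∀ w → (8 + (w + w)) * (3 * (8 + (w + w))) ≡ 192 + 96 * w + 12 * (w * w)
    expand = solve-∀
    collect : ∀ h → 192 * h + 96 * (8 * h) + 12 * (8 * h) ≡ 1056 * h
    collect = solve-∀
    w²≤8h : w * w ≤ 8 * h
    w²≤8h = ≤-trans (n²≤4*2^n w) (≤-trans (*-monoʳ-≤ 4 upper) (≤-reflexive (eight h)))
      where
      eight : ∀ h → 4 * (2 * h) ≡ 8 * h
      eight = solve-∀
    n≤n² : ∀ n → n ≤ n * n
    n≤n² zero = z≤n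
    n≤n² (suc n) = m≤m+n (suc n) (n * suc n)
    q<2^v : q < 2 ^ v
    q<2^v = begin-strict
      q                            ≤⟨ q≤ ⟩
      144 * (h * h)                ≤⟨ *-monoʳ-≤ 144 (*-mono-≤ lower lower) ⟩
      144 * (2 ^ w * 2 ^ w)        <⟨ *-monoˡ-< (2 ^ w * 2 ^ w) {{>-nonZero (*-mono-≤ (m^n>0 2 w) (m^n>0 2 w))}} (m≤m+n 145 111) ⟩
      256 * (2 ^ w * 2 ^ w)        ≡⟨ cong (256 *_) (^-distribˡ-+-* 2 w w) ⟨
      256 * 2 ^ (w + w)            ≡⟨ ^-distribˡ-+-* 2 8 (w + w) ⟨
      2 ^ (8 + (w + w))            ∎

  ^-distribʳ-* : ∀ m n k → m ^ k * n ^ k ≡ (m * n) ^ k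
  ^-distribʳ-* m n zero = refl
  ^-distribʳ-* m n (suc k) = trans (interchange m (m ^ k) n (n ^ k)) (cong (m * n *_) (^-distribʳ-* m n k))
    where
    interchange : ∀ a b c d → (a * b) * (c * d) ≡ (a * c) * (b * d)
    interchange = solve-∀

  -- Three steps shrink the container by 27/64, which is less than one half, so 3v steps outweigh q
  -- < 2^v.
  shrinks-below-one : ∀ {q} v → q < 2 ^ v → q * 3 ^ (3 * v) < 4 ^ (3 * v)
  shrinks-below-one {q} v q< = begin-strict
    q * 3 ^ (3 * v)        ≡⟨ cong (q *_) (^-*-assoc 3 3 v) ⟨
    q * 27 ^ v             <⟨ *-monoˡ-< (27 ^ v) {{>-nonZero (m^n>0 27 v)}} q< ⟩
    2 ^ v * 27 ^ v         ≡⟨ ^-distribʳ-* 2 27 v ⟩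
    54 ^ v                 ≤⟨ ^-monoˡ-≤ v (m≤m+n 54 10) ⟩
    64 ^ v                 ≡⟨ ^-*-assoc 4 3 v ⟩
    4 ^ (3 * v)            ∎

  trivial-count : ∀ {q} (ps : List (Subset q × Subset q)) → Unique ps → length ps ≤ 2 ^ (q + q)
  trivial-count {q} ps u = begin
    length ps                                                   ≤⟨ Unique-⊆⇒length≤ (Product.≡-dec (Vec.≡-dec Bool._≟_) (Vec.≡-dec Bool._≟_)) u
                                                                     (λ {p} _ → ∈-cartesianProductWith⁺ _,_ (all-subsets (proj₁ p)) (all-subsets (proj₂ p))) ⟩
    length (cartesianProductWith _,_ S S)                       ≡⟨ length-product S S ⟩
    length S * length S                                         ≡⟨ cong₂ _*_ length-S length-S ⟩
    2 ^ q * 2 ^ q                                               ≡⟨ ^-distribˡ-+-* 2 q q ⟨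
    2 ^ (q + q)                                                 ∎
    where
    S = subsets (allFin q)
    all-subsets : ∀ A → A ∈ S
    all-subsets A = subsets-complete (allFin q) (λ {x} _ → ∈-allFin x)
    length-S : length S ≡ 2 ^ q
    length-S = trans (length-subsets (allFin q)) (cong (2 ^_) (length-tabulate {n = q} id))
    length-product : ∀ {A B : Set} (xs : List A) (ys : List B) → length (cartesianProductWith _,_ xs ys) ≡ length xs * length ys
    length-product [] ys = refl
    length-product (x ∷ xs) ys = trans (length-++ (map (x ,_) ys)) (cong₂ _+_ (length-map (x ,_) ys) (length-product xs ys))

  main-count : ∀ q (F : FiniteFieldOn q) e → q ≡ suc (suc (suc e) + suc (suc e)) → ∀ h → 1 ≤ h → 36 * (h * h) ≤ q → q ≤ 144 * (h * h) →
    ∀ t → 4 * (24988 * h) ≤ t → ∀ (ps : List (Subset q × Subset q)) → Unique ps → All (DecomposesSquares F) ps →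
    ∀ v m → q < 2 ^ v → v * (3 * v) ≤ m → length ps ≤ 2 ^ (t + t + m)
  main-count q F e q≡ h 1≤h 36h²≤q q≤144h² t t-large ps u good v m q<2^v steps = begin
    length ps                                     ≤⟨ Counting.count-by-containers F χ h 1≤h 36h²≤q q≤144h² small 1≢-1 t t-large (3 * v) (allFin q) ps (allFin⁺ q)
                                                       (≤-<-trans (≤-reflexive (cong (_* 3 ^ (3 * v)) (length-tabulate {n = q} id))) (shrinks-below-one v q<2^v))
                                                       u (All.lookup good) (λ _ {y} _ → ∈-allFin y) ⟩
    2 ^ t * 2 ^ t * suc q ^ (3 * v)               ≤⟨ *-monoʳ-≤ (2 ^ t * 2 ^ t) (^-monoˡ-≤ (3 * v) q<2^v) ⟩
    2 ^ t * 2 ^ t * (2 ^ v) ^ (3 * v)             ≡⟨ cong₂ _*_ (sym (^-distribˡ-+-* 2 t t)) (^-*-assoc 2 v (3 * v)) ⟩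
    2 ^ (t + t) * 2 ^ (v * (3 * v))               ≡⟨ ^-distribˡ-+-* 2 (t + t) (v * (3 * v)) ⟨
    2 ^ (t + t + v * (3 * v))                     ≤⟨ ^-monoʳ-≤ 2 (+-monoʳ-≤ (t + t) steps) ⟩
    2 ^ (t + t + m)                               ∎
    where
    χ = Character.χ F (suc (suc e)) q≡ (s≤s z≤n)
    1≢-1 = Character.1≢-1 F (suc (suc e)) q≡ (s≤s z≤n)
    small = CharacterSum.small-sums F e q≡ h 1≤h 36h²≤q q≤144h²

  collect-exponent : ∀ a b h → 4 * (a * h) + 4 * (a * h) + b * h ≡ (4 * a + 4 * a + b) * h
  collect-exponent = solve-∀

  large-case : ∀ q (F : FiniteFieldOn q) e → q ≡ suc (suc (suc e) + suc (suc e)) → ∀ h → 1 ≤ h → 36 * (h * h) ≤ q → q < 36 * (suc h * suc h) →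
    ∀ K → 4 * 24988 + 4 * 24988 + 1056 ≤ K → ∀ s → q ≤ s * s →
    ∀ (ps : List (Subset q × Subset q)) → Unique ps → All (DecomposesSquares F) ps → length ps ≤ 2 ^ (K * s)
  large-case q F e q≡ h 1≤h 36h²≤q q< K ≤K s q≤s² ps u good =
    ≤-trans (main-count q F e q≡ h 1≤h 36h²≤q q≤144h² (4 * (24988 * h)) ≤-refl ps u good (proj₁ steps) (1056 * h) (proj₁ (proj₂ steps)) (proj₂ (proj₂ steps)))
      (^-monoʳ-≤ 2 (≤-trans (≤-reflexive (collect-exponent 24988 1056 h)) (*-mono-≤ ≤K h≤s)))
    where
    q≤144h² : q ≤ 144 * (h * h)
    q≤144h² = ≤-trans (<⇒≤ q<) (≤-trans (*-monoʳ-≤ 36 (*-mono-≤ 1+h≤2h 1+h≤2h)) (≤-reflexive (form h)))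
      where
      1+h≤2h : suc h ≤ 2 * h
      1+h≤2h = ≤-trans (+-monoˡ-≤ h 1≤h) (+-monoʳ-≤ h (m≤m+n h 0))
      form : ∀ h → 36 * (2 * h * (2 * h)) ≡ 144 * (h * h)
      form = solve-∀
    steps = few-steps h 1≤h q≤144h²
    h≤s : h ≤ s
    h≤s = square-reflects-≤ (≤-trans (m≤m+n (h * h) (35 * (h * h))) (≤-trans 36h²≤q q≤s²))

  bound : ∀ K → 72 ≤ K → 4 * 24988 + 4 * 24988 + 1056 ≤ K → ∀ (q : ℕ) (F : FiniteFieldOn q) → ¬ (2 ∣ q) → ∀ (s : ℕ) → q ≤ s * s →
    ∀ (ps : List (Subset q × Subset q)) → Unique ps → All (DecomposesSquares F) ps → length ps ≤ 2 ^ (K * s)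
  bound K 72≤K ≤K q F odd s q≤s² ps u good with odd-form odd | scaled-root q
  -- Here q < 36, and the trivial exponent 2q is at most 72.
  ... | d , q≡ | zero , _ , q<36 = ≤-trans (trivial-count ps u) (^-monoʳ-≤ 2 (≤-trans (+-mono-≤ (<⇒≤ q<36) (<⇒≤ q<36))
        (≤-trans 72≤K (≤-trans (≤-reflexive (sym (*-identityʳ K))) (*-monoʳ-≤ K 1≤s)))))
    where
    1≤s : 1 ≤ s
    1≤s = ≰⇒> λ { z≤n → <⇒≱ {0} {q} (≤-trans (s≤s z≤n) (≤-reflexive (sym q≡))) q≤s² }
  ... | zero , q≡ | suc h , 36h²≤q , _ = contradiction (≤-trans 36h²≤q (≤-reflexive q≡))
        (<⇒≱ (≤-trans (m≤m+n 2 34) (*-monoʳ-≤ 36 (s≤s (z≤n {h + h * suc h})))))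
  ... | suc zero , q≡ | suc h , 36h²≤q , _ = contradiction (≤-trans 36h²≤q (≤-reflexive q≡))
        (<⇒≱ (≤-trans (m≤m+n 4 32) (*-monoʳ-≤ 36 (s≤s (z≤n {h + h * suc h})))))
  ... | suc (suc e) , q≡ | suc h , 36h²≤q , q< = large-case q F e q≡ (suc h) (s≤s z≤n) 36h²≤q q< K ≤K s q≤s² ps u good

theorem1p1 : ∃ λ (K : ℕ) → ∀ (q : ℕ) (F : FiniteFieldOn q) → ¬ (2 ∣ q) →
    ∀ (s : ℕ) → q ≤ s * s →
    ∀ (ps : List (Subset q × Subset q)) → Unique ps →
    All (DecomposesSquares F) ps → length ps ≤ 2 ^ (K * s)
-- 200960 = 8 · 24988 + 1056. The first term is twice the size bound 4 · 24988 h, once for the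
-- choices of A and once for those of B; the second pays for the container steps.
theorem1p1 = 200960 , Assembly.bound 200960 (m≤m+n 72 200888) ≤-refl
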